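{- $\mathrm{ZFC}$ interprets $\mathrm{SO}$; that is, there is a $\mathrm{ZFC}$-definable $L_{\mathrm{SO}}$-structure $\mathcal{A}$ such that $\mathrm{ZFC}\vdash \mathrm{SO}^{\mathcal{A}}$.
   Context: **The theory SO.** $L_{\mathrm{SO}}=\{\mathrm{Ord},\mathrm{SOrd},<,=,\in,\mathrm{G}\}$ is the first-order language with unary predicates $\mathrm{Ord}$ ("is an ordinal"), $\mathrm{SOrd}$ ("is a set of ordinals"), binary predicates $<,=,\in$ and a binary function symbol $\mathrm{G}$. Upper case letters $X,Y,P_i$ range over all objects, lower case Greek letters over objects satisfying $\mathrm{Ord}$, lower case Roman letters over objects satisfying $\mathrm{SOrd}$ (so $\forall\alpha\,\phi$ means $\forall\alpha(\mathrm{Ord}(\alpha)\to\phi)$, etc.). $\alpha\le\beta$ means $\alpha<\beta\lor\alpha=\beta$; $\exists^{=1}$ means "there is exactly one". $\max$ is the maximum with respect to $<$, and $(\alpha,\beta)<^*(\gamma,\delta)$ means: $\max(\alpha,\beta)<\max(\gamma,\delta)$, or the maxima are equal and $\alpha<\gamma$, or the maxima are equal and $\alpha=\gamma$ and $\beta<\delta$. The axioms of $\mathrm{SO}$ are: (SOR) $\forall X,Y\,((\mathrm{Ord}(X)\leftrightarrow\lnot\mathrm{SOrd}(X))\land(X<Y\to\mathrm{Ord}(X)\land\mathrm{Ord}(Y))\land(X\in Y\to\mathrm{Ord}(X)\land\mathrm{SOrd}(Y))\land\mathrm{Ord}(\mathrm{G}(X,Y)))$. (WO) $\forall\alpha,\beta,\gamma\,(\lnot\alpha<\alpha\land(\alpha<\beta\land\beta<\gamma\to\alpha<\gamma)\land(\alpha<\beta\lor\alpha=\beta\lor\beta<\alpha))\land\forall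 a(\exists\alpha(\alpha\in a)\to\exists\alpha(\alpha\in a\land\forall\beta(\beta<\alpha\to\lnot\beta\in a)))$. (INF) $\exists\alpha(\exists\beta(\beta<\alpha)\land\forall\beta(\beta<\alpha\to\exists\gamma(\beta<\gamma\land\gamma<\alpha)))$. (EXT) $\forall a,b(\forall\alpha(\alpha\in a\leftrightarrow\alpha\in b)\to a=b)$. (INI) $\forall\alpha\exists a\forall\beta(\beta<\alpha\leftrightarrow\beta\in a)$. (BOU) $\forall a\exists\alpha\forall\beta(\beta\in a\to\beta<\alpha)$. (GPF) $\forall\alpha,\beta,\gamma\,(\mathrm{G}(\beta,\gamma)\le\alpha\leftrightarrow\forall\delta,\epsilon((\delta,\epsilon)<^*(\beta,\gamma)\to\mathrm{G}(\delta,\epsilon)<\alpha))$. (SUR) $\forall\alpha\exists\beta,\gamma(\alpha=\mathrm{G}(\beta,\gamma))$. (SEP) for every $L_{\mathrm{SO}}$-formula $\phi(\alpha,P_1,\dots,P_n)$: $\forall P_1,\dots,P_n\forall a\exists b\forall\alpha(\alpha\in b\leftrightarrow\alpha\in a\land\phi(\alpha,P_1,\dots,P_n))$. (REP) for every $L_{\mathrm{SO}}$-formula $\phi(\alpha,\beta,P_1,\dots,P_n)$: $\forall P_1,\dots,P_n(\forall\xi,\zeta_1,\zeta_2(\phi(\xi,\zeta_1,\vec P)\land\phi(\xi,\zeta_2,\vec P)\to\zeta_1=\zeta_2)\to\forall a\exists b\forall\zeta(\zeta\in b\leftrightarrow\exists\xi\in a\,\phi(\xi,\zeta,\vec P)))$.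 (POW) $\forall a\exists b\forall z(\exists\alpha(\alpha\in z)\land\forall\alpha(\alpha\in z\to\alpha\in a)\to\exists^{=1}\xi\forall\beta(\beta\in z\leftrightarrow\mathrm{G}(\beta,\xi)\in b))$. **Interpretability.** Let $L_1,L_2$ be first-order languages and $T_1$ an $L_1$-theory. A $T_1$-definable $L_2$-structure $\mathcal{A}$ consists of $L_1$-formulas $\phi_u$ and $\phi_i$ for each non-logical symbol $i$ of $L_2$ and for $=$, such that: $\phi_u$ has exactly one free variable and $T_1\vdash\exists x\,\phi_u(x)$ (write $x\in U$ for $\phi_u(x)$); for an $n$-ary relation symbol $r$ (including $=$) $\phi_r$ has free variables $v_1,\dots,v_n$; for an $n$-ary function symbol $f$, $\phi_f$ has free variables $v_1,\dots,v_{n+1}$ and $T_1$ proves that for all $v_1,\dots,v_n\in U$ there is $v_{n+1}\in U$ with $\phi_f(v_1,\dots,v_{n+1})$, unique up to $\phi_=$; for a constant symbol $c$, $\phi_c$ has one free variable and $T_1$ proves that it is satisfied by an element of $U$, unique up to $\phi_=$; and $T_1$ proves that $\phi_=$ is on $U$ an equivalence relation respecting all relations and functions defined by the formulas of $\mathcal{A}$. For an $L_2$-formula $\psi$, $\psi^{\mathcal{A}}$ is the $L_1$-formula obtained by replacing each symbol (including $=$) by its defining formula (function terms being unravelled in the usual way by existential quantifiers over $U$) and restricting all quantifiers to $U$; $\Phi^{\mathcal{A}}=\{\phi^{\mathcal{A}}:\phi\in\Phi\}$. An $L_1$-theory $T_1$ interprets an $L_2$-theory $T_2$ iff there is a $T_1$-definable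 $L_2$-structure $\mathcal{A}$ with $T_1\vdash T_2^{\mathcal{A}}$. -}

module Defs where

open import Data.Fin using (Fin; zero; suc; _↑ˡ_; _↑ʳ_)
open import Data.List using (List; []; _∷_; map)
open import Data.List.Membership.Propositional using () renaming (_∈_ to _∈ᴸ_)
open import Data.Nat using (ℕ; zero; suc; _+_)
open import Data.Product using (Σ-syntax)
open import Data.Vec using (Vec; []; _∷_; lookup; tabulate)
open import Function using (_∘_)
open import Level using (0ℓ)
open import Relation.Unary using (Pred)

-- Symbols are indexed by arity.  Equality is a logical symbol and is
-- therefore not listed in a language.
record Language : Set₁ where
  field
    Rel : ℕ → Set
    Fun : ℕ → Set
open Language public

data Term (L : Language) (n : ℕ) : Set where
  var : Fin n → Term L n
  fun : ∀ {k} → Fun L k → Vec (Term L n) k → Term L n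

infix  8 _≐_
infixr 7 _∧_
infixr 6 _∨_
infixr 5 _⇒_
infix  4 _⇔_

-- Formulas whose free variables are among n de Bruijn indices.
data Formula (L : Language) (n : ℕ) : Set where
  rel : ∀ {k} → Rel L k → Vec (Term L n) k → Formula L n
  _≐_ : Term L n → Term L n → Formula L n
  ⊥   : Formula L n
  _∧_ _∨_ _⇒_ : Formula L n → Formula L n → Formula L n
  all ex : Formula L (suc n) → Formula L n

Sentence : Language → Set
Sentence L = Formula L 0

Theory : Language → Set₁
Theory L = Pred (Sentence L) 0ℓ

private variable
  L L₁ L₂ : Language
  k m n : ℕ

¬_ : Formula L n → Formula L n
¬ φ = φ ⇒ ⊥
infix 9 ¬_

_⇔_ : Formula L n → Formula L n → Formula L n
φ ⇔ ψ = (φ ⇒ ψ) ∧ (ψ ⇒ φ)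

⋀ : ∀ k → (Fin k → Formula L n) → Formula L n
⋀ zero    φ = ⊥ ⇒ ⊥
⋀ (suc k) φ = φ zero ∧ ⋀ k (φ ∘ suc)

lift : (Fin m → Fin n) → Fin (suc m) → Fin (suc n)
lift ρ zero    = zero
lift ρ (suc i) = suc (ρ i)

renameᵗ  : (Fin m → Fin n) → Term L m → Term L n
renameᵗ* : (Fin m → Fin n) → Vec (Term L m) k → Vec (Term L n) k
renameᵗ ρ (var i)    = var (ρ i)
renameᵗ ρ (fun f ts) = fun f (renameᵗ* ρ ts)
renameᵗ* ρ []       = []
renameᵗ* ρ (t ∷ ts) = renameᵗ ρ t ∷ renameᵗ* ρ ts

rename : (Fin m → Fin n) → Formula L m → Formula L n
rename ρ (rel r ts) = rel r (renameᵗ* ρ ts)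
rename ρ (s ≐ t)    = renameᵗ ρ s ≐ renameᵗ ρ t
rename ρ ⊥          = ⊥
rename ρ (φ ∧ ψ)    = rename ρ φ ∧ rename ρ ψ
rename ρ (φ ∨ ψ)    = rename ρ φ ∨ rename ρ ψ
rename ρ (φ ⇒ ψ)    = rename ρ φ ⇒ rename ρ ψ
rename ρ (all φ)    = all (rename (lift ρ) φ)
rename ρ (ex φ)     = ex (rename (lift ρ) φ)

liftˢ : (Fin m → Term L n) → Fin (suc m) → Term L (suc n)
liftˢ σ zero    = var zero
liftˢ σ (suc i) = renameᵗ suc (σ i)

substᵗ  : (Fin m → Term L n) → Term L m → Term L n
substᵗ* : (Fin m → Term L n) → Vec (Term L m) k → Vec (Term L n) k
substᵗ σ (var i)    = σ i
substᵗ σ (fun f ts) = fun f (substᵗ* σ ts)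
substᵗ* σ []       = []
substᵗ* σ (t ∷ ts) = substᵗ σ t ∷ substᵗ* σ ts

subst : (Fin m → Term L n) → Formula L m → Formula L n
subst σ (rel r ts) = rel r (substᵗ* σ ts)
subst σ (s ≐ t)    = substᵗ σ s ≐ substᵗ σ t
subst σ ⊥          = ⊥
subst σ (φ ∧ ψ)    = subst σ φ ∧ subst σ ψ
subst σ (φ ∨ ψ)    = subst σ φ ∨ subst σ ψ
subst σ (φ ⇒ ψ)    = subst σ φ ⇒ subst σ ψ
subst σ (all φ)    = all (subst (liftˢ σ) φ)
subst σ (ex φ)     = ex (subst (liftˢ σ) φ)

infix 10 _⟨_⟩ _[_]

_⟨_⟩ : Formula L m → Vec (Term L n) m → Formula L n
φ ⟨ ts ⟩ = subst (lookup ts) φ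

_[_] : Formula L (suc n) → Term L n → Formula L n
φ [ t ] = φ ⟨ t ∷ tabulate var ⟩

∃! : Formula L (suc n) → Formula L n
∃! φ = ex (φ ∧ all (rename (lift suc) φ ⇒ var zero ≐ var (suc zero)))

infix 3 _∣_⊢_ _⊢_

data _∣_⊢_ {L} (T : Theory L) {n} (Γ : List (Formula L n)) : Formula L n → Set where
  axiom  : ∀ {σ} → T σ → T ∣ Γ ⊢ rename (λ ()) σ
  hyp    : ∀ {φ} → φ ∈ᴸ Γ → T ∣ Γ ⊢ φ
  raa    : ∀ {φ} → T ∣ (¬ φ ∷ Γ) ⊢ ⊥ → T ∣ Γ ⊢ φ
  ∧-i    : ∀ {φ ψ} → T ∣ Γ ⊢ φ → T ∣ Γ ⊢ ψ → T ∣ Γ ⊢ φ ∧ ψ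
  ∧-e₁   : ∀ {φ ψ} → T ∣ Γ ⊢ φ ∧ ψ → T ∣ Γ ⊢ φ
  ∧-e₂   : ∀ {φ ψ} → T ∣ Γ ⊢ φ ∧ ψ → T ∣ Γ ⊢ ψ
  ∨-i₁   : ∀ {φ ψ} → T ∣ Γ ⊢ φ → T ∣ Γ ⊢ φ ∨ ψ
  ∨-i₂   : ∀ {φ ψ} → T ∣ Γ ⊢ ψ → T ∣ Γ ⊢ φ ∨ ψ
  ∨-e    : ∀ {φ ψ χ} → T ∣ Γ ⊢ φ ∨ ψ →
           T ∣ (φ ∷ Γ) ⊢ χ → T ∣ (ψ ∷ Γ) ⊢ χ → T ∣ Γ ⊢ χ
  ⇒-i    : ∀ {φ ψ} → T ∣ (φ ∷ Γ) ⊢ ψ → T ∣ Γ ⊢ φ ⇒ ψ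
  ⇒-e    : ∀ {φ ψ} → T ∣ Γ ⊢ φ ⇒ ψ → T ∣ Γ ⊢ φ → T ∣ Γ ⊢ ψ
  ∀-i    : ∀ {φ} → T ∣ map (rename suc) Γ ⊢ φ → T ∣ Γ ⊢ all φ
  ∀-e    : ∀ {φ} → T ∣ Γ ⊢ all φ → ∀ t → T ∣ Γ ⊢ φ [ t ]
  ∃-i    : ∀ {φ} t → T ∣ Γ ⊢ φ [ t ] → T ∣ Γ ⊢ ex φ
  ∃-e    : ∀ {φ χ} → T ∣ Γ ⊢ ex φ →
           T ∣ (φ ∷ map (rename suc) Γ) ⊢ rename suc χ → T ∣ Γ ⊢ χ
  ≐-refl : ∀ {t} → T ∣ Γ ⊢ t ≐ t
  ≐-subst : ∀ φ {s t} → T ∣ Γ ⊢ s ≐ t → T ∣ Γ ⊢ φ [ s ] → T ∣ Γ ⊢ φ [ t ]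
  -- Structures are nonempty.  This is not derivable from the other rules
  -- when n is 0 and there are no constants, as then there are no terms.
  nonempty : T ∣ Γ ⊢ ex (var zero ≐ var zero)

_⊢_ : Theory L → Sentence L → Set
T ⊢ σ = T ∣ [] ⊢ σ

-- The defining formulas of a definable structure.  In fun′ f the index
-- zero is the value v₍ₖ₊₁₎, and suc i is the i-th argument.
record Definition (L₁ L₂ : Language) : Set where
  field
    univ : Formula L₁ 1
    eq   : Formula L₁ 2
    rel′ : Rel L₂ k → Formula L₁ k
    fun′ : Fun L₂ k → Formula L₁ (suc k)

  _∼_ : Term L₁ n → Term L₁ n → Formula L₁ n
  s ∼ t = eq ⟨ s ∷ t ∷ [] ⟩
  infix 8 _∼_

  ∀ᵁ ∃ᵁ : Formula L₁ (suc n) → Formula L₁ n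
  ∀ᵁ φ = all (univ ⟨ var zero ∷ [] ⟩ ⇒ φ)
  ∃ᵁ φ = ex  (univ ⟨ var zero ∷ [] ⟩ ∧ φ)

  ∀ᵁ* : ∀ n → Formula L₁ n → Sentence L₁
  ∀ᵁ* zero    φ = φ
  ∀ᵁ* (suc n) φ = ∀ᵁ* n (∀ᵁ φ)

  -- ⟪ t ⟫ ρ χ says "χ holds of the value of t", where ρ sends the variables
  -- of t into the scope m, index zero of χ stands for the value of t, and
  -- the remaining indices of χ are those of the scope m.  ⟪ ts ⟫* does this
  -- for a vector of terms, whose values are the first k indices of χ.
  -- Only function symbols introduce quantifiers; a variable is its own value.
  ⟪_⟫  : Term L₂ n → (Fin n → Fin m) → Formula L₁ (suc m) → Formula L₁ m
  ⟪_⟫* : Vec (Term L₂ n) k → (Fin n → Fin m) → Formula L₁ (k + m) → Formula L₁ m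
  ⟪ var i ⟫ ρ χ = χ [ var (ρ i) ]
  ⟪_⟫ {m = m} (fun {k} f ts) ρ χ =
    ⟪ ts ⟫* ρ (∃ᵁ (rename (_↑ˡ m) (fun′ f) ∧ rename (lift (k ↑ʳ_)) χ))
  ⟪ [] ⟫*     ρ χ = χ
  ⟪_⟫* {k = suc k} (t ∷ ts) ρ χ = ⟪ ts ⟫* ρ (⟪ t ⟫ ((k ↑ʳ_) ∘ ρ) χ)

  infix 10 _ᴬ
  _ᴬ : Formula L₂ n → Formula L₁ n
  _ᴬ {n} (rel r ts) = ⟪ ts ⟫* (λ i → i) (rename (_↑ˡ n) (rel′ r))
  _ᴬ {n} (s ≐ t)    = ⟪ s ∷ t ∷ [] ⟫* (λ i → i) (rename (_↑ˡ n) eq)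
  ⊥ ᴬ       = ⊥
  (φ ∧ ψ) ᴬ = φ ᴬ ∧ ψ ᴬ
  (φ ∨ ψ) ᴬ = φ ᴬ ∨ ψ ᴬ
  (φ ⇒ ψ) ᴬ = φ ᴬ ⇒ ψ ᴬ
  (all φ) ᴬ = ∀ᵁ (φ ᴬ)
  (ex φ) ᴬ  = ∃ᵁ (φ ᴬ)

  Inhabited : Sentence L₁
  Inhabited = ex univ

  -- Constants are the case k = 0.
  Functional : Fun L₂ k → Sentence L₁
  Functional {k} f =
    ∀ᵁ* k (∃ᵁ (fun′ f ∧
      ∀ᵁ (rename (lift suc) (fun′ f) ⇒ var zero ∼ var (suc zero))))

  Reflexive Symmetric Transitive : Sentence L₁
  Reflexive  = ∀ᵁ* 1 (var zero ∼ var zero)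
  Symmetric  = ∀ᵁ* 2 (var zero ∼ var (suc zero) ⇒ var (suc zero) ∼ var zero)
  Transitive = ∀ᵁ* 3 (x ∼ y ∧ y ∼ z ⇒ x ∼ z)
    where
    x = var zero
    y = var (suc zero)
    z = var (suc (suc zero))

  -- Two disjoint k-tuples of variables.
  v w : Fin k → Term L₁ (k + k)
  v {k} i = var (i ↑ˡ k)
  w {k} i = var (k ↑ʳ i)

  at-v at-w : Formula L₁ k → Formula L₁ (k + k)
  at-v {k} = rename (_↑ˡ k)
  at-w {k} = rename (k ↑ʳ_)

  RelCongruent : Rel L₂ k → Sentence L₁
  RelCongruent {k} r =
    ∀ᵁ* (k + k) (⋀ k (λ i → v i ∼ w i) ⇒ (at-v (rel′ r) ⇔ at-w (rel′ r)))

  FunCongruent : Fun L₂ k → Sentence L₁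
  FunCongruent {k} f =
    ∀ᵁ* (suc k + suc k)
      (⋀ k (λ i → v (suc i) ∼ w (suc i)) ∧ at-v (fun′ f) ∧ at-w (fun′ f) ⇒
       v {suc k} zero ∼ w zero)

record DefinableStructure (T₁ : Theory L₁) (L₂ : Language) : Set where
  field
    definition : Definition L₁ L₂
  open Definition definition public
  field
    inhabited     : T₁ ⊢ Inhabited
    functional    : (f : Fun L₂ k) → T₁ ⊢ Functional f
    ∼-reflexive   : T₁ ⊢ Reflexive
    ∼-symmetric   : T₁ ⊢ Symmetric
    ∼-transitive  : T₁ ⊢ Transitive
    rel-congruent : (r : Rel L₂ k) → T₁ ⊢ RelCongruent r
    fun-congruent : (f : Fun L₂ k) → T₁ ⊢ FunCongruent f

_Interprets_ : Theory L₁ → Theory L₂ → Set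
_Interprets_ {L₂ = L₂} T₁ T₂ =
  Σ[ 𝒜 ∈ DefinableStructure T₁ L₂ ]
    (∀ {φ} → T₂ φ → T₁ ⊢ DefinableStructure._ᴬ 𝒜 φ)

-- m ⊑ n: the scope n extends the scope m by d more recent variables.  There
-- is one instance per distance, so that instance search never overlaps.
data _⊑_ (m : ℕ) : ℕ → Set where
  by : ∀ d → m ⊑ (d + m)

weaken : m ⊑ n → Fin m → Fin n
weaken (by d) = d ↑ʳ_

instance
  ⊑₀ : m ⊑ m
  ⊑₀ = by 0
  ⊑₁ : m ⊑ suc m
  ⊑₁ = by 1
  ⊑₂ : m ⊑ suc (suc m)
  ⊑₂ = by 2
  ⊑₃ : m ⊑ suc (suc (suc m))
  ⊑₃ = by 3
  ⊑₄ : m ⊑ suc (suc (suc (suc m)))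
  ⊑₄ = by 4
  ⊑₅ : m ⊑ suc (suc (suc (suc (suc m))))
  ⊑₅ = by 5

-- A variable (or tuple of variables) of the scope n, seen as a term in
-- whatever larger scope it is used in.
Var : Language → ℕ → Set
Var L n = ∀ {m} → ⦃ suc n ⊑ m ⦄ → Term L m

Vars : Language → ℕ → Set
Vars L n = ∀ {m} → ⦃ n ⊑ m ⦄ → Vec (Term L m) n

newest : Var L n
newest ⦃ le ⦄ = var (weaken le zero)

∀-syntax ∃-syntax ∃!-syntax : (Var L n → Formula L (suc n)) → Formula L n
∀-syntax  φ = all (φ newest)
∃-syntax  φ = ex (φ newest)
∃!-syntax φ = ∃! (φ newest)

∀*-syntax : ∀ n → (Vars L n → Formula L n) → Sentence L
∀*-syntax n φ = close n (φ (λ ⦃ le ⦄ → tabulate (var ∘ weaken le)))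
  where
  close : ∀ n → Formula L n → Sentence L
  close zero    ψ = ψ
  close (suc n) ψ = close n (all ψ)

infix 1 ∀-syntax ∃-syntax ∃!-syntax ∀*-syntax
syntax ∀-syntax  (λ x → φ) = ∀[ x ] φ
syntax ∃-syntax  (λ x → φ) = ∃[ x ] φ
syntax ∃!-syntax (λ x → φ) = ∃![ x ] φ
syntax ∀*-syntax n (λ p → φ) = ∀*[ p ∶ n ] φ

data Rel∈ : ℕ → Set where
  mem : Rel∈ 2

data NoFun : ℕ → Set where

L∈ : Language
L∈ = record { Rel = Rel∈ ; Fun = NoFun }

module ZFC-axioms where
  infix 8 _∈_
  _∈_ : Term L∈ n → Term L∈ n → Formula L∈ n
  x ∈ y = rel mem (x ∷ y ∷ [])

  data ZFC : Theory L∈ where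

    extensionality : ZFC (
      ∀[ x ] ∀[ y ] ((∀[ z ] (z ∈ x ⇔ z ∈ y)) ⇒ x ≐ y))

    foundation : ZFC (
      ∀[ x ] ((∃[ y ] y ∈ x) ⇒ (∃[ y ] (y ∈ x ∧ ¬ (∃[ z ] (z ∈ x ∧ z ∈ y))))))

    pairing : ZFC (
      ∀[ x ] ∀[ y ] ∃[ p ] ∀[ z ] (z ∈ p ⇔ z ≐ x ∨ z ≐ y))

    union : ZFC (
      ∀[ x ] ∃[ u ] ∀[ z ] (z ∈ u ⇔ (∃[ y ] (y ∈ x ∧ z ∈ y))))

    powerset : ZFC (
      ∀[ x ] ∃[ p ] ∀[ y ] (y ∈ p ⇔ (∀[ z ] (z ∈ y ⇒ z ∈ x))))

    infinity : ZFC (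
      ∃[ i ] ((∃[ e ] (e ∈ i ∧ (∀[ z ] ¬ (z ∈ e)))) ∧
              (∀[ x ] (x ∈ i ⇒
                (∃[ s ] (s ∈ i ∧ (∀[ z ] (z ∈ s ⇔ z ∈ x ∨ z ≐ x))))))))

    separation : ∀ n (φ : Formula L∈ (1 + n)) → ZFC (
      ∀*[ p ∶ n ] ∀[ a ] ∃[ b ] ∀[ x ] (x ∈ b ⇔ x ∈ a ∧ φ ⟨ x ∷ p ⟩))

    replacement : ∀ n (φ : Formula L∈ (2 + n)) → ZFC (
      ∀*[ p ∶ n ]
        ((∀[ x ] ∀[ y ] ∀[ z ] (φ ⟨ x ∷ y ∷ p ⟩ ∧ φ ⟨ x ∷ z ∷ p ⟩ ⇒ y ≐ z)) ⇒
         (∀[ a ] ∃[ b ] ∀[ y ] (y ∈ b ⇔ (∃[ x ] (x ∈ a ∧ φ ⟨ x ∷ y ∷ p ⟩))))))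

    -- Every family of nonempty, pairwise disjoint sets has a transversal.
    choice : ZFC (
      ∀[ f ] ((∀[ x ] (x ∈ f ⇒ (∃[ z ] z ∈ x))) ∧
              (∀[ x ] ∀[ y ] (x ∈ f ∧ y ∈ f ∧ (∃[ z ] (z ∈ x ∧ z ∈ y)) ⇒ x ≐ y)) ⇒
              (∃[ c ] ∀[ x ] (x ∈ f ⇒ (∃![ z ] (z ∈ x ∧ z ∈ c))))))

open ZFC-axioms public using (ZFC)

data RelSO : ℕ → Set where
  ord sord : RelSO 1
  lt mem   : RelSO 2

data FunSO : ℕ → Set where
  g : FunSO 2

LSO : Language
LSO = record { Rel = RelSO ; Fun = FunSO }

module SO-axioms where
  infix 8 _<_ _≤_ _∈_ _,_<*_,_

  Ord SOrd : Term LSO n → Formula LSO n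
  Ord t  = rel ord (t ∷ [])
  SOrd t = rel sord (t ∷ [])

  _<_ _≤_ _∈_ : Term LSO n → Term LSO n → Formula LSO n
  s < t = rel lt (s ∷ t ∷ [])
  s ≤ t = s < t ∨ s ≐ t
  s ∈ t = rel mem (s ∷ t ∷ [])

  G : Term LSO n → Term LSO n → Term LSO n
  G s t = fun g (s ∷ t ∷ [])

  ∀ᵒ-syntax ∃ᵒ-syntax ∃!ᵒ-syntax ∀ˢ-syntax ∃ˢ-syntax :
    (Var LSO n → Formula LSO (suc n)) → Formula LSO n
  ∀ᵒ-syntax φ  = ∀[ X ] (Ord X ⇒ φ X)
  ∃ᵒ-syntax φ  = ∃[ X ] (Ord X ∧ φ X)
  ∃!ᵒ-syntax φ = ∃![ X ] (Ord X ∧ φ X)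
  ∀ˢ-syntax φ  = ∀[ X ] (SOrd X ⇒ φ X)
  ∃ˢ-syntax φ  = ∃[ X ] (SOrd X ∧ φ X)

  infix 1 ∀ᵒ-syntax ∃ᵒ-syntax ∃!ᵒ-syntax ∀ˢ-syntax ∃ˢ-syntax
  syntax ∀ᵒ-syntax  (λ α → φ) = ∀ᵒ[ α ] φ
  syntax ∃ᵒ-syntax  (λ α → φ) = ∃ᵒ[ α ] φ
  syntax ∃!ᵒ-syntax (λ α → φ) = ∃!ᵒ[ α ] φ
  syntax ∀ˢ-syntax  (λ a → φ) = ∀ˢ[ a ] φ
  syntax ∃ˢ-syntax  (λ a → φ) = ∃ˢ[ a ] φ

  -- μ = max(α, β)
  Max : Term LSO n → Term LSO n → Term LSO n → Formula LSO n
  Max μ α β = (μ ≐ α ∧ β ≤ α) ∨ (μ ≐ β ∧ α ≤ β)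

  _,_<*_,_ : (α β γ δ : Term LSO n) → Formula LSO n
  _,_<*_,_ {n} α β γ δ =
    ∃ᵒ[ μ ] ∃ᵒ[ ν ] (Max μ (↑ α) (↑ β) ∧ Max ν (↑ γ) (↑ δ) ∧
      (μ < ν ∨
       (μ ≐ ν ∧ ↑ α < ↑ γ) ∨
       (μ ≐ ν ∧ ↑ α ≐ ↑ γ ∧ ↑ β < ↑ δ)))
    where
    ↑ : Term LSO n → Term LSO (2 + n)
    ↑ = renameᵗ (2 ↑ʳ_)

  data SO : Theory LSO where

    SOR : SO (
      ∀[ X ] ∀[ Y ] (
        (Ord X ⇔ ¬ SOrd X) ∧
        (X < Y ⇒ Ord X ∧ Ord Y) ∧
        (X ∈ Y ⇒ Ord X ∧ SOrd Y) ∧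
        Ord (G X Y)))

    WO : SO (
      ∀ᵒ[ α ] ∀ᵒ[ β ] ∀ᵒ[ γ ] (
        (¬ (α < α) ∧
         (α < β ∧ β < γ ⇒ α < γ) ∧
         (α < β ∨ α ≐ β ∨ β < α)) ∧
        (∀ˢ[ a ] ((∃ᵒ[ α ] α ∈ a) ⇒
          (∃ᵒ[ α ] (α ∈ a ∧ (∀ᵒ[ β ] (β < α ⇒ ¬ (β ∈ a)))))))))

    INF : SO (
      ∃ᵒ[ α ] ((∃ᵒ[ β ] β < α) ∧
               (∀ᵒ[ β ] (β < α ⇒ (∃ᵒ[ γ ] (β < γ ∧ γ < α))))))

    EXT : SO (
      ∀ˢ[ a ] ∀ˢ[ b ] ((∀ᵒ[ α ] (α ∈ a ⇔ α ∈ b)) ⇒ a ≐ b))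

    INI : SO (
      ∀ᵒ[ α ] ∃ˢ[ a ] ∀ᵒ[ β ] (β < α ⇔ β ∈ a))

    BOU : SO (
      ∀ˢ[ a ] ∃ᵒ[ α ] ∀ᵒ[ β ] (β ∈ a ⇒ β < α))

    GPF : SO (
      ∀ᵒ[ α ] ∀ᵒ[ β ] ∀ᵒ[ γ ] (
        G β γ ≤ α ⇔
        (∀ᵒ[ δ ] ∀ᵒ[ ε ] (δ , ε <* β , γ ⇒ G δ ε < α))))

    SUR : SO (
      ∀ᵒ[ α ] ∃ᵒ[ β ] ∃ᵒ[ γ ] α ≐ G β γ)

    SEP : ∀ n (φ : Formula LSO (1 + n)) → SO (
      ∀*[ P ∶ n ] ∀ˢ[ a ] ∃ˢ[ b ] ∀ᵒ[ α ] (α ∈ b ⇔ α ∈ a ∧ φ ⟨ α ∷ P ⟩))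

    REP : ∀ n (φ : Formula LSO (2 + n)) → SO (
      ∀*[ P ∶ n ]
        ((∀ᵒ[ ξ ] ∀ᵒ[ ζ₁ ] ∀ᵒ[ ζ₂ ]
            (φ ⟨ ξ ∷ ζ₁ ∷ P ⟩ ∧ φ ⟨ ξ ∷ ζ₂ ∷ P ⟩ ⇒ ζ₁ ≐ ζ₂)) ⇒
         (∀ˢ[ a ] ∃ˢ[ b ] ∀ᵒ[ ζ ]
            (ζ ∈ b ⇔ (∃ᵒ[ ξ ] (ξ ∈ a ∧ φ ⟨ ξ ∷ ζ ∷ P ⟩))))))

    POW : SO (
      ∀ˢ[ a ] ∃ˢ[ b ] ∀ˢ[ z ] (
        (∃ᵒ[ α ] α ∈ z) ∧ (∀ᵒ[ α ] (α ∈ z ⇒ α ∈ a)) ⇒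
        (∃!ᵒ[ ξ ] ∀ᵒ[ β ] (β ∈ z ⇔ G β ξ ∈ b))))

open SO-axioms public using (SO)

{-# OPTIONS --safe #-}

-- Derivability in ZFC is replaced by truth in all models, using a constructive
-- Henkin construction (after Krivine): if falsum may be interpreted by any set,
-- completeness needs no classical logic in the metatheory.  Henkin constants
-- also provide every model with Skolem functions.
--
-- In a model of ZFC the ordinals of SO are the ordinals, and the sets of
-- ordinals of SO are the sets that are not ordinals, two of them being equal if
-- they have the same ordinal elements.  Pairs of ordinals are enumerated by
-- transfinite recursion, always taking the <*-least pair that has not occurred;
-- G is the inverse of this enumeration, which makes GPF and SUR immediate.  For
-- POW, choice gives in the same way an enumeration (F ξ : ξ < κ) of the nonempty
-- sets of ordinals contained in a, and b is { G(β, ξ) : ξ < κ, β ∈ F ξ }.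
module Submission where

open import Defs

open import Data.Empty using () renaming (⊥ to Empty)
open import Data.Fin using (Fin; zero; suc; toℕ; _↑ˡ_; _↑ʳ_)
open import Data.Fin.Patterns using (0F; 1F; 2F; 3F)
open import Data.List using (List; []; _∷_)
open import Data.List.Relation.Unary.Any using (here; there)
open import Data.Nat using (ℕ; zero; suc; _+_; _⊔_; _≤_; s≤s)
open import Data.Nat.Properties using (+-comm; +-suc; ≤-refl; ≤-trans; m⊔n≤o⇒m≤o; m⊔n≤o⇒n≤o; <⇒≢; n≤1+n; _≟_)
open import Data.Product using (_×_; _,_; proj₁; proj₂; Σ; Σ-syntax; uncurry) renaming (map to map×)
open import Data.Sum using (_⊎_; inj₁; inj₂)
open import Data.Unit using (⊤; tt)
open import Data.Vec using (Vec; []; _∷_; lookup; tabulate; _++_; splitAt; head; tail; map)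
open import Data.Vec.Properties using (lookup∘tabulate; lookup-++ˡ; lookup-++ʳ)
open import Data.Vec.Relation.Binary.Pointwise.Inductive as Pointwise using (Pointwise; []; _∷_)
open import Data.Vec.Relation.Unary.All using ([]; _∷_) renaming (All to Allⱽ)
open import Data.Vec.Relation.Unary.All.Properties using (lookup⁺)
open import Function using (_∘_; id)
open import Relation.Binary.PropositionalEquality using (_≡_; _≢_; refl; sym; trans; cong; cong₂) renaming (subst to transport)
open import Relation.Nullary using (yes; no)
open import Relation.Nullary.Negation using (contradiction)

-- An interpretation consists of formulas fixed once and for all, whereas transfinite recursion and
-- the choice of well-orderings take place inside an arbitrary model. Every construction therefore
-- yields a formula together with its meaning, and the formula never mentions the model: a Skolem
-- function may supply the value of an operation, but not its graph. The formulas obtained in two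
-- models are then equal by computation, which is what finally ties the interpretation to each
-- model.
--
-- On the side of completeness the obstacle is that a maximal theory cannot be built by deciding
-- consistency. Each formula is instead added under a condition that is never decided; a derivation
-- is a finite tree, so it can be inspected for uses of the formula, and every use carries a proof
-- of the condition.

infix 1 _⇿_
_⇿_ : Set → Set → Set
A ⇿ B = (A → B) × (B → A)

⇿-refl : ∀ {A} → A ⇿ A
⇿-refl = id , id

⇿-sym : ∀ {A B} → A ⇿ B → B ⇿ A
⇿-sym (to , from) = from , to

infixr 4 _⨾_
_⨾_ : ∀ {A B C} → A ⇿ B → B ⇿ C → A ⇿ C
(to , from) ⨾ (to′ , from′) = to′ ∘ to , from ∘ from′

⇿-× : ∀ {A B C D} → A ⇿ B → C ⇿ D → A × C ⇿ B × D
⇿-× (to , from) (to′ , from′) = map× to to′ , map× from from′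

⇿-→ : ∀ {A B C D} → A ⇿ B → C ⇿ D → (A → C) ⇿ (B → D)
⇿-→ (to , from) (to′ , from′) = (λ h → to′ ∘ h ∘ from) , (λ h → from′ ∘ h ∘ to)

⇿-∀ : ∀ {A : Set} {B C : A → Set} → (∀ x → B x ⇿ C x) → (∀ x → B x) ⇿ (∀ x → C x)
⇿-∀ h = (λ b x → proj₁ (h x) (b x)) , (λ c x → proj₂ (h x) (c x))

-- The local function of ∀*-syntax cannot be named.  It is recovered by
-- unification from a goal in which all its arguments are distinct variables.
-- Agda ignores its first two arguments when it compares types, so the dummies
-- in ⟦closure⟧ below match every ∀*-syntax.
mutual
  closure : (L : Language) (n : ℕ) → (Vars L n → Formula L n) → ∀ k → Formula L k → Sentence L
  closure = _

  private
    constᵛ : ∀ {L n} → Formula L n → Vars L n → Formula L n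
    constᵛ ψ _ = ψ

    closure-solution : ∀ {L} k (ψ : Formula L (suc k)) →
      closure L (suc k) (constᵛ ψ) k (all ψ) ≡ ∀*-syntax (suc k) (constᵛ ψ)
    closure-solution {L} k ψ with all ψ | constᵛ {L} {suc k} ψ
    ... | χ | φ with suc k
    ... | n = refl

-- Tarski semantics

module Tarski (L : Language) (M 𝔽 : Set)
  (⟦_⟧ᶠ : ∀ {k} → Fun L k → Vec M k → M)
  (⟦_⟧ᴿ : ∀ {k} → Rel L k → Vec M k → Set)
  (_≈_ : M → M → Set) where

  private variable
    k m n : ℕ
    ρ ρ′ : Vec M n

  value  : Term L n → Vec M n → M
  values : Vec (Term L n) k → Vec M n → Vec M k
  value (var i)    ρ = lookup ρ i
  value (fun f ts) ρ = ⟦ f ⟧ᶠ (values ts ρ)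
  values []       ρ = []
  values (t ∷ ts) ρ = value t ρ ∷ values ts ρ

  -- Disjunction and existence are read negatively relative to `𝔽`, so that every formula is stable
  -- as soon as the atoms are, and classical reasoning is available inside the model. Equality is an
  -- arbitrary relation, which spares the term model a quotient.
  ⟦_⟧ : Formula L n → Vec M n → Set
  ⟦ rel r ts ⟧ ρ = ⟦ r ⟧ᴿ (values ts ρ)
  ⟦ s ≐ t ⟧   ρ = value s ρ ≈ value t ρ
  ⟦ ⊥ ⟧       ρ = 𝔽
  ⟦ φ ∧ ψ ⟧   ρ = ⟦ φ ⟧ ρ × ⟦ ψ ⟧ ρ
  ⟦ φ ∨ ψ ⟧   ρ = (⟦ φ ⟧ ρ → 𝔽) → (⟦ ψ ⟧ ρ → 𝔽) → 𝔽
  ⟦ φ ⇒ ψ ⟧   ρ = ⟦ φ ⟧ ρ → ⟦ ψ ⟧ ρ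
  ⟦ all φ ⟧   ρ = ∀ x → ⟦ φ ⟧ (x ∷ ρ)
  ⟦ ex φ ⟧    ρ = (∀ x → ⟦ φ ⟧ (x ∷ ρ) → 𝔽) → 𝔽

  ⇿-¬ : ∀ {A B} → A ⇿ B → (A → 𝔽) ⇿ (B → 𝔽)
  ⇿-¬ h = ⇿-→ h ⇿-refl

  ⇿-∨ : ∀ {A B C D} → A ⇿ B → C ⇿ D → ((A → 𝔽) → (C → 𝔽) → 𝔽) ⇿ ((B → 𝔽) → (D → 𝔽) → 𝔽)
  ⇿-∨ h h′ = ⇿-→ (⇿-¬ h) (⇿-¬ (⇿-¬ h′))

  ⇿-∃ : ∀ {A : Set} {B C : A → Set} → (∀ x → B x ⇿ C x) →
    ((∀ x → B x → 𝔽) → 𝔽) ⇿ ((∀ x → C x → 𝔽) → 𝔽)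
  ⇿-∃ h = ⇿-¬ (⇿-∀ (λ x → ⇿-¬ (h x)))

  ≡⇒⇿ : ∀ {A : Set} (P : A → Set) {x y} → x ≡ y → P x ⇿ P y
  ≡⇒⇿ P refl = ⇿-refl

  value-rename  : ∀ (t : Term L m) {f : Fin m → Fin n} → (∀ i → lookup ρ (f i) ≡ lookup ρ′ i) →
    value (renameᵗ f t) ρ ≡ value t ρ′
  values-rename : ∀ (ts : Vec (Term L m) k) {f : Fin m → Fin n} → (∀ i → lookup ρ (f i) ≡ lookup ρ′ i) →
    values (renameᵗ* f ts) ρ ≡ values ts ρ′
  value-rename (var i)    h = h i
  value-rename (fun f ts) h = cong ⟦ f ⟧ᶠ (values-rename ts h)
  values-rename []       h = refl
  values-rename (t ∷ ts) h = cong₂ _∷_ (value-rename t h) (values-rename ts h)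

  lift-lookup : ∀ {f : Fin m → Fin n} {x} → (∀ i → lookup ρ (f i) ≡ lookup ρ′ i) →
    ∀ i → lookup (x ∷ ρ) (lift f i) ≡ lookup (x ∷ ρ′) i
  lift-lookup h zero    = refl
  lift-lookup h (suc i) = h i

  ⟦rename⟧ : ∀ (φ : Formula L m) {f : Fin m → Fin n} → (∀ i → lookup ρ (f i) ≡ lookup ρ′ i) →
    ⟦ rename f φ ⟧ ρ ⇿ ⟦ φ ⟧ ρ′
  ⟦rename⟧ (rel r ts) h = ≡⇒⇿ ⟦ r ⟧ᴿ (values-rename ts h)
  ⟦rename⟧ (s ≐ t)    h = ≡⇒⇿ (uncurry _≈_) (cong₂ _,_ (value-rename s h) (value-rename t h))
  ⟦rename⟧ ⊥          h = ⇿-refl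
  ⟦rename⟧ (φ ∧ ψ)    h = ⇿-× (⟦rename⟧ φ h) (⟦rename⟧ ψ h)
  ⟦rename⟧ (φ ∨ ψ)    h = ⇿-∨ (⟦rename⟧ φ h) (⟦rename⟧ ψ h)
  ⟦rename⟧ (φ ⇒ ψ)    h = ⇿-→ (⟦rename⟧ φ h) (⟦rename⟧ ψ h)
  ⟦rename⟧ (all φ)    h = ⇿-∀ (λ x → ⟦rename⟧ φ (lift-lookup h))
  ⟦rename⟧ (ex φ)     h = ⇿-∃ (λ x → ⟦rename⟧ φ (lift-lookup h))

  value-subst  : ∀ (t : Term L m) {σ : Fin m → Term L n} → (∀ i → value (σ i) ρ ≡ lookup ρ′ i) →
    value (substᵗ σ t) ρ ≡ value t ρ′
  values-subst : ∀ (ts : Vec (Term L m) k) {σ : Fin m → Term L n} → (∀ i → value (σ i) ρ ≡ lookup ρ′ i) →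
    values (substᵗ* σ ts) ρ ≡ values ts ρ′
  value-subst (var i)    h = h i
  value-subst (fun f ts) h = cong ⟦ f ⟧ᶠ (values-subst ts h)
  values-subst []       h = refl
  values-subst (t ∷ ts) h = cong₂ _∷_ (value-subst t h) (values-subst ts h)

  liftˢ-value : ∀ {σ : Fin m → Term L n} {x} → (∀ i → value (σ i) ρ ≡ lookup ρ′ i) →
    ∀ i → value (liftˢ σ i) (x ∷ ρ) ≡ lookup (x ∷ ρ′) i
  liftˢ-value h zero = refl
  liftˢ-value {σ = σ} h (suc i) = trans (value-rename (σ i) (λ _ → refl)) (h i)

  ⟦subst⟧ : ∀ {m n} {ρ : Vec M n} {ρ′ : Vec M m} (φ : Formula L m) {σ : Fin m → Term L n} → (∀ i → value (σ i) ρ ≡ lookup ρ′ i) →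
    ⟦ subst σ φ ⟧ ρ ⇿ ⟦ φ ⟧ ρ′
  ⟦subst⟧ (rel r ts) h = ≡⇒⇿ ⟦ r ⟧ᴿ (values-subst ts h)
  ⟦subst⟧ (s ≐ t)    h = ≡⇒⇿ (uncurry _≈_) (cong₂ _,_ (value-subst s h) (value-subst t h))
  ⟦subst⟧ ⊥          h = ⇿-refl
  ⟦subst⟧ (φ ∧ ψ)    h = ⇿-× (⟦subst⟧ φ h) (⟦subst⟧ ψ h)
  ⟦subst⟧ (φ ∨ ψ)    h = ⇿-∨ (⟦subst⟧ φ h) (⟦subst⟧ ψ h)
  ⟦subst⟧ (φ ⇒ ψ)    h = ⇿-→ (⟦subst⟧ φ h) (⟦subst⟧ ψ h)
  ⟦subst⟧ (all φ)    h = ⇿-∀ (λ x → ⟦subst⟧ φ (liftˢ-value h))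
  ⟦subst⟧ (ex φ)     h = ⇿-∃ (λ x → ⟦subst⟧ φ (liftˢ-value h))

  value-lookup : (ts : Vec (Term L n) k) → ∀ i → value (lookup ts i) ρ ≡ lookup (values ts ρ) i
  value-lookup (t ∷ ts) zero    = refl
  value-lookup (t ∷ ts) (suc i) = value-lookup ts i

  ⟦⟨⟩⟧ : ∀ (φ : Formula L m) (ts : Vec (Term L n) m) → ⟦ φ ⟨ ts ⟩ ⟧ ρ ⇿ ⟦ φ ⟧ (values ts ρ)
  ⟦⟨⟩⟧ φ ts = ⟦subst⟧ φ (value-lookup ts)

  ⟦closure⟧ : ∀ k (ψ : Formula L k) → ⟦ closure L 0 (λ _ → ⊥) k ψ ⟧ [] ⇿ (∀ ρ → ⟦ ψ ⟧ ρ)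
  ⟦closure⟧ zero    ψ = (λ { h [] → h }) , (λ h → h [])
  ⟦closure⟧ (suc k) ψ = ⟦closure⟧ k (all ψ) ⨾
    (λ { h (x ∷ ρ) → h ρ x }) , (λ h ρ x → h (x ∷ ρ))

-- Completeness

module Syntax {L : Language} where
  private variable
    k m n o : ℕ

  substᵗ-renameᵗ  : ∀ (t : Term L m) {f : Fin m → Fin n} {σ : Fin n → Term L o} {h : Fin m → Fin o} →
    (∀ i → σ (f i) ≡ var (h i)) → substᵗ σ (renameᵗ f t) ≡ renameᵗ h t
  substᵗ*-renameᵗ* : ∀ (ts : Vec (Term L m) k) {f : Fin m → Fin n} {σ : Fin n → Term L o} {h : Fin m → Fin o} →
    (∀ i → σ (f i) ≡ var (h i)) → substᵗ* σ (renameᵗ* f ts) ≡ renameᵗ* h ts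
  substᵗ-renameᵗ (var i)    e = e i
  substᵗ-renameᵗ (fun f ts) e = cong (fun f) (substᵗ*-renameᵗ* ts e)
  substᵗ*-renameᵗ* []       e = refl
  substᵗ*-renameᵗ* (t ∷ ts) e = cong₂ _∷_ (substᵗ-renameᵗ t e) (substᵗ*-renameᵗ* ts e)

  liftˢ-lift : {f : Fin m → Fin n} {σ : Fin n → Term L o} {h : Fin m → Fin o} →
    (∀ i → σ (f i) ≡ var (h i)) → ∀ i → liftˢ σ (lift f i) ≡ var (lift h i)
  liftˢ-lift e zero    = refl
  liftˢ-lift e (suc i) = cong (renameᵗ suc) (e i)

  subst-rename : ∀ (φ : Formula L m) {f : Fin m → Fin n} {σ : Fin n → Term L o} {h : Fin m → Fin o} →
    (∀ i → σ (f i) ≡ var (h i)) → subst σ (rename f φ) ≡ rename h φ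
  subst-rename (rel r ts) e = cong (rel r) (substᵗ*-renameᵗ* ts e)
  subst-rename (s ≐ t)    e = cong₂ _≐_ (substᵗ-renameᵗ s e) (substᵗ-renameᵗ t e)
  subst-rename ⊥          e = refl
  subst-rename (φ ∧ ψ)    e = cong₂ _∧_ (subst-rename φ e) (subst-rename ψ e)
  subst-rename (φ ∨ ψ)    e = cong₂ _∨_ (subst-rename φ e) (subst-rename ψ e)
  subst-rename (φ ⇒ ψ)    e = cong₂ _⇒_ (subst-rename φ e) (subst-rename ψ e)
  subst-rename (all φ)    e = cong all (subst-rename φ (liftˢ-lift e))
  subst-rename (ex φ)     e = cong ex (subst-rename φ (liftˢ-lift e))

  renameᵗ-renameᵗ  : ∀ (t : Term L m) {f : Fin m → Fin n} {f′ : Fin n → Fin o} {h : Fin m → Fin o} →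
    (∀ i → f′ (f i) ≡ h i) → renameᵗ f′ (renameᵗ f t) ≡ renameᵗ h t
  renameᵗ*-renameᵗ* : ∀ (ts : Vec (Term L m) k) {f : Fin m → Fin n} {f′ : Fin n → Fin o} {h : Fin m → Fin o} →
    (∀ i → f′ (f i) ≡ h i) → renameᵗ* f′ (renameᵗ* f ts) ≡ renameᵗ* h ts
  renameᵗ-renameᵗ (var i)    e = cong var (e i)
  renameᵗ-renameᵗ (fun f ts) e = cong (fun f) (renameᵗ*-renameᵗ* ts e)
  renameᵗ*-renameᵗ* []       e = refl
  renameᵗ*-renameᵗ* (t ∷ ts) e = cong₂ _∷_ (renameᵗ-renameᵗ t e) (renameᵗ*-renameᵗ* ts e)

  lift-lift : {f : Fin m → Fin n} {f′ : Fin n → Fin o} {h : Fin m → Fin o} →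
    (∀ i → f′ (f i) ≡ h i) → ∀ i → lift f′ (lift f i) ≡ lift h i
  lift-lift e zero    = refl
  lift-lift e (suc i) = cong suc (e i)

  rename-rename : ∀ (φ : Formula L m) {f : Fin m → Fin n} {f′ : Fin n → Fin o} {h : Fin m → Fin o} →
    (∀ i → f′ (f i) ≡ h i) → rename f′ (rename f φ) ≡ rename h φ
  rename-rename (rel r ts) e = cong (rel r) (renameᵗ*-renameᵗ* ts e)
  rename-rename (s ≐ t)    e = cong₂ _≐_ (renameᵗ-renameᵗ s e) (renameᵗ-renameᵗ t e)
  rename-rename ⊥          e = refl
  rename-rename (φ ∧ ψ)    e = cong₂ _∧_ (rename-rename φ e) (rename-rename ψ e)
  rename-rename (φ ∨ ψ)    e = cong₂ _∨_ (rename-rename φ e) (rename-rename ψ e)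
  rename-rename (φ ⇒ ψ)    e = cong₂ _⇒_ (rename-rename φ e) (rename-rename ψ e)
  rename-rename (all φ)    e = cong all (rename-rename φ (lift-lift e))
  rename-rename (ex φ)     e = cong ex (rename-rename φ (lift-lift e))

  renameᵗ-id  : ∀ (t : Term L m) {f : Fin m → Fin m} → (∀ i → f i ≡ i) → renameᵗ f t ≡ t
  renameᵗ*-id : ∀ (ts : Vec (Term L m) k) {f : Fin m → Fin m} → (∀ i → f i ≡ i) → renameᵗ* f ts ≡ ts
  renameᵗ-id (var i)    e = cong var (e i)
  renameᵗ-id (fun f ts) e = cong (fun f) (renameᵗ*-id ts e)
  renameᵗ*-id []       e = refl
  renameᵗ*-id (t ∷ ts) e = cong₂ _∷_ (renameᵗ-id t e) (renameᵗ*-id ts e)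

  lift-id : {f : Fin m → Fin m} → (∀ i → f i ≡ i) → ∀ i → lift f i ≡ i
  lift-id e zero    = refl
  lift-id e (suc i) = cong suc (e i)

  rename-id : ∀ (φ : Formula L m) {f : Fin m → Fin m} → (∀ i → f i ≡ i) → rename f φ ≡ φ
  rename-id (rel r ts) e = cong (rel r) (renameᵗ*-id ts e)
  rename-id (s ≐ t)    e = cong₂ _≐_ (renameᵗ-id s e) (renameᵗ-id t e)
  rename-id ⊥          e = refl
  rename-id (φ ∧ ψ)    e = cong₂ _∧_ (rename-id φ e) (rename-id ψ e)
  rename-id (φ ∨ ψ)    e = cong₂ _∨_ (rename-id φ e) (rename-id ψ e)
  rename-id (φ ⇒ ψ)    e = cong₂ _⇒_ (rename-id φ e) (rename-id ψ e)
  rename-id (all φ)    e = cong all (rename-id φ (lift-id e))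
  rename-id (ex φ)     e = cong ex (rename-id φ (lift-id e))

  rename-cong : ∀ (φ : Formula L m) {f f′ : Fin m → Fin n} → (∀ i → f i ≡ f′ i) → rename f φ ≡ rename f′ φ
  rename-cong φ {f} e = trans (cong (rename f) (sym (rename-id φ (λ _ → refl)))) (rename-rename φ e)

  -- Instantiating the bound variable with a variable is again a renaming. Assertions are renamed
  -- formulas, so this is what matches them with the instances in the quantifier rules.
  rename-[] : ∀ (φ : Formula L (suc m)) {f : Fin m → Fin n} {h : Fin (suc m) → Fin n} {i} →
    i ≡ h zero → (∀ j → f j ≡ h (suc j)) → rename (lift f) φ [ var i ] ≡ rename h φ
  rename-[] φ e e′ = subst-rename φ λ where
    zero    → cong var e
    (suc j) → trans (lookup∘tabulate var _) (cong var (e′ j))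

  rename-lift-suc-[] : ∀ (φ : Formula L (suc m)) → rename (lift suc) φ [ var zero ] ≡ φ
  rename-lift-suc-[] φ = trans (rename-[] φ refl (λ _ → refl)) (rename-id φ (λ _ → refl))

open Syntax

-- Enumeration of the formulas of set theory with named variables.

module Enumeration where
  -- Cantor's antidiagonal walk, whose iterates from the origin reach every pair.
  step : ℕ × ℕ → ℕ × ℕ
  step (zero  , y) = suc y , zero
  step (suc x , y) = x , suc y

  unpair : ℕ → ℕ × ℕ
  unpair zero    = zero , zero
  unpair (suc n) = step (unpair n)

  pair : ∀ x y → Σ[ n ∈ ℕ ] unpair n ≡ (x , y)
  pair x y = go (x + y) y x refl
    where
    go : ∀ s y x → x + y ≡ s → Σ[ n ∈ ℕ ] unpair n ≡ (x , y)
    go s (suc y) x e =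
      let n , p = go s y (suc x) (trans (sym (+-suc x y)) e) in suc n , cong step p
    go s zero zero e = zero , refl
    -- The start of an antidiagonal: the walk comes from `(zero , x)`, the end of the preceding one.
    go (suc s) zero (suc x) refl =
      let n , p = go s x zero (+-comm zero x) in suc n , cong step p

  clamp : ∀ m → ℕ → Fin (suc m)
  clamp m       zero    = zero
  clamp zero    (suc n) = zero
  clamp (suc m) (suc n) = suc (clamp m n)

  clamp-toℕ : ∀ {m} (i : Fin (suc m)) → clamp m (toℕ i) ≡ i
  clamp-toℕ zero = refl
  clamp-toℕ {suc m} (suc i) = cong suc (clamp-toℕ i)

  node : ℕ → (∀ m → ℕ → Formula L∈ m) → ∀ m → ℕ × ℕ → Formula L∈ m
  node 0 F (suc m) (i , j) = rel mem (var (clamp m i) ∷ var (clamp m j) ∷ [])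
  node 1 F (suc m) (i , j) = var (clamp m i) ≐ var (clamp m j)
  node 2 F m (a , b) = F m a ∧ F m b
  node 3 F m (a , b) = F m a ∨ F m b
  node 4 F m (a , b) = F m a ⇒ F m b
  node 5 F m (a , b) = all (F (suc m) a)
  node 6 F m (a , b) = ex (F (suc m) a)
  node _ F m _ = ⊥

  -- The first argument is fuel: it bounds the depth of the decoded tree and makes the recursion
  -- structural.
  formula : ℕ → ∀ m → ℕ → Formula L∈ m
  formula zero    m n = ⊥
  formula (suc d) m n = node (proj₁ (unpair n)) (formula d) m (unpair (proj₂ (unpair n)))

  code : ∀ tag a b → Σ[ n ∈ ℕ ] (∀ d m → formula (suc d) m n ≡ node tag (formula d) m (a , b))
  code tag a b with pair a b
  ... | r , p with pair tag r
  ... | n , q = n , λ d m → trans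
    (cong (λ z → node (proj₁ z) (formula d) m (unpair (proj₂ z))) q)
    (cong (node tag (formula d) m) p)

  -- Both arguments of a connective are decoded with the same fuel. A code at every sufficient
  -- amount of fuel lets the maximum of two bounds serve both.
  Coded : ∀ {m} → ℕ → Formula L∈ m → Set
  Coded d φ = ∀ d′ → d ≤ d′ → Σ[ n ∈ ℕ ] formula d′ _ n ≡ φ

  binary : ∀ {m} (_∙_ : Formula L∈ m → Formula L∈ m → Formula L∈ m) tag →
    (∀ F a b → node tag F m (a , b) ≡ F m a ∙ F m b) → ∀ {φ ψ} →
    (Σ[ d ∈ ℕ ] Coded d φ) → (Σ[ d ∈ ℕ ] Coded d ψ) → Σ[ d ∈ ℕ ] Coded d (φ ∙ ψ)
  binary _∙_ tag e (d , c) (d′ , c′) = suc (d ⊔ d′) , λ where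
    (suc f) (s≤s le) →
      let a , p = c f (m⊔n≤o⇒m≤o d d′ le)
          b , q = c′ f (m⊔n≤o⇒n≤o d d′ le)
          n , r = code tag a b
      in n , trans (r f _) (trans (e _ a b) (cong₂ _∙_ p q))

  quantifier : ∀ {m} (Q : Formula L∈ (suc m) → Formula L∈ m) tag →
    (∀ F a b → node tag F m (a , b) ≡ Q (F (suc m) a)) → ∀ {φ} →
    (Σ[ d ∈ ℕ ] Coded d φ) → Σ[ d ∈ ℕ ] Coded d (Q φ)
  quantifier Q tag e (d , c) = suc d , λ where
    (suc f) (s≤s le) →
      let a , p = c f le
          n , r = code tag a 0
      in n , trans (r f _) (trans (e _ a 0) (cong Q p))

  coded : ∀ {m} (φ : Formula L∈ m) → Σ[ d ∈ ℕ ] Coded d φ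
  coded {zero} (rel mem (var () ∷ _))
  coded {zero} (var () ≐ _)
  coded {suc m} (rel mem (var i ∷ var j ∷ [])) = 1 , λ where
    (suc f) _ → let n , r = code 0 (toℕ i) (toℕ j) in
      n , trans (r f _) (cong₂ (λ i j → rel mem (var i ∷ var j ∷ [])) (clamp-toℕ i) (clamp-toℕ j))
  coded {suc m} (var i ≐ var j) = 1 , λ where
    (suc f) _ → let n , r = code 1 (toℕ i) (toℕ j) in
      n , trans (r f _) (cong₂ (λ i j → var i ≐ var j) (clamp-toℕ i) (clamp-toℕ j))
  coded ⊥       = 1 , λ where
    -- Every tag above 6 decodes to `⊥`.
    (suc f) _ → let n , r = code 7 0 0 in n , r f _
  coded (φ ∧ ψ) = binary _∧_ 2 (λ _ _ _ → refl) (coded φ) (coded ψ)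
  coded (φ ∨ ψ) = binary _∨_ 3 (λ _ _ _ → refl) (coded φ) (coded ψ)
  coded (φ ⇒ ψ) = binary _⇒_ 4 (λ _ _ _ → refl) (coded φ) (coded ψ)
  coded (all φ) = quantifier all 5 (λ _ _ _ → refl) (coded φ)
  coded (ex φ)  = quantifier ex 6 (λ _ _ _ → refl) (coded φ)

  tuple : ∀ m → ℕ → Vec ℕ m
  tuple zero    n = []
  tuple (suc m) n = proj₁ (unpair n) ∷ tuple m (proj₂ (unpair n))

  tuple-surjective : ∀ {m} (ρ : Vec ℕ m) → Σ[ n ∈ ℕ ] tuple m n ≡ ρ
  tuple-surjective [] = 0 , refl
  tuple-surjective {suc m} (x ∷ ρ) =
    let r , p = tuple-surjective ρ
        n , q = pair x r
    in n , trans (cong (λ z → proj₁ z ∷ tuple m (proj₂ z)) q) (cong (x ∷_) p)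

  Named : Set
  Named = Σ[ m ∈ ℕ ] (Formula L∈ m × Vec ℕ m)

  named : ℕ → Named
  named n =
    let m , r = unpair n
        d , r′ = unpair r
        a , b = unpair r′
    in m , formula d m a , tuple m b

  abstract
    named-surjective : ∀ {m} (φ : Formula L∈ m) ρ → Σ[ n ∈ ℕ ] named n ≡ (m , φ , ρ)
    named-surjective {m} φ ρ =
      let d , c = coded φ
          a , p = c d ≤-refl
          b , q = tuple-surjective ρ
          r′ , u′ = pair a b
          r , u = pair d r′
          n , v = pair m r
      in n , trans (cong (λ z → let m , r = z ; d , r′ = unpair r ; a , b = unpair r′ in m , formula d m a , tuple m b) v)
        (trans (cong (λ z → let d , r′ = z ; a , b = unpair r′ in m , formula d m a , tuple m b) u)
          (trans (cong (λ z → let a , b = z in m , formula d m a , tuple m b) u′)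
            (cong₂ (λ φ ρ → m , φ , ρ) p q)))

open Enumeration using (Named; named; named-surjective)

module ∈-Semantics (M 𝔽 : Set) (_∈_ _≈_ : M → M → Set) where
  function : ∀ {k} → NoFun k → Vec M k → M
  function ()

  relation : ∀ {k} → Rel∈ k → Vec M k → Set
  relation mem (x ∷ y ∷ []) = x ∈ y

  open Tarski L∈ M 𝔽 function relation _≈_ public

-- 𝔽 interprets falsum.  It may be inhabited, and stability of the atoms makes
-- it imply every formula.
record Model : Set₁ where
  infix 4 _∈_ _≈_
  field
    M 𝔽 : Set
    _∈_ _≈_ : M → M → Set

  open ∈-Semantics M 𝔽 _∈_ _≈_ public

  field
    ∈-stable : ∀ {x y} → ((x ∈ y → 𝔽) → 𝔽) → x ∈ y
    ≈-stable : ∀ {x y} → ((x ≈ y → 𝔽) → 𝔽) → x ≈ y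
    ≈-refl   : ∀ {x} → x ≈ x
    ≈-subst  : ∀ {n} (φ : Formula L∈ (suc n)) {ρ x y} → x ≈ y → ⟦ φ ⟧ (x ∷ ρ) → ⟦ φ ⟧ (y ∷ ρ)
    witness  : ∀ {n} → Formula L∈ (suc n) → Vec M n → M
    witness-correct : ∀ {n} (φ : Formula L∈ (suc n)) {ρ} →
      ((∀ x → ⟦ φ ⟧ (x ∷ ρ) → 𝔽) → 𝔽) → ⟦ φ ⟧ (witness φ ρ ∷ ρ)

-- Maximal Henkin theories and the term model.

module Henkin (T : Theory L∈) where
  private variable
    m n : ℕ

  -- An assertion is a formula whose free variables have been given names in ℕ.
  -- Quantifying over all assignments of variables to names makes substitution
  -- of names unnecessary.
  Assertion : Set
  Assertion = ∀ n → (ℕ → Fin n) → Formula L∈ n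

  private variable
    c d : Assertion
    Θ : Assertion → Set

  infixr 5 _⊃_
  _⊃_ : Assertion → Assertion → Assertion
  (c ⊃ d) n σ = c n σ ⇒ d n σ

  ⊥ₐ : Assertion
  ⊥ₐ n σ = ⊥

  ¬ₐ_ : Assertion → Assertion
  ¬ₐ c = c ⊃ ⊥ₐ

  inst : Formula L∈ m → Vec ℕ m → Assertion
  inst φ ρ n σ = rename (σ ∘ lookup ρ) φ

  Valid : Assertion → Set
  Valid d = ∀ n σ → T ∣ [] ⊢ d n σ

  infix 3 _⊩_
  -- A Hilbert-style calculus in which all logic is delegated to `Valid`, leaving modus ponens as
  -- the only rule. Metatheorems become inductions with three cases, and `Θ` may be infinite.
  data _⊩_ (Θ : Assertion → Set) : Assertion → Set where
    valid      : Valid d → Θ ⊩ d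
    assumption : Θ d → Θ ⊩ d
    mp         : Θ ⊩ c ⊃ d → Θ ⊩ c → Θ ⊩ d

  #0 : ∀ {n} {φ : Formula L∈ n} {Γ} → T ∣ φ ∷ Γ ⊢ φ
  #0 = hyp (here refl)

  #1 : ∀ {n} {φ ψ : Formula L∈ n} {Γ} → T ∣ ψ ∷ φ ∷ Γ ⊢ φ
  #1 = hyp (there (here refl))

  #2 : ∀ {n} {φ ψ χ : Formula L∈ n} {Γ} → T ∣ χ ∷ ψ ∷ φ ∷ Γ ⊢ φ
  #2 = hyp (there (there (here refl)))

  cast : ∀ {n} {φ ψ : Formula L∈ n} {Γ} → φ ≡ ψ → T ∣ Γ ⊢ φ → T ∣ Γ ⊢ ψ
  cast refl p = p

  -- The set `Θ` with `c` added on condition that `P` holds. `P` need not be decidable; this takes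
  -- the place of the case distinction on consistency in the classical proof.
  data Extend (Θ : Assertion → Set) (c : Assertion) (P : Set) : Assertion → Set where
    old : Θ d → Extend Θ c P d
    new : P → Extend Θ c P c

  ⊩-mono : {Θ′ : Assertion → Set} → (∀ {d} → Θ d → Θ′ d) → Θ ⊩ d → Θ′ ⊩ d
  ⊩-mono i (valid v)      = valid v
  ⊩-mono i (assumption a) = assumption (i a)
  ⊩-mono i (mp p q)       = mp (⊩-mono i p) (⊩-mono i q)

  deduction : ∀ {P} → Extend Θ c P ⊩ d → Θ ⊩ c ⊃ d
  deduction (valid v)            = mp (valid (λ n σ → ⇒-i (⇒-i #1))) (valid v)
  deduction (assumption (old a)) = mp (valid (λ n σ → ⇒-i (⇒-i #1))) (assumption a)
  deduction (assumption (new p)) = valid (λ n σ → ⇒-i #0)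
  deduction (mp p q) = mp
    (mp (valid (λ n σ → ⇒-i (⇒-i (⇒-i (⇒-e (⇒-e #2 #0) (⇒-e #1 #0)))))) (deduction p))
    (deduction q)

  -- Derivations are finite, so it can be decided whether the new assertion occurs in one, although
  -- `P` itself cannot be decided.
  used? : ∀ {P} → Extend Θ c P ⊩ d → Θ ⊩ d ⊎ P
  used? (valid v)            = inj₁ (valid v)
  used? (assumption (old a)) = inj₁ (assumption a)
  used? (assumption (new p)) = inj₂ p
  used? (mp p q) with used? p | used? q
  ... | inj₂ x | _      = inj₂ x
  ... | inj₁ _ | inj₂ x = inj₂ x
  ... | inj₁ p′ | inj₁ q′ = inj₁ (mp p′ q′)

  Extend-conservative : ∀ {P} → (P → Θ ⊩ ¬ₐ c → Θ ⊩ ⊥ₐ) → Extend Θ c P ⊩ ⊥ₐ → Θ ⊩ ⊥ₐ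
  Extend-conservative h p with used? p
  ... | inj₁ q = q
  ... | inj₂ x = h x (deduction p)

  _[_↦0] : (ℕ → Fin n) → ℕ → ℕ → Fin (suc n)
  (σ [ x ↦0]) y with y ≟ x
  ... | yes _ = zero
  ... | no  _ = suc (σ y)

  ↦0-≡ : ∀ (σ : ℕ → Fin n) x → (σ [ x ↦0]) x ≡ zero
  ↦0-≡ σ x with x ≟ x
  ... | yes _ = refl
  ... | no x≢x = contradiction refl x≢x

  ↦0-≢ : ∀ (σ : ℕ → Fin n) {x y} → y ≢ x → (σ [ x ↦0]) y ≡ suc (σ y)
  ↦0-≢ σ {x} {y} y≢x with y ≟ x
  ... | yes y≡x = contradiction y≡x y≢x
  ... | no _ = refl

  -- Assertions are functions, not syntax, so that a name does not occur is expressed by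
  -- indifference: under a binder, sending `x` to the bound variable gives the same as weakening.
  Fresh : ℕ → Assertion → Set
  Fresh x d = ∀ n σ → rename suc (d n σ) ≡ d (suc n) (σ [ x ↦0])

  _∉ⱽ_ : ℕ → Vec ℕ m → Set
  x ∉ⱽ ρ = Allⱽ (_≢ x) ρ

  ↦0-lookup : ∀ (σ : ℕ → Fin n) {x} {ρ : Vec ℕ m} → x ∉ⱽ ρ →
    ∀ i → (σ [ x ↦0]) (lookup ρ i) ≡ suc (σ (lookup ρ i))
  ↦0-lookup σ f i = ↦0-≢ σ (lookup⁺ f i)

  inst-fresh : ∀ (φ : Formula L∈ m) {x ρ} → x ∉ⱽ ρ → Fresh x (inst φ ρ)
  inst-fresh φ f n σ = rename-rename φ (λ i → sym (↦0-lookup σ f i))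

  -- The eigenvariable rule. By freshness an assumption is its own weakening, so quantifying it over
  -- `x` is vacuous.
  generalize : ∀ x → (∀ {c} → Θ c → Fresh x c) → Θ ⊩ d → Θ ⊩ (λ n σ → all (d (suc n) (σ [ x ↦0])))
  generalize x f (valid v) = valid (λ n σ → ∀-i (v (suc n) _))
  generalize x f (assumption {c} a) = mp
    (valid (λ n σ → ⇒-i (∀-i (cast (f a n σ) #0)))) (assumption a)
  generalize x f (mp p q) = mp
    (mp (valid (λ n σ → ⇒-i (⇒-i (∀-i (⇒-e (instance₀ #1) (instance₀ #0)))))) (generalize x f p))
    (generalize x f q)
    where
    instance₀ : ∀ {n} {φ : Formula L∈ (suc n)} {Γ} → T ∣ Γ ⊢ all (rename (lift suc) φ) → T ∣ Γ ⊢ φ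
    instance₀ {φ = φ} h = cast (rename-lift-suc-[] φ) (∀-e h (var zero))

  -- The same enumeration serves for the Henkin axioms of the universal closures;
  -- the name given to the bound variable is ignored.
  henkin : ℕ → Named → Assertion
  henkin x (zero  , φ , ρ)     = ⊥ₐ ⊃ ⊥ₐ
  henkin x (suc m , φ , _ ∷ ρ) = inst φ (x ∷ ρ) ⊃ inst (all φ) ρ

  Away : ℕ → Named → Set
  Away x (m , φ , ρ) = x ∉ⱽ ρ

  henkin-fresh : ∀ x {y} c → y ≢ x → Away x c → Fresh x (henkin y c)
  henkin-fresh x (zero  , φ , ρ)     y≢x f n σ = refl
  henkin-fresh x (suc m , φ , _ ∷ ρ) y≢x (_ ∷ f) n σ =
    cong₂ _⇒_ (inst-fresh φ (y≢x ∷ f) n σ) (inst-fresh (all φ) f n σ)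

  -- A refutation of the implication from `φ` at `x` to `all φ` proves its premise. As `x` is fresh
  -- the premise generalizes to `all φ`, which implies the refuted implication.
  henkin-conservative : ∀ x c → (∀ {d} → Θ d → Fresh x d) → Away x c →
    Θ ⊩ ¬ₐ henkin x c → Θ ⊩ ⊥ₐ
  henkin-conservative x (zero , φ , ρ) f a p = mp p (valid (λ n σ → ⇒-i #0))
  henkin-conservative {Θ} x (suc m , φ , _ ∷ ρ) f (_ ∷ a) p =
    mp p (mp (valid (λ n σ → ⇒-i (⇒-i #1))) universal)
    where
    premise : Θ ⊩ inst φ (x ∷ ρ)
    premise = mp (valid (λ n σ → ⇒-i (raa (⇒-e #1 (⇒-i (raa (⇒-e #2 #1))))))) p

    universal : Θ ⊩ inst (all φ) ρ
    universal = mp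
      (valid (λ n σ → ⇒-i (cast (cong all (rename-cong φ (λ where
        zero    → ↦0-≡ σ x
        (suc i) → ↦0-lookup σ a i))) #0)))
      (generalize x f premise)

  sup : Vec ℕ m → ℕ
  sup []      = 0
  sup (x ∷ ρ) = suc x ⊔ sup ρ

  sup-away : ∀ {x} (ρ : Vec ℕ m) → sup ρ ≤ x → x ∉ⱽ ρ
  sup-away []      le = []
  sup-away (y ∷ ρ) le = <⇒≢ (m⊔n≤o⇒m≤o (suc y) (sup ρ) le) ∷ sup-away ρ (m⊔n≤o⇒n≤o (suc y) (sup ρ) le)

  module Completion (σ₀ : Sentence L∈) where
    bound : ℕ → ℕ
    fresh : ℕ → ℕ
    fresh k = bound k ⊔ sup (proj₂ (proj₂ (named k)))
    bound zero    = 0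
    bound (suc k) = suc (fresh k)

    -- Stage 0 holds the negation of the sentence to be proved. Each further stage treats one named
    -- formula: it is added on condition that refuting it would already be contradictory, and then
    -- its Henkin axiom is added unconditionally, with a name above all those in use.
    stage : ℕ → Assertion → Set
    step : ℕ → Assertion → Set
    stage zero    = Extend (λ _ → Empty) (inst (¬ σ₀) []) ⊤
    stage (suc k) = Extend (step k) (henkin (fresh k) (named k)) ⊤
    step k = Extend (stage k) (inst φ ρ) (stage k ⊩ inst (¬ φ) ρ → stage k ⊩ ⊥ₐ)
      where
      φ = proj₁ (proj₂ (named k))
      ρ = proj₂ (proj₂ (named k))

    named-away : ∀ k {x} → fresh k ≤ x → Away x (named k)
    named-away k le = sup-away (proj₂ (proj₂ (named k)))
      (m⊔n≤o⇒n≤o (bound k) (sup (proj₂ (proj₂ (named k)))) le)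

    stage-fresh : ∀ k {x} → bound k ≤ x → ∀ {c} → stage k c → Fresh x c
    step-fresh  : ∀ k {x} → fresh k ≤ x → ∀ {c} → step k c → Fresh x c
    stage-fresh zero    le (new _) = inst-fresh (¬ σ₀) []
    stage-fresh (suc k) le (old s) = step-fresh k (≤-trans (n≤1+n _) le) s
    stage-fresh (suc k) {x} le (new _) =
      henkin-fresh x (named k) (<⇒≢ le) (named-away k (≤-trans (n≤1+n _) le))
    step-fresh k le (old s) = stage-fresh k (m⊔n≤o⇒m≤o (bound k) (sup (proj₂ (proj₂ (named k)))) le) s
    step-fresh k le (new _) = inst-fresh (proj₁ (proj₂ (named k))) (named-away k le)

    stage-conservative : ∀ k → stage k ⊩ ⊥ₐ → stage 0 ⊩ ⊥ₐ
    stage-conservative zero    p = p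
    stage-conservative (suc k) p = stage-conservative k
      -- The condition attached to the new formula is literally the hypothesis required here, hence
      -- `id`.
      (Extend-conservative id
        (Extend-conservative
          (λ _ → henkin-conservative (fresh k) (named k) (step-fresh k ≤-refl) (named-away k ≤-refl)) p))

    stage-mono : ∀ j {k d} → stage k ⊩ d → stage (j + k) ⊩ d
    stage-mono zero    p = p
    stage-mono (suc j) p = ⊩-mono (old ∘ old) (stage-mono j p)

    True : Assertion → Set
    True d = Σ[ k ∈ ℕ ] stage k ⊩ d

    true : Valid d → True d
    true v = 0 , valid v

    infixl 5 _·_
    _·_ : True (c ⊃ d) → True c → True d
    _·_ {c} (k , p) (k′ , q) = k′ + k , mp (stage-mono k′ p) (transport (λ k → stage k ⊩ c) (+-comm k k′) (stage-mono k q))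

    false→stage : ∀ k → True ⊥ₐ → stage k ⊩ ⊥ₐ
    false→stage k (j , p) =
      transport (λ k → stage k ⊩ ⊥ₐ) (+-comm k 0) (stage-mono k (stage-conservative j p))

    -- The hypothesis speaks of the union of all stages, the condition in `step k` of stage `k`
    -- alone. Conservativity closes the gap, since a contradiction at any stage is already one at
    -- stage 0.
    maximal : ∀ (φ : Formula L∈ m) ρ → (True (inst (¬ φ) ρ) → True ⊥ₐ) → True (inst φ ρ)
    maximal φ ρ h with named-surjective φ ρ
    ... | k , e = suc k , assumption (old (member k e (λ p → false→stage k (h (k , p)))))
      where
      member : ∀ k → named k ≡ (_ , φ , ρ) → (stage k ⊩ inst (¬ φ) ρ → stage k ⊩ ⊥ₐ) → step k (inst φ ρ)
      member k e c = convert (named k) e c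
        where
        convert : ∀ z → z ≡ (_ , φ , ρ) → (stage k ⊩ inst (¬ φ) ρ → stage k ⊩ ⊥ₐ) →
          let _ , ψ , τ = z in Extend (stage k) (inst ψ τ) (stage k ⊩ inst (¬ ψ) τ → stage k ⊩ ⊥ₐ) (inst φ ρ)
        convert _ refl c = new c

    refute : ∀ (φ : Formula L∈ m) ρ → (True (inst φ ρ) → True ⊥ₐ) → True (inst (¬ φ) ρ)
    refute φ ρ h = maximal (¬ φ) ρ (λ p → h (true (λ n σ → ⇒-i (raa (⇒-e #1 #0))) · p))

    True-stable : ∀ (φ : Formula L∈ m) ρ → ((True (inst φ ρ) → True ⊥ₐ) → True ⊥ₐ) → True (inst φ ρ)
    True-stable φ ρ h = maximal φ ρ (λ p → h (p ·_))

    generic : Formula L∈ (suc m) → Vec ℕ m → ℕ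
    generic φ ρ = fresh (proj₁ (named-surjective φ (0 ∷ ρ)))

    generic-correct : ∀ (φ : Formula L∈ (suc m)) ρ → True (inst φ (generic φ ρ ∷ ρ)) → True (inst (all φ) ρ)
    generic-correct φ ρ p =
      let k , e = named-surjective φ (0 ∷ ρ) in
      (suc k , assumption (transport (λ z → stage (suc k) (henkin (fresh k) z)) e (new tt))) · p

    specialize : ∀ (φ : Formula L∈ (suc m)) x ρ → Valid (inst (all φ) ρ ⊃ inst φ (x ∷ ρ))
    specialize φ x ρ n σ = ⇒-i (cast (rename-[] φ {h = σ ∘ lookup (x ∷ ρ)} refl (λ _ → refl)) (∀-e #0 (var (σ x))))

    exists : ∀ (φ : Formula L∈ (suc m)) x ρ → Valid (inst φ (x ∷ ρ) ⊃ inst (ex φ) ρ)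
    exists φ x ρ n σ = ⇒-i (∃-i (var (σ x)) (cast (sym (rename-[] φ {h = σ ∘ lookup (x ∷ ρ)} refl (λ _ → refl))) #0))

    none : ∀ (φ : Formula L∈ (suc m)) ρ → Valid (inst (all (¬ φ)) ρ ⊃ inst (ex φ) ρ ⊃ ⊥ₐ)
    none φ ρ n σ = ⇒-i (⇒-i (∃-e #0
      (⇒-e (cast (rename-lift-suc-[] (¬ rename (lift _) φ)) (∀-e #2 (var zero))) #0)))

    _∈_ _≈_ : ℕ → ℕ → Set
    x ∈ y = True (inst (rel mem (var zero ∷ var (suc zero) ∷ [])) (x ∷ y ∷ []))
    x ≈ y = True (inst (var zero ≐ var (suc zero)) (x ∷ y ∷ []))

    open ∈-Semantics ℕ (True ⊥ₐ) _∈_ _≈_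

    truth : ∀ (φ : Formula L∈ m) ρ → ⟦ φ ⟧ ρ ⇿ True (inst φ ρ)
    truth (rel mem (var i ∷ var j ∷ [])) ρ = ⇿-refl
    truth (var i ≐ var j) ρ = ⇿-refl
    truth ⊥ ρ = ⇿-refl
    truth (φ ∧ ψ) ρ =
      (λ (a , b) → true (λ n σ → ⇒-i (⇒-i (∧-i #1 #0))) · proj₁ (truth φ ρ) a · proj₁ (truth ψ ρ) b) ,
      (λ p → proj₂ (truth φ ρ) (true (λ n σ → ⇒-i (∧-e₁ #0)) · p) ,
             proj₂ (truth ψ ρ) (true (λ n σ → ⇒-i (∧-e₂ #0)) · p))
    truth (φ ∨ ψ) ρ =
      (λ h → maximal (φ ∨ ψ) ρ (λ p → h
        (λ a → p · (true (λ n σ → ⇒-i (∨-i₁ #0)) · proj₁ (truth φ ρ) a))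
        (λ b → p · (true (λ n σ → ⇒-i (∨-i₂ #0)) · proj₁ (truth ψ ρ) b)))) ,
      (λ p f f′ → true (λ n σ → ⇒-i (⇒-i (⇒-i (∨-e #2 (⇒-e #2 #0) (⇒-e #1 #0))))) · p
        · refute φ ρ (f ∘ proj₂ (truth φ ρ)) · refute ψ ρ (f′ ∘ proj₂ (truth ψ ρ)))
    truth (φ ⇒ ψ) ρ =
      (λ f → maximal (φ ⇒ ψ) ρ (λ p →
        (true (λ n σ → ⇒-i (⇒-i (⇒-e #1 (⇒-i #1)))) · p) ·
        proj₁ (truth ψ ρ) (f (proj₂ (truth φ ρ) (true (λ n σ → ⇒-i (raa (⇒-e #1 (⇒-i (raa (⇒-e #2 #1)))))) · p))))) ,
      (λ p a → proj₂ (truth ψ ρ) (p · proj₁ (truth φ ρ) a))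
    truth (all φ) ρ =
      (λ f → generic-correct φ ρ (proj₁ (truth φ _) (f _))) ,
      (λ p x → proj₂ (truth φ (x ∷ ρ)) (true (specialize φ x ρ) · p))
    truth (ex φ) ρ =
      (λ h → True-stable (ex φ) ρ (λ f → h (λ x a → f (true (exists φ x ρ) · proj₁ (truth φ (x ∷ ρ)) a)))) ,
      (λ p f → true (none φ ρ) ·
        generic-correct (¬ φ) ρ (refute φ (generic (¬ φ) ρ ∷ ρ) (f (generic (¬ φ) ρ) ∘ proj₂ (truth φ (generic (¬ φ) ρ ∷ ρ)))) · p)

    model : Model
    model = record
      { M = ℕ
      ; 𝔽 = True ⊥ₐ
      ; _∈_ = _∈_
      ; _≈_ = _≈_
      ; ∈-stable = λ {x} {y} → True-stable (rel mem (var zero ∷ var (suc zero) ∷ [])) (x ∷ y ∷ [])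
      ; ≈-stable = λ {x} {y} → True-stable (var zero ≐ var (suc zero)) (x ∷ y ∷ [])
      ; ≈-refl = true (λ n σ → ≐-refl)
      ; ≈-subst = λ φ {ρ} {x} {y} e p → proj₂ (truth φ (y ∷ ρ)) (true (replace φ ρ x y) · e · proj₁ (truth φ (x ∷ ρ)) p)
      -- If `¬ φ` held at its own generic name it would hold everywhere; so an existing example of
      -- `φ` can be found at that name.
      ; witness = λ φ → generic (¬ φ)
      ; witness-correct = λ φ {ρ} h → proj₂ (truth φ (generic (¬ φ) ρ ∷ ρ)) (True-stable φ (generic (¬ φ) ρ ∷ ρ) (λ f →
          true (none φ ρ) · generic-correct (¬ φ) ρ (refute φ (generic (¬ φ) ρ ∷ ρ) f) · proj₁ (truth (ex φ) ρ) h))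
      }
      where
      replace : ∀ (φ : Formula L∈ (suc m)) ρ x y →
        Valid (inst (var zero ≐ var (suc zero)) (x ∷ y ∷ []) ⊃ inst φ (x ∷ ρ) ⊃ inst φ (y ∷ ρ))
      replace φ ρ x y n σ = ⇒-i (⇒-i (cast (rename-[] φ {h = σ ∘ lookup (y ∷ ρ)} refl (λ _ → refl))
        (≐-subst (rename (lift _) φ) #1 (cast (sym (rename-[] φ {h = σ ∘ lookup (x ∷ ρ)} refl (λ _ → refl))) #0))))

-- Names must be sent to variables, so `Valid` says nothing about the empty scope. The sentence is
-- therefore derived with one spare variable, which the rule `nonempty` then discharges.
completeness : ∀ {T : Theory L∈} {σ} →
  (∀ 𝓜 → (∀ {τ} → T τ → Model.⟦_⟧ 𝓜 τ []) → Model.⟦_⟧ 𝓜 σ []) → T ⊢ σ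
completeness {T} {σ} h = ⇒-e (⇒-e drop (∀-i σ↑)) nonempty
  where
  open Henkin T
  open Completion σ

  axioms : ∀ {τ} → T τ → True (inst τ [])
  axioms {τ} t = true (λ n _ → cast (rename-cong τ (λ ())) (axiom t))

  -- The term model of the theory containing `¬ σ` satisfies `T`, hence also `σ`; so its falsum
  -- holds.
  inconsistent : stage 0 ⊩ ⊥ₐ
  inconsistent = false→stage 0 ((0 , assumption (new tt)) ·
    proj₁ (truth σ []) (h model (λ {τ} t → proj₂ (truth τ []) (axioms t))))

  sound : ∀ {d} → (λ _ → Empty) ⊩ d → Valid d
  sound (valid v)      = v
  sound (assumption ())
  sound (mp p q) n σ   = ⇒-e (sound p n σ) (sound q n σ)

  σ↑ : T ∣ [] ⊢ var zero ≐ var zero ⇒ rename suc σ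
  σ↑ = ⇒-e (⇒-i (⇒-i (raa (⇒-e #2 #0))))
    (cast (cong (λ φ → ¬ ¬ φ) (rename-cong σ (λ ()))) (sound (deduction inconsistent) 1 (λ _ → zero)))

  drop : T ∣ [] ⊢ all (var zero ≐ var zero ⇒ rename suc σ) ⇒ ex (var zero ≐ var zero) ⇒ σ
  drop = ⇒-i (⇒-i (∃-e #0 (⇒-e
    (cast (rename-lift-suc-[] (var zero ≐ var zero ⇒ rename suc σ)) (∀-e #2 (var zero))) #0)))

-- Definable relations and operations

module Definability (𝓜 : Model) where
  open Model 𝓜 public

  private variable
    A B C : Set
    k m n : ℕ
    x y z : M
    ρ ρ′ : Vec M n

  record Stable (A : Set) : Set where
    constructor mkStable
    field by-contradiction : ((A → 𝔽) → 𝔽) → A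
  open Stable ⦃ ... ⦄ public

  instance
    stable-𝔽 : Stable 𝔽
    stable-𝔽 = mkStable (λ h → h id)

    stable-∈ : Stable (x ∈ y)
    stable-∈ = mkStable ∈-stable

    stable-≈ : Stable (x ≈ y)
    stable-≈ = mkStable ≈-stable

    stable-× : ⦃ Stable A ⦄ → ⦃ Stable B ⦄ → Stable (A × B)
    stable-× = mkStable λ h →
      by-contradiction (λ f → h (f ∘ proj₁)) , by-contradiction (λ f → h (f ∘ proj₂))

    stable-Π : {B : A → Set} → ⦃ ∀ {x} → Stable (B x) ⦄ → Stable (∀ x → B x)
    stable-Π = mkStable λ h x → by-contradiction (λ f → h (λ b → f (b x)))

  ⟦⟧-stable : ∀ (φ : Formula L∈ n) {ρ} → Stable (⟦ φ ⟧ ρ)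
  ⟦⟧-stable (rel mem (s ∷ t ∷ [])) = stable-∈
  ⟦⟧-stable (s ≐ t) = stable-≈
  ⟦⟧-stable ⊥       = stable-𝔽
  ⟦⟧-stable (φ ∧ ψ) = stable-× ⦃ ⟦⟧-stable φ ⦄ ⦃ ⟦⟧-stable ψ ⦄
  ⟦⟧-stable (φ ∨ ψ) = stable-Π
  ⟦⟧-stable (φ ⇒ ψ) = stable-Π ⦃ ⟦⟧-stable ψ ⦄
  ⟦⟧-stable (all φ) = stable-Π ⦃ ⟦⟧-stable φ ⦄
  ⟦⟧-stable (ex φ)  = stable-Π

  infix 3 ¬̃_
  ¬̃_ : Set → Set
  ¬̃ A = A → 𝔽

  infixr 2 _∨̃_
  _∨̃_ : Set → Set → Set
  A ∨̃ B = (¬̃ A) → (¬̃ B) → 𝔽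

  ∃̃ : (A → Set) → Set
  ∃̃ B = (∀ x → ¬̃ B x) → 𝔽

  some : ∀ {B : A → Set} x → B x → ∃̃ B
  some x b h = h x b

  infixl 1 _>>=_
  -- A weak existential can be opened only for a stable goal. Instance search supplies the
  -- stability, so that proofs can be written as if existentials came with witnesses.
  _>>=_ : ∀ {B : A → Set} → ⦃ Stable C ⦄ → ∃̃ B → (Σ A B → C) → C
  h >>= f = by-contradiction (λ c → h (λ x b → c (f (x , b))))

  inl : A → A ∨̃ B
  inl a f _ = f a

  inr : B → A ∨̃ B
  inr b _ f = f b

  either : ⦃ Stable C ⦄ → A ∨̃ B → (A → C) → (B → C) → C
  either h f f′ = by-contradiction (λ c → h (c ∘ f) (c ∘ f′))

  absurd : ⦃ Stable C ⦄ → 𝔽 → C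
  absurd f = by-contradiction (λ _ → f)

  by-cases : ∀ A → ⦃ Stable C ⦄ → (A → C) → (¬̃ A → C) → C
  by-cases A f f′ = by-contradiction (λ c → c (f′ (c ∘ f)))

  ≈-sym : x ≈ y → y ≈ x
  ≈-sym {x} e = ≈-subst (var zero ≐ var (suc zero)) {x ∷ []} e ≈-refl

  ≈-trans : x ≈ y → y ≈ z → x ≈ z
  ≈-trans {x} e e′ = ≈-subst (var (suc zero) ≐ var zero) {x ∷ []} e′ e

  ∈-respˡ : x ≈ y → x ∈ z → y ∈ z
  ∈-respˡ {z = z} = ≈-subst (rel mem (var zero ∷ var (suc zero) ∷ [])) {z ∷ []}

  ∈-respʳ : x ≈ y → z ∈ x → z ∈ y
  ∈-respʳ {z = z} = ≈-subst (rel mem (var (suc zero) ∷ var zero ∷ [])) {z ∷ []}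

  infix 4 _≋_
  _≋_ : Vec M n → Vec M n → Set
  _≋_ = Pointwise _≈_

  ≋-sym : ρ ≋ ρ′ → ρ′ ≋ ρ
  ≋-sym = Pointwise.sym ≈-sym

  ⟦⟧-resp : ∀ (φ : Formula L∈ n) → ρ ≋ ρ′ → ⟦ φ ⟧ ρ → ⟦ φ ⟧ ρ′
  ⟦⟧-resp (rel mem (var i ∷ var j ∷ [])) e =
    ∈-respˡ (Pointwise.lookup e i) ∘ ∈-respʳ (Pointwise.lookup e j)
  ⟦⟧-resp (var i ≐ var j) e p =
    ≈-trans (≈-sym (Pointwise.lookup e i)) (≈-trans p (Pointwise.lookup e j))
  ⟦⟧-resp ⊥       e = id
  ⟦⟧-resp (φ ∧ ψ) e (a , b) = ⟦⟧-resp φ e a , ⟦⟧-resp ψ e b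
  ⟦⟧-resp (φ ∨ ψ) e h f f′ = h (f ∘ ⟦⟧-resp φ e) (f′ ∘ ⟦⟧-resp ψ e)
  ⟦⟧-resp (φ ⇒ ψ) e h = ⟦⟧-resp ψ e ∘ h ∘ ⟦⟧-resp φ (≋-sym e)
  ⟦⟧-resp (all φ) e h x = ⟦⟧-resp φ (≈-refl ∷ e) (h x)
  ⟦⟧-resp (ex φ)  e h f = h (λ x → f x ∘ ⟦⟧-resp φ (≈-refl ∷ e))

  -- Definable relations and operations carry their intended meaning along with
  -- the defining formula, so that proofs only ever see the meaning.
  record Predicate (n : ℕ) : Set₁ where
    field
      formula : Formula L∈ n
      holds   : Vec M n → Set
      correct : ∀ ρ → ⟦ formula ⟧ ρ ⇿ holds ρ
  open Predicate public using (formula; holds)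

  record Operation (n : ℕ) : Set₁ where
    field
      graph   : Formula L∈ (suc n)
      apply   : Vec M n → M
      correct : ∀ ρ {y} → ⟦ graph ⟧ (y ∷ ρ) ⇿ y ≈ apply ρ
  open Operation public using (graph; apply)

  stable-holds : ∀ (P : Predicate n) {ρ} → Stable (holds P ρ)
  stable-holds P {ρ} = mkStable λ h → proj₁ (Predicate.correct P ρ)
    (by-contradiction ⦃ ⟦⟧-stable (formula P) ⦄ (λ f → h (f ∘ proj₂ (Predicate.correct P ρ))))

  holds-resp : ∀ (P : Predicate n) → ρ ≋ ρ′ → holds P ρ → holds P ρ′
  holds-resp P e = proj₁ (Predicate.correct P _) ∘ ⟦⟧-resp (formula P) e ∘ proj₂ (Predicate.correct P _)

  apply-cong : ∀ (f : Operation n) → ρ ≋ ρ′ → apply f ρ ≈ apply f ρ′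
  apply-cong f e = proj₁ (Operation.correct f _)
    (⟦⟧-resp (graph f) (≈-refl ∷ e) (proj₂ (Operation.correct f _) ≈-refl))

  -- `h` does to environments what `r` does to variables. Giving it separately keeps the meaning a
  -- function that computes on explicit vectors.
  reindexᵖ : (r : Fin m → Fin n) (h : Vec M n → Vec M m) →
    (∀ ρ i → lookup ρ (r i) ≡ lookup (h ρ) i) → Predicate m → Predicate n
  reindexᵖ r h e P = record
    { formula = rename r (formula P)
    ; holds   = holds P ∘ h
    ; correct = λ ρ → ⟦rename⟧ (formula P) (e ρ) ⨾ Predicate.correct P (h ρ) }

  reindexᵒ : (r : Fin m → Fin n) (h : Vec M n → Vec M m) →
    (∀ ρ i → lookup ρ (r i) ≡ lookup (h ρ) i) → Operation m → Operation n
  reindexᵒ r h e f = record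
    { graph   = rename (lift r) (graph f)
    ; apply   = apply f ∘ h
    ; correct = λ ρ → ⟦rename⟧ (graph f) (lift-lookup (e ρ)) ⨾ Operation.correct f (h ρ) }

  weakenᵒ : Operation n → Operation (suc n)
  weakenᵒ = reindexᵒ suc tail (λ { (x ∷ ρ) i → refl })

  varᵒ : Fin n → Operation n
  varᵒ i = record
    { graph   = var zero ≐ var (suc i)
    ; apply   = λ ρ → lookup ρ i
    ; correct = λ ρ → ⇿-refl }

  infix 8 _∈ᵖ_ _≈ᵖ_
  infixr 7 _∧ᵖ_
  infixr 6 _∨ᵖ_
  infixr 5 _⇒ᵖ_
  infix 9 ¬ᵖ_
  infix 10 _$ᵖ_ _$ᵒ_

  applies : Vec (Operation n) k → Vec M n → Vec M k
  applies []       ρ = []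
  applies (f ∷ fs) ρ = apply f ρ ∷ applies fs ρ

  -- Variables are the only terms of `L∈`, so the values of operations have to be introduced by
  -- quantifiers before a formula can speak of them.
  let-in : Vec (Operation n) k → Formula L∈ (k + n) → Formula L∈ n
  let-in []               χ = χ
  let-in {k = suc k} (f ∷ fs) χ = let-in fs (ex (rename (lift (k ↑ʳ_)) (graph f) ∧ χ))

  ⟦let-in⟧ : ∀ (fs : Vec (Operation n) k) χ → ⟦ let-in fs χ ⟧ ρ ⇿ ⟦ χ ⟧ (applies fs ρ ++ ρ)
  ⟦let-in⟧ [] χ = ⇿-refl
  ⟦let-in⟧ {ρ = ρ} (f ∷ fs) χ = ⟦let-in⟧ fs _ ⨾
    (λ h → _>>=_ ⦃ ⟦⟧-stable χ ⦄ h λ (y , p , q) → ⟦⟧-resp χ (proj₁ (graph-at y) p ∷ Pointwise.refl ≈-refl) q) ,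
    (λ q → some (apply f ρ) (proj₂ (graph-at _) ≈-refl , q))
    where
    graph-at : ∀ y → ⟦ rename (lift (_ ↑ʳ_)) (graph f) ⟧ (y ∷ applies fs ρ ++ ρ) ⇿ y ≈ apply f ρ
    graph-at y = ⟦rename⟧ (graph f) (lift-lookup (lookup-++ʳ (applies fs ρ) ρ)) ⨾ Operation.correct f ρ

  _$ᵖ_ : Predicate k → Vec (Operation n) k → Predicate n
  _$ᵖ_ {n = n} P fs = record
    { formula = let-in fs (rename (_↑ˡ n) (formula P))
    ; holds   = λ ρ → holds P (applies fs ρ)
    ; correct = λ ρ → ⟦let-in⟧ fs _ ⨾ ⟦rename⟧ (formula P) (lookup-++ˡ (applies fs ρ) ρ) ⨾ Predicate.correct P _ }

  applies-weakenᵒ : ∀ (fs : Vec (Operation n) k) → applies (map weakenᵒ fs) (y ∷ ρ) ≡ applies fs ρ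
  applies-weakenᵒ []       = refl
  applies-weakenᵒ (f ∷ fs) = cong (_ ∷_) (applies-weakenᵒ fs)

  _$ᵒ_ : Operation k → Vec (Operation n) k → Operation n
  _$ᵒ_ {k} {n} f fs = record
    { graph   = let-in (map weakenᵒ fs) (rename place (graph f))
    ; apply   = λ ρ → apply f (applies fs ρ)
    ; correct = λ ρ {y} → ⟦let-in⟧ (map weakenᵒ fs) _ ⨾
        ⟦rename⟧ (graph f) (placed ρ y) ⨾ Operation.correct f (applies fs ρ) }
    where
    place : Fin (suc k) → Fin (k + suc n)
    place zero    = k ↑ʳ zero
    place (suc i) = i ↑ˡ suc n

    placed : ∀ ρ y i → lookup (applies (map weakenᵒ fs) (y ∷ ρ) ++ y ∷ ρ) (place i) ≡ lookup (y ∷ applies fs ρ) i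
    placed ρ y zero    = lookup-++ʳ (applies (map weakenᵒ fs) (y ∷ ρ)) (y ∷ ρ) zero
    placed ρ y (suc i) = trans (lookup-++ˡ (applies (map weakenᵒ fs) (y ∷ ρ)) (y ∷ ρ) i)
      (cong (λ τ → lookup τ i) (applies-weakenᵒ fs))

  _∈ᵖ_ _≈ᵖ_ : Operation n → Operation n → Predicate n
  s ∈ᵖ t = membership $ᵖ (s ∷ t ∷ [])
    where
    membership : Predicate 2
    membership = record
      { formula = rel mem (var zero ∷ var (suc zero) ∷ [])
      ; holds   = λ { (x ∷ y ∷ []) → x ∈ y }
      ; correct = λ { (x ∷ y ∷ []) → ⇿-refl } }
  s ≈ᵖ t = equality $ᵖ (s ∷ t ∷ [])
    where
    equality : Predicate 2
    equality = record
      { formula = var zero ≐ var (suc zero)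
      ; holds   = λ { (x ∷ y ∷ []) → x ≈ y }
      ; correct = λ { (x ∷ y ∷ []) → ⇿-refl } }

  ⊥ᵖ : Predicate n
  ⊥ᵖ = record { formula = ⊥ ; holds = λ _ → 𝔽 ; correct = λ _ → ⇿-refl }

  _∧ᵖ_ _∨ᵖ_ _⇒ᵖ_ : Predicate n → Predicate n → Predicate n
  P ∧ᵖ Q = record
    { formula = formula P ∧ formula Q
    ; holds   = λ ρ → holds P ρ × holds Q ρ
    ; correct = λ ρ → ⇿-× (Predicate.correct P ρ) (Predicate.correct Q ρ) }
  P ∨ᵖ Q = record
    { formula = formula P ∨ formula Q
    ; holds   = λ ρ → holds P ρ ∨̃ holds Q ρ
    ; correct = λ ρ → ⇿-∨ (Predicate.correct P ρ) (Predicate.correct Q ρ) }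
  P ⇒ᵖ Q = record
    { formula = formula P ⇒ formula Q
    ; holds   = λ ρ → holds P ρ → holds Q ρ
    ; correct = λ ρ → ⇿-→ (Predicate.correct P ρ) (Predicate.correct Q ρ) }

  ¬ᵖ_ : Predicate n → Predicate n
  ¬ᵖ P = P ⇒ᵖ ⊥ᵖ

  allᵖ exᵖ : Predicate (suc n) → Predicate n
  allᵖ P = record
    { formula = all (formula P)
    ; holds   = λ ρ → ∀ x → holds P (x ∷ ρ)
    ; correct = λ ρ → ⇿-∀ (λ x → Predicate.correct P (x ∷ ρ)) }
  exᵖ P = record
    { formula = ex (formula P)
    ; holds   = λ ρ → ∃̃ λ x → holds P (x ∷ ρ)
    ; correct = λ ρ → ⇿-∃ (λ x → Predicate.correct P (x ∷ ρ)) }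

  Variable : ℕ → Set₁
  Variable n = ∀ {m} → ⦃ suc n ⊑ m ⦄ → Operation m

  newestᵒ : Variable n
  newestᵒ ⦃ le ⦄ = varᵒ (weaken le zero)

  ∀ᵖ-syntax ∃ᵖ-syntax : (Variable n → Predicate (suc n)) → Predicate n
  ∀ᵖ-syntax P = allᵖ (P newestᵒ)
  ∃ᵖ-syntax P = exᵖ (P newestᵒ)

  infix 1 ∀ᵖ-syntax ∃ᵖ-syntax
  syntax ∀ᵖ-syntax (λ x → P) = ∀ᵖ[ x ] P
  syntax ∃ᵖ-syntax (λ x → P) = ∃ᵖ[ x ] P

  Argument : ℕ → Set₁
  Argument n = ∀ {m} → ⦃ n ⊑ m ⦄ → Operation m

  argument : Fin n → Argument n
  argument i ⦃ le ⦄ = varᵒ (weaken le i)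

  op₁ : (Argument 1 → Operation 1) → Operation 1
  op₁ f = f (argument zero)

  op₂ : (Argument 2 → Argument 2 → Operation 2) → Operation 2
  op₂ f = f (argument zero) (argument (suc zero))

  pred₁ : (Argument 1 → Predicate 1) → Predicate 1
  pred₁ f = f (argument zero)

  pred₂ : (Argument 2 → Argument 2 → Predicate 2) → Predicate 2
  pred₂ f = f (argument zero) (argument (suc zero))

  pred₃ : (Argument 3 → Argument 3 → Argument 3 → Predicate 3) → Predicate 3
  pred₃ f = f (argument zero) (argument (suc zero)) (argument (suc (suc zero)))

  pred₄ : (Argument 4 → Argument 4 → Argument 4 → Argument 4 → Predicate 4) → Predicate 4
  pred₄ f = f (argument zero) (argument (suc zero)) (argument (suc (suc zero))) (argument (suc (suc (suc zero))))

  infixr 9 _∘ᵒ_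
  -- Composition in the first argument only, which passes on an unspecified number of parameters
  -- unchanged.
  _∘ᵒ_ : Operation (suc n) → Operation n → Operation n
  f ∘ᵒ t = record
    { graph   = ex (rename (lift suc) (graph t) ∧ rename swap (graph f))
    ; apply   = λ ρ → apply f (apply t ρ ∷ ρ)
    ; correct = λ ρ {y} →
        (λ h → h >>= λ (s , p , q) →
          ≈-trans (proj₁ (f-at ρ y s) q) (apply-cong f (proj₁ (t-at ρ y s) p ∷ Pointwise.refl ≈-refl))) ,
        (λ e → some (apply t ρ) (proj₂ (t-at ρ y _) ≈-refl , proj₂ (f-at ρ y _) e)) }
    where
    swap : Fin (suc (suc n)) → Fin (suc (suc n))
    swap zero          = suc zero
    swap (suc zero)    = zero
    swap (suc (suc i)) = suc (suc i)

    t-at : ∀ ρ y s → ⟦ rename (lift suc) (graph t) ⟧ (s ∷ y ∷ ρ) ⇿ s ≈ apply t ρ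
    t-at ρ y s = ⟦rename⟧ (graph t) (lift-lookup (λ i → refl)) ⨾ Operation.correct t ρ

    f-at : ∀ ρ y s → ⟦ rename swap (graph f) ⟧ (s ∷ y ∷ ρ) ⇿ y ≈ apply f (s ∷ ρ)
    f-at ρ y s = ⟦rename⟧ (graph f) (λ where
      zero          → refl
      (suc zero)    → refl
      (suc (suc i)) → refl) ⨾ Operation.correct f (s ∷ ρ)

  infix 4 _⇔ᵖ_
  _⇔ᵖ_ : Predicate n → Predicate n → Predicate n
  P ⇔ᵖ Q = (P ⇒ᵖ Q) ∧ᵖ (Q ⇒ᵖ P)

-- Set theory in a model of ZFC

module SetTheory (𝓜 : Model) (axioms : ∀ {τ} → ZFC τ → Model.⟦_⟧ 𝓜 τ []) where
  open Definability 𝓜 public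

  private variable
    k m n : ℕ
    x y z w x′ y′ : M
    ρ ρ′ : Vec M n

  extensional : (∀ z → z ∈ x ⇿ z ∈ y) → x ≈ y
  extensional = axioms ZFC-axioms.extensionality _ _

  minimal : z ∈ x → ∃̃ λ y → y ∈ x × (∀ z → z ∈ x → ¬̃ z ∈ y)
  minimal {z} {x} p = axioms ZFC-axioms.foundation x (some z p) >>= λ (y , q , f) →
    some y (q , λ z r s → f (some z (r , s)))

  lookup-vars : ∀ {r : Fin m → Fin n} i → value (lookup (tabulate (var ∘ r)) i) ρ ≡ lookup ρ (r i)
  lookup-vars {ρ = ρ} i = cong (λ t → value t ρ) (lookup∘tabulate _ i)

  separated : ∀ (P : Predicate (suc n)) ρ a → ∃̃ λ b → ∀ x → x ∈ b ⇿ (x ∈ a × holds P (x ∷ ρ))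
  separated {n} P ρ a =
    proj₁ (⟦closure⟧ n _) (axioms (ZFC-axioms.separation _ (formula P))) ρ a >>= λ (b , h) →
    some b (λ x → h x ⨾ ⇿-× ⇿-refl (⟦subst⟧ (formula P) (λ where
      zero    → refl
      (suc i) → lookup-vars i) ⨾ Predicate.correct P (x ∷ ρ)))

  replaced : ∀ (P : Predicate (suc (suc n))) ρ →
    (∀ {x y z} → holds P (x ∷ y ∷ ρ) → holds P (x ∷ z ∷ ρ) → y ≈ z) →
    ∀ a → ∃̃ λ b → ∀ y → y ∈ b ⇿ (∃̃ λ x → x ∈ a × holds P (x ∷ y ∷ ρ))
  replaced {n} P ρ functional a =
    proj₁ (⟦closure⟧ n _) (axioms (ZFC-axioms.replacement _ (formula P))) ρ
      (λ x y z (p , q) → functional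
        (proj₁ (⟦subst⟧ (formula P) (λ where
          zero          → refl
          (suc zero)    → refl
          (suc (suc i)) → lookup-vars i) ⨾ Predicate.correct P (x ∷ y ∷ ρ)) p)
        (proj₁ (⟦subst⟧ (formula P) (λ where
          zero          → refl
          (suc zero)    → refl
          (suc (suc i)) → lookup-vars i) ⨾ Predicate.correct P (x ∷ z ∷ ρ)) q))
      a
    >>= λ (b , h) → some b (λ y → h y ⨾ ⇿-∃ (λ x → ⇿-× ⇿-refl
      (⟦subst⟧ (formula P) (λ where
        zero          → refl
        (suc zero)    → refl
        (suc (suc i)) → lookup-vars i) ⨾ Predicate.correct P (x ∷ y ∷ ρ))))

  record SetOperation (P : Predicate (suc n)) : Set₁ where
    field
      operation : Operation n
      member    : ∀ {ρ z} → z ∈ apply operation ρ ⇿ holds P (z ∷ ρ)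
  open SetOperation public

  -- The value is a Skolem witness, but the graph is the membership condition itself and so is the
  -- same formula in every model. Extensionality makes the two agree.
  comprehension : (P : Predicate (suc n)) → (∀ ρ → ∃̃ λ s → ∀ z → z ∈ s ⇿ holds P (z ∷ ρ)) → SetOperation P
  comprehension P e = record
    { operation = record
      { graph   = φ
      ; apply   = witness φ
      ; correct = λ ρ {y} →
          (λ h → extensional (λ z → h z ⨾ formula-at ρ y z ⨾ ⇿-sym (chosen-member ρ z))) ,
          (λ q → ⟦⟧-resp φ (≈-sym q ∷ Pointwise.refl ≈-refl) (chosen ρ)) }
    ; member = chosen-member _ _ }
    where
    φ = all (rel mem (var 0F ∷ var 1F ∷ []) ⇔ rename (lift suc) (formula P))

    formula-at : ∀ ρ s z → ⟦ rename (lift suc) (formula P) ⟧ (z ∷ s ∷ ρ) ⇿ holds P (z ∷ ρ)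
    formula-at ρ s z = ⟦rename⟧ (formula P) (lift-lookup (λ i → refl)) ⨾ Predicate.correct P (z ∷ ρ)

    chosen : ∀ ρ → ⟦ φ ⟧ (witness φ ρ ∷ ρ)
    chosen ρ = witness-correct φ (e ρ >>= λ (s , h) → some s (λ z → h z ⨾ ⇿-sym (formula-at ρ s z)))

    chosen-member : ∀ ρ z → z ∈ witness φ ρ ⇿ holds P (z ∷ ρ)
    chosen-member ρ z = chosen ρ z ⨾ formula-at ρ _ z

  SepPredicate : Predicate (suc n) → Operation n → Predicate (suc n)
  SepPredicate P a = varᵒ 0F ∈ᵖ weakenᵒ a ∧ᵖ P

  ImageGraph : Operation (suc n) → Predicate (suc (suc n))
  ImageGraph f = varᵒ 1F ≈ᵖ reindexᵒ (lift suc) (λ ρ → head ρ ∷ tail (tail ρ)) (λ where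
    (x ∷ y ∷ ρ) zero    → refl
    (x ∷ y ∷ ρ) (suc i) → refl) f

  ImagePredicate : Operation (suc n) → Operation n → Predicate (suc n)
  ImagePredicate f a = exᵖ (varᵒ 0F ∈ᵖ weakenᵒ (weakenᵒ a) ∧ᵖ ImageGraph f)

  opaque
    sepˢ : (P : Predicate (suc n)) (a : Operation n) → SetOperation (SepPredicate P a)
    sepˢ P a = comprehension _ (λ ρ → separated P ρ (apply a ρ))

    imageˢ : (f : Operation (suc n)) (a : Operation n) → SetOperation (ImagePredicate f a)
    imageˢ f a = comprehension _ (λ ρ → replaced (ImageGraph f) ρ (λ p q → ≈-trans p (≈-sym q)) (apply a ρ))

    ∅ˢ : SetOperation {n} ⊥ᵖ
    ∅ˢ = comprehension _ (λ _ → axioms ZFC-axioms.infinity >>= λ (_ , e , _) → e >>= λ (o , _ , h) →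
      some o (λ z → h z , absurd))

    pairˢ : SetOperation (pred₃ λ z x y → z ≈ᵖ x ∨ᵖ z ≈ᵖ y)
    pairˢ = comprehension _ (λ { (x ∷ y ∷ []) → axioms ZFC-axioms.pairing x y })

    ⋃ˢ : SetOperation (pred₂ λ z x → ∃ᵖ[ y ] y ∈ᵖ x ∧ᵖ z ∈ᵖ y)
    ⋃ˢ = comprehension _ (λ { (x ∷ []) → axioms ZFC-axioms.union x })

    𝒫ˢ : SetOperation (pred₂ λ z x → ∀ᵖ[ y ] y ∈ᵖ z ⇒ᵖ y ∈ᵖ x)
    𝒫ˢ = comprehension _ (λ { (x ∷ []) → axioms ZFC-axioms.powerset x })

  sepᵒ : Predicate (suc n) → Operation n → Operation n
  sepᵒ P a = operation (sepˢ P a)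

  imageᵒ : Operation (suc n) → Operation n → Operation n
  imageᵒ f a = operation (imageˢ f a)

  ∅ᵒ : Operation n
  ∅ᵒ = operation ∅ˢ

  pairᵒ : Operation 2
  pairᵒ = operation pairˢ

  ⋃ᵒ 𝒫ᵒ : Operation 1
  ⋃ᵒ = operation ⋃ˢ
  𝒫ᵒ = operation 𝒫ˢ

  ∈-sep : ∀ (P : Predicate (suc n)) a → z ∈ apply (sepᵒ P a) ρ ⇿ (z ∈ apply a ρ × holds P (z ∷ ρ))
  ∈-sep P a = member (sepˢ P a)

  ∈-image : ∀ (f : Operation (suc n)) a →
    z ∈ apply (imageᵒ f a) ρ ⇿ (∃̃ λ x → x ∈ apply a ρ × z ≈ apply f (x ∷ ρ))
  ∈-image f a = member (imageˢ f a)

  ∅ : M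
  ∅ = apply ∅ᵒ []

  ∉∅ : ¬̃ z ∈ ∅
  ∉∅ = proj₁ (member ∅ˢ)

  pair : M → M → M
  pair x y = apply pairᵒ (x ∷ y ∷ [])

  ∈-pair : z ∈ pair x y ⇿ (z ≈ x ∨̃ z ≈ y)
  ∈-pair = member pairˢ

  ⋃ 𝒫 : M → M
  ⋃ x = apply ⋃ᵒ (x ∷ [])
  𝒫 x = apply 𝒫ᵒ (x ∷ [])

  ∈-⋃ : z ∈ ⋃ x ⇿ (∃̃ λ y → y ∈ x × z ∈ y)
  ∈-⋃ = member ⋃ˢ

  ∈-𝒫 : z ∈ 𝒫 x ⇿ (∀ y → y ∈ z → y ∈ x)
  ∈-𝒫 = member 𝒫ˢ

  infix 4 _⊆_
  _⊆_ : M → M → Set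
  x ⊆ y = ∀ z → z ∈ x → z ∈ y

  opaque
    ∪ᵒ : Operation 2
    ∪ᵒ = ⋃ᵒ $ᵒ (pairᵒ ∷ [])

    ∈-∪ : z ∈ apply ∪ᵒ (x ∷ y ∷ []) ⇿ (z ∈ x ∨̃ z ∈ y)
    ∈-∪ {z} {x} {y} = ∈-⋃ ⨾
      (λ h → h >>= λ (u , u∈ , z∈u) → either (proj₁ ∈-pair u∈)
        (λ e → inl (∈-respʳ e z∈u)) (λ e → inr (∈-respʳ e z∈u))) ,
      (λ h → either h (λ z∈x → some x (proj₂ ∈-pair (inl ≈-refl) , z∈x))
                      (λ z∈y → some y (proj₂ ∈-pair (inr ≈-refl) , z∈y)))

    singletonᵒ : Operation 1
    singletonᵒ = op₁ λ x → pairᵒ $ᵒ (x ∷ x ∷ [])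

    ∈-singleton : z ∈ apply singletonᵒ (x ∷ []) ⇿ z ≈ x
    ∈-singleton = (λ h → either (proj₁ ∈-pair h) id id) , (λ e → proj₂ ∈-pair (inl e))

  infixl 6 _∪_
  _∪_ : M → M → M
  x ∪ y = apply ∪ᵒ (x ∷ y ∷ [])

  singleton : M → M
  singleton x = apply singletonᵒ (x ∷ [])

  ∪-introˡ : z ∈ x → z ∈ x ∪ y
  ∪-introˡ p = proj₂ ∈-∪ (inl p)

  ∪-introʳ : z ∈ y → z ∈ x ∪ y
  ∪-introʳ p = proj₂ ∈-∪ (inr p)

  ∈-singleton-self : x ∈ singleton x
  ∈-singleton-self = proj₂ ∈-singleton ≈-refl

  opaque
    tupleᵒ : Operation 2
    tupleᵒ = op₂ λ x y → pairᵒ $ᵒ (singletonᵒ $ᵒ (x ∷ []) ∷ pairᵒ $ᵒ (x ∷ y ∷ []) ∷ [])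

  ⟪_,_⟫ : M → M → M
  ⟪ x , y ⟫ = apply tupleᵒ (x ∷ y ∷ [])

  opaque
    unfolding tupleᵒ

    ∈-tuple : z ∈ ⟪ x , y ⟫ ⇿ (z ≈ singleton x ∨̃ z ≈ pair x y)
    ∈-tuple = ∈-pair

  tuple-cong : x ≈ x′ → y ≈ y′ → ⟪ x , y ⟫ ≈ ⟪ x′ , y′ ⟫
  tuple-cong e e′ = apply-cong tupleᵒ (e ∷ e′ ∷ [])

  tuple-injectiveˡ : ⟪ x , y ⟫ ≈ ⟪ x′ , y′ ⟫ → x ≈ x′
  tuple-injectiveˡ {x} {y} {x′} {y′} e = ≈-sym (proj₁ ∈-singleton x′∈)
    where
    x′∈ : x′ ∈ singleton x
    x′∈ = either (proj₁ ∈-tuple (∈-respʳ e (proj₂ ∈-tuple (inl ≈-refl))))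
      (λ q → ∈-respʳ (≈-sym q) ∈-singleton-self)
      (λ q → ∈-respʳ (≈-sym q) (proj₂ ∈-pair (inl ≈-refl)))

  tuple-injectiveʳ : ⟪ x , y ⟫ ≈ ⟪ x′ , y′ ⟫ → y ≈ y′
  tuple-injectiveʳ {x} {y} {x′} {y′} e = either (second e) id λ y≈x′ →
    either (second (≈-sym e)) ≈-sym λ y′≈x →
    ≈-trans y≈x′ (≈-trans (≈-sym (tuple-injectiveˡ e)) (≈-sym y′≈x))
    where
    second : ∀ {x y x′ y′} → ⟪ x , y ⟫ ≈ ⟪ x′ , y′ ⟫ → y ≈ y′ ∨̃ y ≈ x′
    second e = either (proj₁ ∈-tuple (∈-respʳ e (proj₂ ∈-tuple (inr ≈-refl))))
      (λ q → inr (proj₁ ∈-singleton (∈-respʳ q (proj₂ ∈-pair (inr ≈-refl)))))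
      (λ q → either (proj₁ ∈-pair (∈-respʳ q (proj₂ ∈-pair (inr ≈-refl)))) inr inl)

-- Von Neumann ordinals.

module Ordinals (𝓜 : Model) (axioms : ∀ {τ} → ZFC τ → Model.⟦_⟧ 𝓜 τ []) where
  open SetTheory 𝓜 axioms public

  private variable
    n : ℕ
    x y z α β γ δ : M
    ρ : Vec M n

  ∉-self : ¬̃ x ∈ x
  ∉-self {x} p = minimal (∈-singleton-self {x}) >>= λ (y , y∈ , h) →
    h x ∈-singleton-self (∈-respʳ (≈-sym (proj₁ ∈-singleton y∈)) p)

  -- In the presence of foundation a transitive set of transitive sets is an ordinal;
  -- well-foundedness need not be part of the definition.
  Trans Ord : M → Set
  Trans x = ∀ y → y ∈ x → ∀ z → z ∈ y → z ∈ x
  Ord x = Trans x × (∀ y → y ∈ x → Trans y)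

  transᵖ ordᵖ : Predicate 1
  transᵖ = pred₁ λ x → ∀ᵖ[ y ] y ∈ᵖ x ⇒ᵖ (∀ᵖ[ z ] z ∈ᵖ y ⇒ᵖ z ∈ᵖ x)
  ordᵖ = pred₁ λ x → transᵖ $ᵖ (x ∷ []) ∧ᵖ (∀ᵖ[ y ] y ∈ᵖ x ⇒ᵖ transᵖ $ᵖ (y ∷ []))

  Ord-resp : x ≈ y → Ord x → Ord y
  Ord-resp e = holds-resp ordᵖ (e ∷ [])

  Ord-∈ : Ord x → y ∈ x → Ord y
  Ord-∈ (t , h) y∈x = h _ y∈x , λ z z∈y → h z (t _ y∈x z z∈y)

  ∈-trans : Ord z → x ∈ y → y ∈ z → x ∈ z
  ∈-trans (t , _) x∈y y∈z = t _ y∈z _ x∈y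

  ∈-asym : Ord x → x ∈ y → ¬̃ y ∈ x
  ∈-asym o x∈y y∈x = ∉-self (∈-trans o x∈y y∈x)

  -- Foundation is applied to the set of members of `α` with the property; if it is empty, `α`
  -- itself is least.
  least : ∀ (P : Predicate (suc n)) ρ → Ord α → holds P (α ∷ ρ) →
    ∃̃ λ β → Ord β × holds P (β ∷ ρ) × (∀ γ → γ ∈ β → ¬̃ holds P (γ ∷ ρ))
  least {α = α} P ρ o p =
    separated P ρ α >>= λ (s , ∈s) →
    by-cases (∃̃ λ β → β ∈ s)
      (λ h → h >>= λ (β , β∈s) → minimal β∈s >>= λ (γ , γ∈s , min) →
        let γ∈α , q = proj₁ (∈s γ) γ∈s in
        some γ (Ord-∈ o γ∈α , q , λ δ δ∈γ r →
          min δ (proj₂ (∈s δ) (∈-trans o δ∈γ γ∈α , r)) δ∈γ))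
      (λ h → some α (o , p , λ γ γ∈α q → h (some γ (proj₂ (∈s γ) (γ∈α , q)))))

  ordinal-induction : ∀ (P : Predicate (suc n)) ρ →
    (∀ α → Ord α → (∀ β → β ∈ α → holds P (β ∷ ρ)) → holds P (α ∷ ρ)) →
    ∀ α → Ord α → holds P (α ∷ ρ)
  ordinal-induction P ρ step α o = by-contradiction ⦃ stable-holds P ⦄ λ ¬p →
    least (¬ᵖ P) ρ o ¬p >>= λ (β , oβ , ¬q , min) →
    ¬q (step β oβ (λ γ γ∈β → by-contradiction ⦃ stable-holds P ⦄ (min γ γ∈β)))

  Comparable : M → M → Set
  Comparable α β = α ∈ β ∨̃ α ≈ β ∨̃ β ∈ α

  comparableᵖ : Predicate 2
  comparableᵖ = pred₂ λ α β → α ∈ᵖ β ∨ᵖ α ≈ᵖ β ∨ᵖ β ∈ᵖ α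

  -- Nested induction. If neither ordinal belongs to the other, comparing the members of each with
  -- the other ordinal shows that both have the same members.
  trichotomy : Ord α → Ord β → Comparable α β
  trichotomy {α} {β} oα oβ = ordinal-induction
    (pred₁ λ α → ∀ᵖ[ β ] ordᵖ $ᵖ (β ∷ []) ⇒ᵖ comparableᵖ $ᵖ (α ∷ β ∷ [])) []
    (λ α oα ih → ordinal-induction (pred₂ λ β α → comparableᵖ $ᵖ (α ∷ β ∷ [])) (α ∷ [])
      (λ β oβ ih′ ¬∈ ¬≈∋ → ¬≈∋ (inl (extensional λ z →
        (λ z∈α → either (ih z z∈α β oβ) id λ c → either c
          (λ z≈β → absurd (¬≈∋ (inr (∈-respˡ z≈β z∈α))))
          (λ β∈z → absurd (¬≈∋ (inr (∈-trans oα β∈z z∈α))))) ,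
        (λ z∈β → either (ih′ z z∈β)
          (λ α∈z → absurd (¬∈ (∈-trans oβ α∈z z∈β)))
          (λ c → either c (λ α≈z → absurd (¬∈ (∈-respˡ (≈-sym α≈z) z∈β))) id))))))
    α oα β oβ

  ⊆⇒∈∨≈ : Ord α → Ord β → α ⊆ β → α ∈ β ∨̃ α ≈ β
  ⊆⇒∈∨≈ oα oβ s = either (trichotomy oα oβ) inl λ c → either c inr (absurd ∘ ∉-self ∘ s _)

  ∈∨≈⇒⊆ : Ord β → α ∈ β ∨̃ α ≈ β → α ⊆ β
  ∈∨≈⇒⊆ oβ h z z∈α = either h (∈-trans oβ z∈α) (λ e → ∈-respʳ e z∈α)

  ∉⇒∋∨≈ : Ord α → Ord β → ¬̃ α ∈ β → β ∈ α ∨̃ β ≈ α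
  ∉⇒∋∨≈ oα oβ ∉ = either (trichotomy oα oβ) (absurd ∘ ∉) λ c → either c (inr ∘ ≈-sym) inl

  Ord-∅ : Ord ∅
  Ord-∅ = (λ y y∈ → absurd (∉∅ y∈)) , (λ y y∈ → absurd (∉∅ y∈))

  Ord-⋃ : (∀ y → y ∈ x → Ord y) → Ord (⋃ x)
  Ord-⋃ h =
    (λ y y∈ z z∈y → proj₁ ∈-⋃ y∈ >>= λ (u , u∈x , y∈u) → proj₂ ∈-⋃ (some u (u∈x , ∈-trans (h u u∈x) z∈y y∈u))) ,
    (λ y y∈ → proj₁ ∈-⋃ y∈ >>= λ (u , u∈x , y∈u) → proj₂ (h u u∈x) y y∈u)

  Ord-∪ : Ord x → Ord y → Ord (x ∪ y)
  Ord-∪ (t , h) (t′ , h′) =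
    (λ z z∈ w w∈z → either (proj₁ ∈-∪ z∈) (λ p → ∪-introˡ (t z p w w∈z)) (λ p → ∪-introʳ (t′ z p w w∈z))) ,
    (λ z z∈ → either (proj₁ ∈-∪ z∈) (h z) (h′ z))

  ∪-absorbˡ : x ⊆ y → x ∪ y ≈ y
  ∪-absorbˡ s = extensional λ z → (λ z∈ → either (proj₁ ∈-∪ z∈) (s z) id) , ∪-introʳ

  ∪-comm : x ∪ y ≈ y ∪ x
  ∪-comm = extensional λ z →
    (λ z∈ → either (proj₁ ∈-∪ z∈) ∪-introʳ ∪-introˡ) , (λ z∈ → either (proj₁ ∈-∪ z∈) ∪-introʳ ∪-introˡ)

  ∪-cong : ∀ {x′ y′} → x ≈ x′ → y ≈ y′ → x ∪ y ≈ x′ ∪ y′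
  ∪-cong e e′ = apply-cong ∪ᵒ (e ∷ e′ ∷ [])

  succ : M → M
  succ x = x ∪ singleton x

  ∈-succ : z ∈ succ x ⇿ (z ∈ x ∨̃ z ≈ x)
  ∈-succ = ∈-∪ ⨾ ⇿-∨ ⇿-refl ∈-singleton

  Ord-succ : Ord x → Ord (succ x)
  Ord-succ (t , h) =
    (λ y y∈ z z∈y → proj₂ ∈-succ (inl (either (proj₁ ∈-succ y∈) (λ y∈x → t y y∈x z z∈y) (λ e → ∈-respʳ e z∈y)))) ,
    (λ y y∈ → either (proj₁ ∈-succ y∈) (h y) (λ e z z∈y w w∈z →
      ∈-respʳ (≈-sym e) (t z (∈-respʳ e z∈y) w w∈z)))

  strict-bound : ∀ s → ∃̃ λ α → Ord α × (∀ β → β ∈ s → Ord β → β ∈ α)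
  strict-bound s = some (succ (⋃ t)) (Ord-succ o , λ β β∈s oβ →
    proj₂ ∈-succ (⊆⇒∈∨≈ oβ o (λ z z∈β → proj₂ ∈-⋃ (some β (proj₂ (∈-sep ordᵖ′ (varᵒ 0F)) (β∈s , oβ) , z∈β)))))
    where
    ordᵖ′ = ordᵖ $ᵖ (varᵒ 0F ∷ [])
    t = apply (sepᵒ ordᵖ′ (varᵒ 0F)) (s ∷ [])
    o : Ord (⋃ t)
    o = Ord-⋃ (λ y y∈ → proj₂ (proj₁ (∈-sep ordᵖ′ (varᵒ 0F)) y∈))

-- Transfinite recursion.

module TransfiniteRecursion (𝓜 : Model) (axioms : ∀ {τ} → ZFC τ → Model.⟦_⟧ 𝓜 τ []) where
  open Ordinals 𝓜 axioms public

  private variable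
    n : ℕ
    x y z f f′ α β ξ η : M

  belowPredicate : Predicate 3
  belowPredicate = pred₃ λ z f ξ → ∃ᵖ[ η ] η ∈ᵖ ξ ∧ᵖ tupleᵒ $ᵒ (η ∷ z ∷ []) ∈ᵖ f

  opaque
    -- The image of an ordinal under a relation `f`. Second components of Kuratowski pairs in `f`
    -- lie in `⋃ (⋃ f)`, so separation suffices.
    belowᵒ : Operation 2
    belowᵒ = sepᵒ belowPredicate (⋃ᵒ $ᵒ (⋃ᵒ $ᵒ (varᵒ 0F ∷ []) ∷ []))

  below : M → M → M
  below f ξ = apply belowᵒ (f ∷ ξ ∷ [])

  opaque
    unfolding belowᵒ

    ∈-below : z ∈ below f ξ ⇿ (∃̃ λ η → η ∈ ξ × ⟪ η , z ⟫ ∈ f)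
    ∈-below = ∈-sep belowPredicate (⋃ᵒ $ᵒ (⋃ᵒ $ᵒ (varᵒ 0F ∷ []) ∷ [])) ⨾ proj₂ , λ h →
      (h >>= λ (η , _ , p) → proj₂ ∈-⋃ (some _
        (proj₂ ∈-⋃ (some _ (p , proj₂ ∈-tuple (inr ≈-refl))) , proj₂ ∈-pair (inr ≈-refl)))) , h

  -- `H` receives only the set of earlier values, not the function producing them. This is enough
  -- for enumerations that always take something new.
  module Recursion (H : Operation (suc n)) where
    H⟨_⟩ : M → Vec M n → M
    H⟨ s ⟩ ρ = apply H (s ∷ ρ)

    H-cong : ∀ ρ → x ≈ y → H⟨ x ⟩ ρ ≈ H⟨ y ⟩ ρ
    H-cong ρ e = apply-cong H (e ∷ Pointwise.refl ≈-refl)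

    -- Nothing is asked of `f` outside `α`, so an attempt serves unchanged for every smaller
    -- ordinal.
    Attempt : M → M → Vec M n → Set
    Attempt f α ρ = ∀ ξ → ξ ∈ α → ∀ y → ⟪ ξ , y ⟫ ∈ f ⇿ y ≈ H⟨ below f ξ ⟩ ρ

    attemptᵖ : Predicate (suc (suc n))
    attemptᵖ = allᵖ (varᵒ 0F ∈ᵖ varᵒ 2F ⇒ᵖ allᵖ
      (tupleᵒ $ᵒ (varᵒ 1F ∷ varᵒ 0F ∷ []) ∈ᵖ varᵒ 2F ⇔ᵖ
       varᵒ 0F ≈ᵖ H′ ∘ᵒ (belowᵒ $ᵒ (varᵒ 2F ∷ varᵒ 1F ∷ []))))
      where
      H′ : Operation (suc (suc (suc (suc (suc n)))))
      H′ = reindexᵒ (lift (4 ↑ʳ_)) (λ σ → head σ ∷ tail (tail (tail (tail (tail σ))))) (λ where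
        (s ∷ _ ∷ _ ∷ _ ∷ _ ∷ ρ) zero    → refl
        (s ∷ _ ∷ _ ∷ _ ∷ _ ∷ ρ) (suc i) → refl) H

    Attempt-⊆ : ∀ {ρ} → β ⊆ α → Attempt f α ρ → Attempt f β ρ
    Attempt-⊆ s a ξ ξ∈β = a ξ (s ξ ξ∈β)

    -- The value at `η` depends on an attempt only through its image of `η`, so induction makes any
    -- two attempts agree.
    below-unique : ∀ {ρ} → Ord ξ → Attempt f ξ ρ → Attempt f′ ξ ρ → below f ξ ≈ below f′ ξ
    below-unique {ξ} {f} {f′} {ρ} oξ a a′ = extensional λ z →
      ∈-below ⨾ ⇿-∃ (λ η →
        (λ (η∈ , p) → η∈ , proj₁ (agree η (Ord-∈ oξ η∈) η∈ z) p) ,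
        (λ (η∈ , p) → η∈ , proj₂ (agree η (Ord-∈ oξ η∈) η∈ z) p)) ⨾ ⇿-sym ∈-below
      where
      agree : ∀ η → Ord η → η ∈ ξ → ∀ z → ⟪ η , z ⟫ ∈ f ⇿ ⟪ η , z ⟫ ∈ f′
      agree = ordinal-induction
        (pred₄ λ η f f′ ξ → η ∈ᵖ ξ ⇒ᵖ (∀ᵖ[ z ] (tupleᵒ $ᵒ (η ∷ z ∷ []) ∈ᵖ f ⇔ᵖ tupleᵒ $ᵒ (η ∷ z ∷ []) ∈ᵖ f′)))
        (f ∷ f′ ∷ ξ ∷ [])
        (λ η oη ih η∈ z →
          let e : below f η ≈ below f′ η
              e = extensional λ w → ∈-below ⨾ ⇿-∃ (λ ζ →
                (λ (ζ∈ , p) → ζ∈ , proj₁ (ih ζ ζ∈ (∈-trans oξ ζ∈ η∈) w) p) ,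
                (λ (ζ∈ , p) → ζ∈ , proj₂ (ih ζ ζ∈ (∈-trans oξ ζ∈ η∈) w) p)) ⨾ ⇿-sym ∈-below
          in a η η∈ z ⨾ ((λ q → ≈-trans q (H-cong ρ e)) , (λ q → ≈-trans q (H-cong ρ (≈-sym e)))) ⨾ ⇿-sym (a′ η η∈ z))

    Value : M → M → Vec M n → Set
    Value y ξ ρ = ∃̃ λ f → Attempt f ξ ρ × y ≈ H⟨ below f ξ ⟩ ρ

    valueᵖ : Predicate (suc (suc n))
    valueᵖ = exᵖ (reindexᵖ (lift suc) (λ σ → head σ ∷ tail (tail σ)) (λ where
        (_ ∷ _ ∷ _) zero    → refl
        (_ ∷ _ ∷ _) (suc i) → refl) attemptᵖ
      ∧ᵖ varᵒ 1F ≈ᵖ H′ ∘ᵒ (belowᵒ $ᵒ (varᵒ 0F ∷ varᵒ 2F ∷ [])))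
      where
      H′ : Operation (suc (suc (suc (suc n))))
      H′ = reindexᵒ (lift (3 ↑ʳ_)) (λ σ → head σ ∷ tail (tail (tail (tail σ)))) (λ where
        (s ∷ _ ∷ _ ∷ _ ∷ ρ) zero    → refl
        (s ∷ _ ∷ _ ∷ _ ∷ ρ) (suc i) → refl) H

    Value⇿ : ∀ {ρ} → Ord ξ → Attempt f ξ ρ → Value y ξ ρ ⇿ y ≈ H⟨ below f ξ ⟩ ρ
    Value⇿ {ρ = ρ} oξ a =
      (λ h → h >>= λ (f′ , a′ , e) → ≈-trans e (H-cong ρ (below-unique oξ a′ a))) ,
      (λ e → some _ (a , e))

    Value-unique : ∀ {ρ} → Ord ξ → Value x ξ ρ → Value y ξ ρ → x ≈ y
    Value-unique oξ h h′ = h >>= λ (f , a , e) → ≈-trans e (≈-sym (proj₁ (Value⇿ oξ a) h′))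

    Value-resp : ∀ {ρ} → x ≈ y → ξ ≈ η → Value x ξ ρ → Value y η ρ
    Value-resp e e′ = holds-resp valueᵖ (e ∷ e′ ∷ Pointwise.refl ≈-refl)

    attempt-value : ∀ {ρ ξ η f} → Ord ξ → Attempt f ξ ρ → η ∈ ξ → ∀ {z} → Value z η ρ ⇿ ⟪ η , z ⟫ ∈ f
    attempt-value oξ a η∈ξ = Value⇿ oη (Attempt-⊆ (λ ζ ζ∈η → ∈-trans oξ ζ∈η η∈ξ) a) ⨾ ⇿-sym (a _ η∈ξ _)
      where
      oη = Ord-∈ oξ η∈ξ

    -- By induction there are attempts for all members of `α`. Replacement collects the values they
    -- give into one relation; uniqueness of values makes it irrelevant which attempts are used.
    attempt : ∀ ρ α → Ord α → ∃̃ λ f → Attempt f α ρ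
    attempt ρ = ordinal-induction (exᵖ attemptᵖ) ρ λ α oα ih →
      replaced P (α ∷ ρ) (functional oα) α >>= λ (f , ∈f) →
      let
        f-value : ∀ {ξ} → ξ ∈ α → ∀ {y} → ⟪ ξ , y ⟫ ∈ f ⇿ Value y ξ ρ
        f-value ξ∈α = 
          (λ p → proj₁ (∈f _) p >>= λ (ξ′ , ξ′∈α , _ , h) → h >>= λ (y′ , e , v) →
            Value-resp (≈-sym (tuple-injectiveʳ e)) (≈-sym (tuple-injectiveˡ e)) v) ,
          (λ v → proj₂ (∈f _) (some _ (ξ∈α , ξ∈α , some _ (≈-refl , v))))
        f-below : ∀ {ξ f′} → ξ ∈ α → Attempt f′ ξ ρ → below f ξ ≈ below f′ ξ
        f-below ξ∈α a = extensional λ z → ∈-below ⨾ ⇿-∃ (λ η →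
          (λ (η∈ξ , p) → η∈ξ , proj₁ (f-value (∈-trans oα η∈ξ ξ∈α) ⨾ attempt-value (Ord-∈ oα ξ∈α) a η∈ξ) p) ,
          (λ (η∈ξ , p) → η∈ξ , proj₂ (f-value (∈-trans oα η∈ξ ξ∈α) ⨾ attempt-value (Ord-∈ oα ξ∈α) a η∈ξ) p)) ⨾ ⇿-sym ∈-below
      in some f λ ξ ξ∈α y → f-value ξ∈α ⨾
        (λ v → v >>= λ (f′ , a , e) → ≈-trans e (H-cong ρ (≈-sym (f-below ξ∈α a)))) ,
        (λ e → ih ξ ξ∈α >>= λ (f′ , a) → some f′ (a , ≈-trans e (H-cong ρ (f-below ξ∈α a))))
      where
      P : Predicate (suc (suc (suc n)))
      -- `replaced` wants functionality at all arguments, while values are unique only at ordinals;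
      -- hence membership in `α` is made part of the predicate.
      P = (varᵒ 0F ∈ᵖ varᵒ 2F) ∧ᵖ exᵖ (varᵒ 2F ≈ᵖ tupleᵒ $ᵒ (varᵒ 1F ∷ varᵒ 0F ∷ []) ∧ᵖ
        reindexᵖ (lift (lift (2 ↑ʳ_))) (λ σ → head σ ∷ head (tail σ) ∷ tail (tail (tail (tail σ)))) (λ where
          (_ ∷ _ ∷ _ ∷ _ ∷ _) zero          → refl
          (_ ∷ _ ∷ _ ∷ _ ∷ _) (suc zero)    → refl
          (_ ∷ _ ∷ _ ∷ _ ∷ _) (suc (suc i)) → refl) valueᵖ)

      functional : ∀ {α ξ u u′} → Ord α → holds P (ξ ∷ u ∷ α ∷ ρ) → holds P (ξ ∷ u′ ∷ α ∷ ρ) → u ≈ u′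
      functional oα (ξ∈α , h) (_ , h′) = h >>= λ (y , e , v) → h′ >>= λ (y′ , e′ , v′) →
        ≈-trans e (≈-trans (tuple-cong ≈-refl (Value-unique (Ord-∈ oα ξ∈α) v v′)) (≈-sym e′))

    -- The value is described through its elements, as `comprehension` requires. Outside the
    -- ordinals it is empty.
    recPredicate : Predicate (suc (suc n))
    recPredicate = ordᵖ $ᵖ (varᵒ 1F ∷ []) ∧ᵖ exᵖ (varᵒ 1F ∈ᵖ varᵒ 0F ∧ᵖ
      reindexᵖ (lift suc) (λ σ → head σ ∷ tail (tail σ)) (λ where
        (_ ∷ _ ∷ _) zero    → refl
        (_ ∷ _ ∷ _) (suc i) → refl) valueᵖ)

    opaque
      recˢ : SetOperation recPredicate
      recˢ = comprehension _ λ { (ξ ∷ ρ) → by-cases (Ord ξ)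
        (λ oξ → attempt ρ ξ oξ >>= λ (f , a) → some (H⟨ below f ξ ⟩ ρ) λ z →
          (λ z∈ → oξ , some _ (z∈ , some f (a , ≈-refl))) ,
          (λ (_ , h) → h >>= λ (y , z∈y , v) → ∈-respʳ (proj₁ (Value⇿ oξ a) v) z∈y))
        (λ ¬o → some ∅ λ z → absurd ∘ ∉∅ , absurd ∘ ¬o ∘ proj₁) }

    recᵒ : Operation (suc n)
    recᵒ = operation recˢ

    rec : M → Vec M n → M
    rec ξ ρ = apply recᵒ (ξ ∷ ρ)

    rec-value : ∀ {ρ} → Ord ξ → Value y ξ ρ → rec ξ ρ ≈ y
    rec-value oξ v = extensional λ z → member recˢ ⨾
      (λ (_ , h) → h >>= λ (y′ , z∈ , v′) → ∈-respʳ (Value-unique oξ v′ v) z∈) ,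
      (λ z∈ → oξ , some _ (z∈ , v))

    rangeᵒ : Operation (suc n)
    rangeᵒ = imageᵒ (reindexᵒ (lift suc) (λ σ → head σ ∷ tail (tail σ)) (λ where
      (_ ∷ _ ∷ _) zero    → refl
      (_ ∷ _ ∷ _) (suc i) → refl) recᵒ) (varᵒ 0F)

    range : M → Vec M n → M
    range ξ ρ = apply rangeᵒ (ξ ∷ ρ)

    ∈-range : ∀ {ρ} → z ∈ range ξ ρ ⇿ (∃̃ λ η → η ∈ ξ × z ≈ rec η ρ)
    ∈-range = ∈-image _ _

    rec-unfold : ∀ {ρ} → Ord ξ → rec ξ ρ ≈ H⟨ range ξ ρ ⟩ ρ
    rec-unfold {ξ} {ρ} oξ = attempt ρ ξ oξ >>= λ (f , a) →
      ≈-trans (rec-value oξ (some f (a , ≈-refl))) (H-cong ρ (extensional λ z →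
        ∈-below ⨾ ⇿-∃ (λ η →
          (λ (η∈ξ , p) → η∈ξ , ≈-sym (rec-value (Ord-∈ oξ η∈ξ) (proj₂ (attempt-value oξ a η∈ξ) p))) ,
          (λ (η∈ξ , e) → η∈ξ , (attempt ρ η (Ord-∈ oξ η∈ξ) >>= λ (f′ , b) →
            proj₁ (attempt-value oξ a η∈ξ) (Value-resp
              (≈-trans (≈-sym (rec-value (Ord-∈ oξ η∈ξ) (some f′ (b , ≈-refl)))) (≈-sym e)) ≈-refl
              (some f′ (b , ≈-refl)))))) ⨾ ⇿-sym ∈-range))

    rec-cong : ∀ {ρ} → ξ ≈ η → rec ξ ρ ≈ rec η ρ
    rec-cong e = apply-cong recᵒ (e ∷ Pointwise.refl ≈-refl)

    Fresh : M → Vec M n → Set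
    Fresh ξ ρ = ¬̃ rec ξ ρ ∈ range ξ ρ

    rec-injective : ∀ {ρ} → Ord ξ → Ord η → Fresh ξ ρ → Fresh η ρ → rec ξ ρ ≈ rec η ρ → ξ ≈ η
    rec-injective oξ oη f f′ e = either (trichotomy oξ oη)
      (λ ξ∈η → absurd (f′ (proj₂ ∈-range (some _ (ξ∈η , ≈-sym e)))))
      (λ c → either c id (λ η∈ξ → absurd (f (proj₂ ∈-range (some _ (η∈ξ , e))))))

    -- Otherwise replacement along the inverse of rec turns X into a set that
    -- contains all ordinals.
    hartogs : ∀ X ρ → (∀ ξ → Ord ξ → rec ξ ρ ∈ X × Fresh ξ ρ) → 𝔽
    hartogs X ρ h =
      replaced (ordᵖ $ᵖ (varᵒ 1F ∷ []) ∧ᵖ varᵒ 0F ≈ᵖ weakenᵒ recᵒ) ρ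
        (λ (oξ , e) (oη , e′) → rec-injective oξ oη (proj₂ (h _ oξ)) (proj₂ (h _ oη)) (≈-trans (≈-sym e) e′)) X
      >>= λ (b , ∈b) → strict-bound b >>= λ (α , oα , bound) →
      ∉-self (bound α (proj₂ (∈b α) (some _ (proj₁ (h α oα) , oα , ≈-refl))) oα)

-- Gödel pairing of ordinals.

module GoedelPairing (𝓜 : Model) (axioms : ∀ {τ} → ZFC τ → Model.⟦_⟧ 𝓜 τ []) where
  open TransfiniteRecursion 𝓜 axioms public

  private variable
    n : ℕ
    x y z S u α β γ δ ε ξ η : M

  record Description (P : Predicate (suc n)) : Set₁ where
    field
      described : Operation n
      satisfied : ∀ {ρ} → holds P (apply described ρ ∷ ρ)
  open Description

  describe : (P : Predicate (suc n)) → (∀ ρ → ∃̃ λ y → holds P (y ∷ ρ)) →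
    (∀ {ρ y z} → holds P (y ∷ ρ) → holds P (z ∷ ρ) → y ≈ z) → Description P
  describe P e u = record
    { described = record
      { graph   = formula P
      ; apply   = witness (formula P)
      ; correct = λ ρ → Predicate.correct P _ ⨾
          (λ p → u p (chosen ρ)) , (λ q → holds-resp P (≈-sym q ∷ Pointwise.refl ≈-refl) (chosen ρ)) }
    ; satisfied = chosen _ }
    where
    chosen : ∀ ρ → holds P (witness (formula P) ρ ∷ ρ)
    chosen ρ = proj₁ (Predicate.correct P _)
      (witness-correct (formula P) (proj₂ (⇿-∃ (λ y → Predicate.correct P (y ∷ ρ))) (e ρ)))

  -- The order `<*`, the union of two ordinals being their maximum.
  Less : M → M → M → M → Set
  Less δ ε β γ = (δ ∪ ε ∈ β ∪ γ) ∨̃ (δ ∪ ε ≈ β ∪ γ × (δ ∈ β ∨̃ (δ ≈ β × ε ∈ γ)))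

  lessᵖ : Predicate 4
  lessᵖ = pred₄ λ δ ε β γ → (∪ᵒ $ᵒ (δ ∷ ε ∷ []) ∈ᵖ ∪ᵒ $ᵒ (β ∷ γ ∷ [])) ∨ᵖ
    (∪ᵒ $ᵒ (δ ∷ ε ∷ []) ≈ᵖ ∪ᵒ $ᵒ (β ∷ γ ∷ []) ∧ᵖ (δ ∈ᵖ β ∨ᵖ (δ ≈ᵖ β ∧ᵖ ε ∈ᵖ γ)))

  Less-linear : Ord δ → Ord ε → Ord β → Ord γ →
    Less δ ε β γ ∨̃ (δ ≈ β × ε ≈ γ) ∨̃ Less β γ δ ε
  Less-linear oδ oε oβ oγ = either (trichotomy (Ord-∪ oδ oε) (Ord-∪ oβ oγ)) (λ p → inl (inl p)) λ c → either c
    (λ e → either (trichotomy oδ oβ) (λ p → inl (inr (e , inl p))) λ c → either c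
      (λ e′ → either (trichotomy oε oγ) (λ p → inl (inr (e , inr (e′ , p)))) λ c → either c
        (λ e″ → inr (inl (e′ , e″)))
        (λ p → inr (inr (inr (≈-sym e , inr (≈-sym e′ , p))))))
      (λ p → inr (inr (inr (≈-sym e , inl p)))))
    (λ p → inr (inr (inl p)))

  NewPair : M → M → M → Set
  NewPair β γ S = ¬̃ ⟪ β , γ ⟫ ∈ S × (∀ δ ε → Ord δ × Ord ε → Less δ ε β γ → ⟪ δ , ε ⟫ ∈ S)

  newPairᵖ : Predicate 2
  newPairᵖ = pred₂ λ y S → ∃ᵖ[ β ] ∃ᵖ[ γ ] (ordᵖ $ᵖ (β ∷ []) ∧ᵖ ordᵖ $ᵖ (γ ∷ [])) ∧ᵖ y ≈ᵖ tupleᵒ $ᵒ (β ∷ γ ∷ []) ∧ᵖ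
    ¬ᵖ (tupleᵒ $ᵒ (β ∷ γ ∷ []) ∈ᵖ S) ∧ᵖ (∀ᵖ[ δ ] ∀ᵖ[ ε ] (ordᵖ $ᵖ (δ ∷ []) ∧ᵖ ordᵖ $ᵖ (ε ∷ [])) ⇒ᵖ
      lessᵖ $ᵖ (δ ∷ ε ∷ β ∷ γ ∷ []) ⇒ᵖ tupleᵒ $ᵒ (δ ∷ ε ∷ []) ∈ᵖ S)

  -- Some pair of ordinals lies outside `S`. Among such pairs the maximum, then the first and then
  -- the second component are minimized in turn.
  newPair : ∀ S → ∃̃ λ β → ∃̃ λ γ → (Ord β × Ord γ) × NewPair β γ S
  newPair S =
    strict-bound (⋃ (⋃ S)) >>= λ (α , oα , bound) →
    -- `α` is above all ordinals in `⋃ (⋃ S)`. If `⟪ α , ∅ ⟫` were in `S`, then `α` would be one of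
    -- them.
    least Q₀ (S ∷ []) (Ord-∪ oα Ord-∅) (some α (some ∅ ((oα , Ord-∅) , ≈-refl , λ p →
      ∉-self (bound α (proj₂ ∈-⋃ (some _
        (proj₂ ∈-⋃ (some _ (p , proj₂ ∈-tuple (inl ≈-refl))) , ∈-singleton-self))) oα))))
    >>= λ (μ , oμ , q₀ , min₀) → q₀ >>= λ (β₀ , q) → q >>= λ (γ₀ , (oβ₀ , oγ₀) , e₀ , ∉₀) →
    least Q₁ (μ ∷ S ∷ []) oβ₀ (some γ₀ (oγ₀ , e₀ , ∉₀))
    >>= λ (β , oβ , q₁ , min₁) → q₁ >>= λ (γ₁ , oγ₁ , e₁ , ∉₁) →
    least Q₂ (β ∷ μ ∷ S ∷ []) oγ₁ (e₁ , ∉₁)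
    >>= λ (γ , oγ , (e , ∉S) , min₂) →
    some β (some γ ((oβ , oγ) , ∉S , λ δ ε (oδ , oε) l → by-contradiction λ ∉ → either l
      (λ p → min₀ _ (∈-respʳ e p) (some δ (some ε ((oδ , oε) , ≈-refl , ∉))))
      (λ (e′ , c) → either c
        (λ δ∈β → min₁ δ δ∈β (some ε (oε , ≈-trans e′ e , ∉)))
        (λ (δ≈β , ε∈γ) → min₂ ε ε∈γ
          (≈-trans (∪-cong (≈-sym δ≈β) ≈-refl) (≈-trans e′ e) ,
           λ p → ∉ (∈-respˡ (tuple-cong (≈-sym δ≈β) ≈-refl) p))))))
    where
    Q₀ : Predicate 2
    Q₀ = pred₂ λ μ S → ∃ᵖ[ β ] ∃ᵖ[ γ ] (ordᵖ $ᵖ (β ∷ []) ∧ᵖ ordᵖ $ᵖ (γ ∷ [])) ∧ᵖ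
      ∪ᵒ $ᵒ (β ∷ γ ∷ []) ≈ᵖ μ ∧ᵖ ¬ᵖ (tupleᵒ $ᵒ (β ∷ γ ∷ []) ∈ᵖ S)
    Q₁ : Predicate 3
    Q₁ = pred₃ λ β μ S → ∃ᵖ[ γ ] ordᵖ $ᵖ (γ ∷ []) ∧ᵖ
      ∪ᵒ $ᵒ (β ∷ γ ∷ []) ≈ᵖ μ ∧ᵖ ¬ᵖ (tupleᵒ $ᵒ (β ∷ γ ∷ []) ∈ᵖ S)
    Q₂ : Predicate 4
    Q₂ = pred₄ λ γ β μ S → ∪ᵒ $ᵒ (β ∷ γ ∷ []) ≈ᵖ μ ∧ᵖ ¬ᵖ (tupleᵒ $ᵒ (β ∷ γ ∷ []) ∈ᵖ S)

  newPair-unique : Ord β × Ord γ → Ord δ × Ord ε → NewPair β γ S → NewPair δ ε S → ⟪ β , γ ⟫ ≈ ⟪ δ , ε ⟫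
  newPair-unique (oβ , oγ) (oδ , oε) (∉ , h) (∉′ , h′) = either (Less-linear oβ oγ oδ oε)
    (λ l → absurd (∉ (h′ _ _ (oβ , oγ) l))) λ c → either c
    (λ (e , e′) → tuple-cong e e′)
    (λ l → absurd (∉′ (h _ _ (oδ , oε) l)))

  opaque
    newPairᵈ : Description newPairᵖ
    newPairᵈ = describe newPairᵖ
      (λ { (S ∷ []) → newPair S >>= λ (β , h) → h >>= λ (γ , o , n) →
        some ⟪ β , γ ⟫ (some β (some γ (o , ≈-refl , n))) })
      (λ { {S ∷ []} h h′ → h >>= λ (β , h) → h >>= λ (γ , o , e , n) →
        h′ >>= λ (δ , h′) → h′ >>= λ (ε , o′ , e′ , n′) →
        ≈-trans e (≈-trans (newPair-unique o o′ n n′) (≈-sym e′)) })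

  module Enumerate = Recursion (described newPairᵈ)

  enum enumerated : M → M
  enum ξ = Enumerate.rec ξ []
  enumerated ξ = Enumerate.range ξ []

  enum-new : Ord ξ → ∃̃ λ β → ∃̃ λ γ → (Ord β × Ord γ) × enum ξ ≈ ⟪ β , γ ⟫ × NewPair β γ (enumerated ξ)
  enum-new oξ = holds-resp newPairᵖ (≈-sym (Enumerate.rec-unfold oξ) ∷ ≈-refl ∷ []) (satisfied newPairᵈ)

  enum-fresh : Ord ξ → Enumerate.Fresh ξ []
  enum-fresh oξ p = enum-new oξ >>= λ (β , h) → h >>= λ (γ , _ , e , ∉ , _) → ∉ (∈-respˡ e p)

  enum-injective : Ord ξ → Ord η → enum ξ ≈ enum η → ξ ≈ η
  enum-injective oξ oη = Enumerate.rec-injective oξ oη (enum-fresh oξ) (enum-fresh oη)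

  squareᵒ : Operation 1
  squareᵒ = ⋃ᵒ $ᵒ (imageᵒ (imageᵒ (tupleᵒ $ᵒ (varᵒ 1F ∷ varᵒ 0F ∷ [])) (varᵒ 1F)) (varᵒ 0F) ∷ [])

  ∈-square : ∀ {A} → x ∈ A → y ∈ A → ⟪ x , y ⟫ ∈ apply squareᵒ (A ∷ [])
  ∈-square x∈ y∈ = proj₂ ∈-⋃ (some _ (proj₂ (∈-image _ _) (some _ (x∈ , ≈-refl)) ,
    proj₂ (∈-image _ _) (some _ (y∈ , ≈-refl))))

  -- If the pair never occurred, only smaller pairs could ever be enumerated. Their components are
  -- at most `β ∪ γ`, so all values would lie in one set, against `hartogs`.
  enum-surjective : Ord β → Ord γ → ∃̃ λ ξ → Ord ξ × enum ξ ≈ ⟪ β , γ ⟫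
  enum-surjective {β} {γ} oβ oγ none = Enumerate.hartogs (apply squareᵒ (succ (β ∪ γ) ∷ [])) [] λ ξ oξ →
    (enum-new oξ >>= λ (δ , h) → h >>= λ (ε , (oδ , oε) , e , ∉ , h) →
      let small : δ ∪ ε ⊆ β ∪ γ
          small = either (Less-linear oδ oε oβ oγ)
            (λ l → either l (∈∨≈⇒⊆ (Ord-∪ oβ oγ) ∘ inl) (∈∨≈⇒⊆ (Ord-∪ oβ oγ) ∘ inr ∘ proj₁))
            λ c → either c
              (λ (e′ , e″) → absurd (none ξ (oξ , ≈-trans e (tuple-cong e′ e″))))
              (λ l → absurd (proj₁ Enumerate.∈-range (h β γ (oβ , oγ) l) λ η (η∈ , e′) →
                none η (Ord-∈ oξ η∈ , ≈-sym e′)))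
      in ∈-respˡ (≈-sym e) (∈-square
        (proj₂ ∈-succ (⊆⇒∈∨≈ oδ (Ord-∪ oβ oγ) (λ z p → small z (∪-introˡ p))))
        (proj₂ ∈-succ (⊆⇒∈∨≈ oε (Ord-∪ oβ oγ) (λ z p → small z (∪-introʳ p)))))) ,
    enum-fresh oξ

  -- The inverse of `enum`, with value `∅` unless both arguments are ordinals: SOR requires `G` to
  -- be defined, with ordinal values, on all objects.
  indexᵖ : Predicate 3
  indexᵖ = pred₃ λ α β γ →
    ((ordᵖ $ᵖ (β ∷ []) ∧ᵖ ordᵖ $ᵖ (γ ∷ [])) ⇒ᵖ
      (ordᵖ $ᵖ (α ∷ []) ∧ᵖ Enumerate.recᵒ $ᵒ (α ∷ []) ≈ᵖ tupleᵒ $ᵒ (β ∷ γ ∷ []))) ∧ᵖ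
    (¬ᵖ (ordᵖ $ᵖ (β ∷ []) ∧ᵖ ordᵖ $ᵖ (γ ∷ [])) ⇒ᵖ α ≈ᵖ ∅ᵒ $ᵒ [])

  opaque
    indexᵈ : Description indexᵖ
    indexᵈ = describe indexᵖ
      (λ { (β ∷ γ ∷ []) → by-cases (Ord β × Ord γ)
        (λ (oβ , oγ) → enum-surjective oβ oγ >>= λ (ξ , h) → some ξ ((λ _ → h) , λ ¬o → absurd (¬o (oβ , oγ))))
        (λ ¬o → some ∅ (absurd ∘ ¬o , λ _ → ≈-refl)) })
      (λ { {β ∷ γ ∷ []} (h , f) (h′ , f′) → by-cases (Ord β × Ord γ)
        (λ o → let oα , e = h o ; oα′ , e′ = h′ o in enum-injective oα oα′ (≈-trans e (≈-sym e′)))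
        (λ ¬o → ≈-trans (f ¬o) (≈-sym (f′ ¬o))) })

  Gᵒ : Operation 2
  Gᵒ = described indexᵈ

  G : M → M → M
  G x y = apply Gᵒ (x ∷ y ∷ [])

  G-Ord : Ord (G x y)
  G-Ord {x} {y} = by-cases (Ord x × Ord y)
    (λ o → proj₁ (proj₁ (satisfied indexᵈ) o))
    (λ ¬o → Ord-resp (≈-sym (proj₂ (satisfied indexᵈ) ¬o)) Ord-∅)

  enum-G : Ord β → Ord γ → enum (G β γ) ≈ ⟪ β , γ ⟫
  enum-G oβ oγ = proj₂ (proj₁ (satisfied indexᵈ) (oβ , oγ))

  G-unique : Ord α → Ord β → Ord γ → enum α ≈ ⟪ β , γ ⟫ → α ≈ G β γ
  G-unique oα oβ oγ e = enum-injective oα G-Ord (≈-trans e (≈-sym (enum-G oβ oγ)))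

  G-injective : Ord β → Ord γ → Ord δ → Ord ε → G β γ ≈ G δ ε → β ≈ δ × γ ≈ ε
  G-injective oβ oγ oδ oε e = tuple-injectiveˡ e′ , tuple-injectiveʳ e′
    where e′ = ≈-trans (≈-sym (enum-G oβ oγ)) (≈-trans (Enumerate.rec-cong e) (enum-G oδ oε))

  G-surjective : Ord α → ∃̃ λ β → ∃̃ λ γ → (Ord β × Ord γ) × α ≈ G β γ
  G-surjective oα = enum-new oα >>= λ (β , h) → h >>= λ (γ , (oβ , oγ) , e , _) →
    some β (some γ ((oβ , oγ) , G-unique oα oβ oγ e))

  -- The pair with index `G β γ` was new at that point, so every smaller pair had been enumerated
  -- before, that is, at a member of `G β γ`.
  G-monotone : Ord δ → Ord ε → Ord β → Ord γ → Less δ ε β γ → G δ ε ∈ G β γ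
  G-monotone {δ} {ε} {β} {γ} oδ oε oβ oγ l =
    enum-new (G-Ord {β} {γ}) >>= λ (β′ , h) → h >>= λ (γ′ , _ , e , _ , h) →
    let e′ = ≈-trans (≈-sym (enum-G oβ oγ)) e
        l′ = holds-resp lessᵖ (≈-refl ∷ ≈-refl ∷ tuple-injectiveˡ e′ ∷ tuple-injectiveʳ e′ ∷ []) l
    in proj₁ Enumerate.∈-range (h δ ε (oδ , oε) l′) >>= λ (η , η∈ , e″) →
    ∈-respˡ (G-unique (Ord-∈ G-Ord η∈) oδ oε (≈-sym e″)) η∈

  -- Together with `G-monotone` this makes `G β γ` the set of the indices of all smaller pairs,
  -- which is the content of GPF.
  G-initial : Ord β → Ord γ → α ∈ G β γ → ∃̃ λ δ → ∃̃ λ ε → (Ord δ × Ord ε) × Less δ ε β γ × α ≈ G δ ε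
  G-initial {β} {γ} {α} oβ oγ α∈ = G-surjective (Ord-∈ G-Ord α∈) >>= λ (δ , h) → h >>= λ (ε , (oδ , oε) , e) →
    some δ (some ε ((oδ , oε) , either (Less-linear oδ oε oβ oγ) id (λ c → either c
      (λ (e′ , e″) → absurd (∉-self (∈-respˡ (≈-trans e (apply-cong Gᵒ (e′ ∷ e″ ∷ []))) α∈)))
      (λ l → absurd (∈-asym G-Ord (∈-respˡ e α∈) (G-monotone oβ oγ oδ oε l)))) , e))

-- The well-ordering theorem.

module WellOrderingTheorem (𝓜 : Model) (axioms : ∀ {τ} → ZFC τ → Model.⟦_⟧ 𝓜 τ []) where
  open GoedelPairing 𝓜 axioms public

  private variable
    x y z c s t X : M

  -- The choice axiom needs disjoint sets, so each set s is replaced by { s } × s.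
  copyᵒ : Operation 1
  copyᵒ = imageᵒ (tupleᵒ $ᵒ (varᵒ 1F ∷ varᵒ 0F ∷ [])) (varᵒ 0F)

  copy : M → M
  copy s = apply copyᵒ (s ∷ [])

  ∈-copy : z ∈ copy s ⇿ (∃̃ λ x → x ∈ s × z ≈ ⟪ s , x ⟫)
  ∈-copy = ∈-image _ _

  pickedᵖ : Predicate 3
  pickedᵖ = pred₃ λ x s c → tupleᵒ $ᵒ (s ∷ x ∷ []) ∈ᵖ c

  -- If `c` selects exactly one element of `s`, this is the union of its singleton, hence that
  -- element; the operation is total without a case distinction.
  pickᵒ : Operation 2
  pickᵒ = ⋃ᵒ $ᵒ (sepᵒ pickedᵖ (varᵒ 0F) ∷ [])

  pick : M → M → M
  pick s c = apply pickᵒ (s ∷ c ∷ [])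

  choice-function : ∀ X → ∃̃ λ c → ∀ {s} → s ⊆ X → ∃̃ (_∈ s) → pick s c ∈ s
  choice-function X = axioms ZFC-axioms.choice copies
      ((λ x x∈ → from-copies x∈ >>= λ (s , (_ , ne) , e) → ne >>= λ (z , z∈s) →
         some ⟪ s , z ⟫ (∈-respʳ (≈-sym e) (proj₂ ∈-copy (some z (z∈s , ≈-refl))))) ,
       (λ x y (x∈ , y∈ , h) → h >>= λ (z , z∈x , z∈y) →
         from-copies x∈ >>= λ (s , _ , e) → from-copies y∈ >>= λ (t , _ , e′) →
         proj₁ ∈-copy (∈-respʳ e z∈x) >>= λ (_ , _ , q) → proj₁ ∈-copy (∈-respʳ e′ z∈y) >>= λ (_ , _ , q′) →
         ≈-trans e (≈-trans (apply-cong copyᵒ (tuple-injectiveˡ (≈-trans (≈-sym q) q′) ∷ [])) (≈-sym e′))))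
    >>= λ (c , h) → some c λ {s} s⊆X ne →
      h (copy s) (proj₂ (∈-image _ _) (some s (proj₂ (∈-sep _ _) (proj₂ ∈-𝒫 s⊆X , ne) , ≈-refl)))
      >>= λ (u , (u∈ , u∈c) , unique) → proj₁ ∈-copy u∈ >>= λ (x , x∈s , e) →
      let pick≈x : pick s c ≈ x
          pick≈x = extensional λ z →
            (λ z∈ → proj₁ ∈-⋃ z∈ >>= λ (y , y∈ , z∈y) →
              let y∈s , q = proj₁ (∈-sep pickedᵖ (varᵒ 0F)) y∈
              in ∈-respʳ (tuple-injectiveʳ (≈-trans (unique _ (proj₂ ∈-copy (some y (y∈s , ≈-refl)) , q)) e)) z∈y) ,
            (λ z∈x → proj₂ ∈-⋃ (some x (proj₂ (∈-sep pickedᵖ (varᵒ 0F)) (x∈s , ∈-respˡ e u∈c) , z∈x)))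
      in ∈-respˡ (≈-sym pick≈x) x∈s
    where
    nonemptyᵖ : Predicate 2
    nonemptyᵖ = exᵖ (varᵒ 0F ∈ᵖ varᵒ 1F)

    copies : M
    copies = apply (imageᵒ (copyᵒ $ᵒ (varᵒ 0F ∷ [])) (sepᵒ nonemptyᵖ 𝒫ᵒ)) (X ∷ [])

    from-copies : x ∈ copies → ∃̃ λ s → (s ⊆ X × ∃̃ (_∈ s)) × x ≈ copy s
    from-copies x∈ = proj₁ (∈-image _ _) x∈ >>= λ (s , s∈ , e) →
      let s∈𝒫 , ne = proj₁ (∈-sep nonemptyᵖ 𝒫ᵒ) s∈ in some s ((proj₁ ∈-𝒫 s∈𝒫 , ne) , e)

  differenceᵒ : Operation 2
  differenceᵒ = sepᵒ (¬ᵖ (varᵒ 0F ∈ᵖ varᵒ 2F)) (varᵒ 0F)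

  _∖_ : M → M → M
  x ∖ y = apply differenceᵒ (x ∷ y ∷ [])

  ∈-∖ : z ∈ x ∖ y ⇿ (z ∈ x × ¬̃ z ∈ y)
  ∈-∖ = ∈-sep _ _

  -- Zermelo's recursion: with parameters `X` and `c`, the next value is the element chosen from
  -- what remains of `X`.
  module WellOrder = Recursion {2} (pickᵒ $ᵒ (differenceᵒ $ᵒ (varᵒ 1F ∷ varᵒ 0F ∷ []) ∷ varᵒ 2F ∷ []))

  record WellOrdering (X κ : M) (F : M → M) : Set where
    field
      length-Ord : Ord κ
      into : ∀ {ξ} → ξ ∈ κ → F ξ ∈ X
      onto : ∀ {x} → x ∈ X → ∃̃ λ ξ → ξ ∈ κ × x ≈ F ξ
      injective : ∀ {ξ η} → ξ ∈ κ → η ∈ κ → F ξ ≈ F η → ξ ≈ η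

  -- As long as something of `X` remains, the next value is a new element of `X`; by `hartogs` this
  -- cannot go on through all ordinals. The length `κ` is the least stage at which `X` is exhausted,
  -- so no value is repeated before it.
  well-ordering : ∀ X → ∃̃ λ c → ∃̃ λ κ → WellOrdering X κ (λ ξ → WellOrder.rec ξ (X ∷ c ∷ []))
  well-ordering X = choice-function X >>= λ (c , choose) →
    let
      ρ = X ∷ c ∷ []
      next : ∀ {ξ} → Ord ξ → ¬̃ (X ⊆ WellOrder.range ξ ρ) →
        WellOrder.rec ξ ρ ∈ X ∖ WellOrder.range ξ ρ
      next oξ ⊈ = ∈-respˡ (≈-sym (WellOrder.rec-unfold oξ)) (choose (λ z z∈ → proj₁ (proj₁ ∈-∖ z∈))
        (λ none → ⊈ (λ z z∈X → by-contradiction (λ ∉ → none z (proj₂ ∈-∖ (z∈X , ∉))))))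
      exhausted : ∃̃ λ ξ → Ord ξ × X ⊆ WellOrder.range ξ ρ
      exhausted = λ none → WellOrder.hartogs X ρ λ ξ oξ → proj₁ ∈-∖ (next oξ (λ s → none ξ (oξ , s)))
    in exhausted >>= λ (ξ , oξ , s) →
    least (pred₃ λ κ X c → ∀ᵖ[ z ] z ∈ᵖ X ⇒ᵖ z ∈ᵖ WellOrder.rangeᵒ $ᵒ (κ ∷ X ∷ c ∷ [])) ρ oξ s >>= λ (κ , oκ , cover , min) →
    some c (some κ record
      { length-Ord = oκ
      ; into = λ ξ∈ → proj₁ (proj₁ ∈-∖ (next (Ord-∈ oκ ξ∈) (min _ ξ∈)))
      ; onto = λ x∈ → proj₁ WellOrder.∈-range (cover _ x∈)
      ; injective = λ ξ∈ η∈ → WellOrder.rec-injective (Ord-∈ oκ ξ∈) (Ord-∈ oκ η∈)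
          (proj₂ (proj₁ ∈-∖ (next (Ord-∈ oκ ξ∈) (min _ ξ∈))))
          (proj₂ (proj₁ ∈-∖ (next (Ord-∈ oκ η∈) (min _ η∈)))) })

-- The structure of ordinals and sets of ordinals.

module OrdinalModel (𝓜 : Model) (axioms : ∀ {τ} → ZFC τ → Model.⟦_⟧ 𝓜 τ []) where
  open WellOrderingTheorem 𝓜 axioms public

  private variable
    n : ℕ
    x y z a b s α β γ δ ε μ ν : M

  -- Ordinals represent themselves, and a set that is not an ordinal represents
  -- the set of its ordinal elements.
  Lt Mem Eq : M → M → Set
  Lt x y  = Ord x × Ord y × x ∈ y
  Mem x y = Ord x × (¬̃ Ord y) × x ∈ y
  Eq x y  = (Ord x × Ord y × x ≈ y) ∨̃
    ((¬̃ Ord x) × (¬̃ Ord y) × (∀ α → Ord α → α ∈ x ⇿ α ∈ y))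

  sordᵖ : Predicate 1
  sordᵖ = ¬ᵖ ordᵖ

  ltᵖ memᵖ eqᵖ : Predicate 2
  ltᵖ  = pred₂ λ x y → ordᵖ $ᵖ (x ∷ []) ∧ᵖ ordᵖ $ᵖ (y ∷ []) ∧ᵖ x ∈ᵖ y
  memᵖ = pred₂ λ x y → ordᵖ $ᵖ (x ∷ []) ∧ᵖ ¬ᵖ (ordᵖ $ᵖ (y ∷ [])) ∧ᵖ x ∈ᵖ y
  eqᵖ  = pred₂ λ x y → (ordᵖ $ᵖ (x ∷ []) ∧ᵖ ordᵖ $ᵖ (y ∷ []) ∧ᵖ x ≈ᵖ y) ∨ᵖ
    (¬ᵖ (ordᵖ $ᵖ (x ∷ [])) ∧ᵖ ¬ᵖ (ordᵖ $ᵖ (y ∷ [])) ∧ᵖ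
      (∀ᵖ[ α ] ordᵖ $ᵖ (α ∷ []) ⇒ᵖ (α ∈ᵖ x ⇔ᵖ α ∈ᵖ y)))

  Eq-ord : Ord x → x ≈ y → Eq x y
  Eq-ord o e = inl (o , Ord-resp e o , e)

  Eq⇒≈ : Ord x → Eq x y → x ≈ y
  Eq⇒≈ o h = either h (proj₂ ∘ proj₂) (λ (¬o , _) → absurd (¬o o))

  Eq-refl : Eq x x
  Eq-refl {x} = by-cases (Ord x) (λ o → Eq-ord o ≈-refl) (λ ¬o → inr (¬o , ¬o , λ _ _ → ⇿-refl))

  ≈⇒Eq : x ≈ y → Eq x y
  ≈⇒Eq e = holds-resp eqᵖ (≈-refl ∷ e ∷ []) Eq-refl

  Eq-sym : Eq x y → Eq y x
  Eq-sym h = either h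
    (λ (o , o′ , e) → inl (o′ , o , ≈-sym e))
    (λ (¬o , ¬o′ , f) → inr (¬o′ , ¬o , λ α o → ⇿-sym (f α o)))

  Eq-trans : Eq x y → Eq y z → Eq x z
  Eq-trans h h′ = either h
    (λ (o , o′ , e) → Eq-ord o (≈-trans e (Eq⇒≈ o′ h′)))
    (λ (¬o , ¬o′ , f) → either h′ (λ (o , _) → absurd (¬o′ o))
      (λ (_ , ¬o″ , f′) → inr (¬o , ¬o″ , λ α o → f α o ⨾ f′ α o)))

  Ord-Eq : Eq x y → Ord x → Ord y
  Ord-Eq h o = Ord-resp (Eq⇒≈ o h) o

  ¬Ord-Eq : Eq x y → ¬̃ Ord x → ¬̃ Ord y
  ¬Ord-Eq h ¬o o = ¬o (Ord-Eq (Eq-sym h) o)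

  Lt-Eq : ∀ {x′ y′} → Eq x x′ → Eq y y′ → Lt x y → Lt x′ y′
  Lt-Eq h h′ (o , o′ , p) = Ord-Eq h o , Ord-Eq h′ o′ , ∈-respˡ (Eq⇒≈ o h) (∈-respʳ (Eq⇒≈ o′ h′) p)

  Mem-Eq : ∀ {x′ y′} → Eq x x′ → Eq y y′ → Mem x y → Mem x′ y′
  Mem-Eq h h′ (o , ¬o , p) = Ord-Eq h o , ¬Ord-Eq h′ ¬o ,
    ∈-respˡ (Eq⇒≈ o h) (either h′ (λ (o′ , _) → absurd (¬o o′)) (λ (_ , _ , f) → proj₁ (f _ o) p))

  -- `Eq` is coarser than `≈` away from the ordinals. There `G` is constantly `∅`, so it cannot tell
  -- the identified sets apart.
  G-Eq : ∀ {x′ y′} → Eq x x′ → Eq y y′ → Eq (G x y) (G x′ y′)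
  G-Eq {x} {y} {x′} {y′} h h′ = by-cases (Ord x × Ord y)
    (λ (o , o′) → ≈⇒Eq (apply-cong Gᵒ (Eq⇒≈ o h ∷ Eq⇒≈ o′ h′ ∷ [])))
    (λ ¬o → ≈⇒Eq (≈-trans (G-default ¬o)
      (≈-sym (G-default λ (o , o′) → ¬o (Ord-Eq (Eq-sym h) o , Ord-Eq (Eq-sym h′) o′)))))
    where
    G-default : ∀ {x y} → ¬̃ (Ord x × Ord y) → G x y ≈ ∅
    G-default = proj₂ (Description.satisfied indexᵈ)

  -- Added to a set of ordinals, the marker keeps it from being an ordinal.
  marker : M
  marker = singleton (singleton ∅)

  ¬Ord-marker : ¬̃ Ord marker
  ¬Ord-marker (t , _) = ∉∅ (∈-respʳ (≈-sym ∅≈) ∈-singleton-self)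
    where
    ∅≈ : ∅ ≈ singleton ∅
    ∅≈ = proj₁ ∈-singleton (t (singleton ∅) ∈-singleton-self ∅ ∈-singleton-self)

  set-of-ordinals : ∀ s → ∃̃ λ a → (¬̃ Ord a) × (∀ {α} → Ord α → α ∈ a ⇿ α ∈ s)
  set-of-ordinals s = some (s ∪ singleton marker)
    ((λ o → ¬Ord-marker (Ord-∈ o (∪-introʳ ∈-singleton-self))) , λ {α} oα →
      (λ α∈ → either (proj₁ ∈-∪ α∈) id (λ α∈ → absurd (¬Ord-marker (Ord-resp (proj₁ ∈-singleton α∈) oα)))) ,
      ∪-introˡ)

  SOfunction : ∀ {k} → FunSO k → Vec M k → M
  SOfunction FunSO.g (x ∷ y ∷ []) = G x y

  SOrelation : ∀ {k} → RelSO k → Vec M k → Set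
  SOrelation RelSO.ord (x ∷ [])     = Ord x
  SOrelation RelSO.sord (x ∷ [])    = ¬̃ Ord x
  SOrelation RelSO.lt (x ∷ y ∷ [])  = Lt x y
  SOrelation RelSO.mem (x ∷ y ∷ []) = Mem x y

  private module S = Tarski LSO M 𝔽 SOfunction SOrelation Eq

  -- The inductive set may contain more than ordinals, but its ordinals are still closed under
  -- successor. Each of them thus belongs to another one, so their union has no largest element.
  limit : ∃̃ λ α → Ord α × ∃̃ (_∈ α) × (∀ β → β ∈ α → ∃̃ λ γ → β ∈ γ × γ ∈ α)
  limit = axioms ZFC-axioms.infinity >>= λ (i , e , step) → e >>= λ (o , o∈i , empty) →
    let
      D = apply (sepᵒ ordᵖ′ (varᵒ 0F)) (i ∷ [])
      ∈D : ∀ {x} → x ∈ D ⇿ (x ∈ i × Ord x)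
      ∈D = ∈-sep ordᵖ′ (varᵒ 0F)
      above : ∀ {x} → x ∈ D → x ∈ ⋃ D
      above {x} x∈ = let x∈i , ox = proj₁ ∈D x∈ in step x x∈i >>= λ (s , s∈i , h) →
        proj₂ ∈-⋃ (some s (proj₂ ∈D (s∈i , Ord-resp (extensional λ z → ∈-succ ⨾ ⇿-sym (h z)) (Ord-succ ox)) ,
          proj₂ (h x) (inr ≈-refl)))
    in some (⋃ D)
      ( Ord-⋃ (λ y y∈ → proj₂ (proj₁ ∈D y∈))
      , some o (above (proj₂ ∈D (o∈i , (λ y y∈ → absurd (empty y y∈)) , (λ y y∈ → absurd (empty y y∈)))))
      , λ β β∈ → proj₁ ∈-⋃ β∈ >>= λ (γ , γ∈ , β∈γ) → some γ (β∈γ , above γ∈))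
    where
    ordᵖ′ = ordᵖ $ᵖ (varᵒ 0F ∷ [])

  Max : M → M → M → Set
  Max μ α β = (Eq μ α × (Lt β α ∨̃ Eq β α)) ∨̃ (Eq μ β × (Lt α β ∨̃ Eq α β))

  Max⇿∪ : Ord μ → Ord α → Ord β → Max μ α β ⇿ μ ≈ α ∪ β
  Max⇿∪ {μ} {α} {β} oμ oα oβ =
    (λ h → either h
      (λ (e , le) → ≈-trans (Eq⇒≈ oμ e) (≈-trans (≈-sym (∪-absorbˡ (other⊆ oα oβ le))) ∪-comm))
      (λ (e , le) → ≈-trans (Eq⇒≈ oμ e) (≈-sym (∪-absorbˡ (other⊆ oβ oα le))))) ,
    (λ e → either (trichotomy oα oβ)
      (λ p → larger e (inl p)) λ c → either c
      (λ q → larger e (inr q))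
      (λ p → inl (Eq-ord oμ (≈-trans e (≈-trans ∪-comm (∪-absorbˡ (∈∨≈⇒⊆ oα (inl p))))) , inl (oβ , oα , p))))
    where
    other⊆ : ∀ {α β} → Ord α → Ord β → Lt β α ∨̃ Eq β α → β ⊆ α
    other⊆ oα oβ le = ∈∨≈⇒⊆ oα (either le (λ (_ , _ , p) → inl p) (λ q → inr (Eq⇒≈ oβ q)))

    larger : μ ≈ α ∪ β → α ∈ β ∨̃ α ≈ β → Max μ α β
    larger e le = inr (Eq-ord oμ (≈-trans e (∪-absorbˡ (∈∨≈⇒⊆ oβ le))) ,
      either le (λ p → inl (oα , oβ , p)) (λ q → inr (Eq-ord oα q)))

  -- Spelled so as to be definitionally the Tarski meaning of the formula for `<*` among the axioms
  -- of SO.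
  Less* : M → M → M → M → Set
  Less* δ ε β γ = ∃̃ λ μ → Ord μ × (∃̃ λ ν → Ord ν × Max μ δ ε × Max ν β γ ×
    (Lt μ ν ∨̃ ((Eq μ ν × Lt δ β) ∨̃ (Eq μ ν × Eq δ β × Lt ε γ))))

  Less*⇿Less : Ord δ → Ord ε → Ord β → Ord γ → Less* δ ε β γ ⇿ Less δ ε β γ
  Less*⇿Less {δ} {ε} {β} {γ} oδ oε oβ oγ =
    (λ h → h >>= λ (μ , oμ , h) → h >>= λ (ν , oν , m , m′ , h) →
      let e = proj₁ (Max⇿∪ oμ oδ oε) m
          e′ = proj₁ (Max⇿∪ oν oβ oγ) m′
          same : Eq μ ν → δ ∪ ε ≈ β ∪ γ
          same q = ≈-trans (≈-sym e) (≈-trans (Eq⇒≈ oμ q) e′)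
      in either h (λ (_ , _ , p) → inl (∈-respˡ e (∈-respʳ e′ p))) λ c → either c
        (λ (q , _ , _ , p) → inr (same q , inl p))
        (λ (q , r , _ , _ , p) → inr (same q , inr (Eq⇒≈ oδ r , p)))) ,
    (λ h → some (δ ∪ ε) (o₁ , some (β ∪ γ) (o₂ ,
      proj₂ (Max⇿∪ o₁ oδ oε) ≈-refl , proj₂ (Max⇿∪ o₂ oβ oγ) ≈-refl ,
      either h (λ p → inl (o₁ , o₂ , p)) λ (e , c) → either c
        (λ p → inr (inl (Eq-ord o₁ e , oδ , oβ , p)))
        (λ (q , p) → inr (inr (Eq-ord o₁ e , Eq-ord oδ q , oε , oγ , p))))))
    where
    o₁ = Ord-∪ oδ oε
    o₂ = Ord-∪ oβ oγ

  -- For `ξ ∈ κ` the section of `b` at `ξ` is `F ξ`, because `G` is injective; for other ordinals it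
  -- is empty. Hence the code of a nonempty `z` is unique.
  power-code : ∀ a → ∃̃ λ b → (¬̃ Ord b) × (∀ z → ∃̃ (λ α → Ord α × α ∈ z) →
    (∀ α → Ord α → α ∈ z → α ∈ a) →
    ∃̃ λ ξ → (Ord ξ × (∀ β → Ord β → β ∈ z ⇿ G β ξ ∈ b)) ×
      (∀ ξ′ → Ord ξ′ → (∀ β → Ord β → β ∈ z ⇿ G β ξ′ ∈ b) → ξ′ ≈ ξ))
  power-code a = well-ordering X >>= λ (c , h) → h >>= λ (κ , w) → let open WellOrdering w in
    set-of-ordinals (codes c κ) >>= λ (b , ¬ob , ∈b) →
    some b (¬ob , λ z ne z⊆a →
      let
        F = λ ξ → WellOrder.rec ξ (X ∷ c ∷ [])
        z′ = ordinals z
        oκ = length-Ord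
        F-ordinals : ∀ {ξ β} → ξ ∈ κ → β ∈ F ξ → Ord β
        F-ordinals ξ∈ β∈ = proj₂ (proj₁ ∈-ordinals (proj₁ ∈-𝒫 (proj₁ (proj₁ (∈-sep _ _) (into ξ∈))) _ β∈))
        ∈codes : ∀ {α} → α ∈ codes c κ ⇿ (∃̃ λ ξ → ξ ∈ κ × ∃̃ λ β → β ∈ F ξ × α ≈ G β ξ)
        ∈codes = ∈-⋃ ⨾
          (λ h → h >>= λ (u , u∈ , α∈u) → proj₁ (∈-image _ _) u∈ >>= λ (ξ , ξ∈ , e) →
            some ξ (ξ∈ , proj₁ (∈-image _ _) (∈-respʳ e α∈u))) ,
          (λ h → h >>= λ (ξ , ξ∈ , h) → some _ (proj₂ (∈-image _ _) (some ξ (ξ∈ , ≈-refl)) , proj₂ (∈-image _ _) h))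
        section : ∀ {ξ β} → ξ ∈ κ → Ord β → β ∈ F ξ ⇿ G β ξ ∈ b
        section ξ∈ oβ =
          (λ β∈ → proj₂ (∈b G-Ord) (proj₂ ∈codes (some _ (ξ∈ , some _ (β∈ , ≈-refl))))) ,
          (λ G∈ → proj₁ ∈codes (proj₁ (∈b G-Ord) G∈) >>= λ (ξ′ , ξ′∈ , h) → h >>= λ (β′ , β′∈ , e) →
            let e₁ , e₂ = G-injective oβ (Ord-∈ oκ ξ∈) (F-ordinals ξ′∈ β′∈) (Ord-∈ oκ ξ′∈) e
            in ∈-respˡ (≈-sym e₁) (∈-respʳ (WellOrder.rec-cong (≈-sym e₂)) β′∈))
        z′∈X : z′ ∈ X
        z′∈X = proj₂ (∈-sep _ _)
          ( proj₂ ∈-𝒫 (λ β β∈ → let β∈z , oβ = proj₁ ∈-ordinals β∈ in proj₂ ∈-ordinals (z⊆a β oβ β∈z , oβ))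
          , (ne >>= λ (α , oα , α∈z) → some α (proj₂ ∈-ordinals (α∈z , oα))) )
      in onto z′∈X >>= λ (ξ , ξ∈ , e) →
      let
        z⇿ : ∀ {β} → Ord β → β ∈ z ⇿ β ∈ F ξ
        z⇿ oβ = (λ p → ∈-respʳ e (proj₂ ∈-ordinals (p , oβ))) , (λ p → proj₁ (proj₁ ∈-ordinals (∈-respʳ (≈-sym e) p)))
      in some ξ ((Ord-∈ oκ ξ∈ , λ β oβ → z⇿ oβ ⨾ section ξ∈ oβ) , λ ξ′ oξ′ h →
        -- An element of `z` puts some `G α ξ′` into `b`, which forces `ξ′ ∈ κ`; injectivity of the
        -- enumeration then applies.
        ne >>= λ (α , oα , α∈z) →
        proj₁ ∈codes (proj₁ (∈b G-Ord) (proj₁ (h α oα) α∈z)) >>= λ (ξ″ , ξ″∈ , k) → k >>= λ (β″ , β″∈ , q) →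
        let
          e₁ , e₂ = G-injective oα oξ′ (F-ordinals ξ″∈ β″∈) (Ord-∈ oκ ξ″∈) q
          ξ′∈ = ∈-respˡ (≈-sym e₂) ξ″∈
        in injective ξ′∈ ξ∈ (extensional λ β →
          (λ p → let oβ = F-ordinals ξ′∈ p in proj₁ (z⇿ oβ) (proj₂ (h β oβ) (proj₁ (section ξ′∈ oβ) p))) ,
          (λ p → let oβ = F-ordinals ξ∈ p in proj₂ (section ξ′∈ oβ) (proj₁ (h β oβ) (proj₂ (z⇿ oβ) p))))))
    where
    ordinals : M → M
    ordinals s = apply (sepᵒ (ordᵖ $ᵖ (varᵒ 0F ∷ [])) (varᵒ 0F)) (s ∷ [])

    ∈-ordinals : ∀ {s x} → x ∈ ordinals s ⇿ (x ∈ s × Ord x)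
    ∈-ordinals = ∈-sep (ordᵖ $ᵖ (varᵒ 0F ∷ [])) (varᵒ 0F)

    X : M
    X = apply (sepᵒ (exᵖ (varᵒ 0F ∈ᵖ varᵒ 1F)) 𝒫ᵒ) (ordinals a ∷ [])

    codes : M → M → M
    codes c κ = apply (⋃ᵒ $ᵒ (imageᵒ (imageᵒ (Gᵒ $ᵒ (varᵒ 0F ∷ varᵒ 1F ∷ []))
      (WellOrder.recᵒ $ᵒ (varᵒ 0F ∷ varᵒ 2F ∷ varᵒ 3F ∷ []))) (varᵒ 0F) ∷ [])) (κ ∷ X ∷ c ∷ [])

  -- SEP and REP need a formula of set theory for every formula of SO. Any translation with the
  -- right meaning will do; it is a parameter because the interpretation is extracted from the
  -- present module only later.
  module SOAxioms (translate : ∀ {n} (φ : Formula LSO n) → Formula L∈ n)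
    (⟦translate⟧ : ∀ {n} (φ : Formula LSO n) ρ → ⟦ translate φ ⟧ ρ ⇿ S.⟦ φ ⟧ ρ) where

    predicate : Formula LSO n → Predicate n
    predicate φ = record { formula = translate φ ; holds = S.⟦ φ ⟧ ; correct = ⟦translate⟧ φ }

    lookup-varsˢ : ∀ {m} {ρ : Vec M n} {r : Fin m → Fin n} i → S.value (lookup (tabulate (var ∘ r)) i) ρ ≡ lookup ρ (r i)
    lookup-varsˢ {ρ = ρ} i = cong (λ t → S.value t ρ) (lookup∘tabulate _ i)

    ⟦SO⟧ : ∀ {φ} → SO φ → S.⟦ φ ⟧ []
    ⟦SO⟧ SO-axioms.SOR = λ X Y →
      ((λ o ¬o → ¬o o) , by-contradiction) ,
      (λ (oX , oY , _) → oX , oY) , (λ (oX , ¬oY , _) → oX , ¬oY) , G-Ord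
    ⟦SO⟧ SO-axioms.WO = λ α oα β oβ γ oγ →
      ((λ (_ , _ , p) → ∉-self p) ,
       (λ ((_ , _ , p) , (_ , _ , q)) → oα , oγ , ∈-trans oγ p q) ,
       either (trichotomy oα oβ) (λ p → inl (oα , oβ , p)) λ c → either c
         (λ e → inr (inl (Eq-ord oα e))) (λ p → inr (inr (oβ , oα , p)))) ,
      λ a ¬oa h → h >>= λ (α , oα , _ , _ , α∈a) →
        least (varᵒ 0F ∈ᵖ varᵒ 1F) (a ∷ []) oα α∈a >>= λ (β , oβ , β∈a , min) →
        some β (oβ , (oβ , ¬oa , β∈a) , λ γ oγ (_ , _ , γ∈β) (_ , _ , γ∈a) → min γ γ∈β γ∈a)
    ⟦SO⟧ SO-axioms.INF = limit >>= λ (α , oα , ne , next) → some α (oα ,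
      (ne >>= λ (β , β∈) → some β (Ord-∈ oα β∈ , Ord-∈ oα β∈ , oα , β∈)) ,
      λ β oβ (_ , _ , β∈) → next β β∈ >>= λ (γ , β∈γ , γ∈) →
        some γ (Ord-∈ oα γ∈ , (oβ , Ord-∈ oα γ∈ , β∈γ) , (Ord-∈ oα γ∈ , oα , γ∈)))
    ⟦SO⟧ SO-axioms.EXT = λ a ¬oa b ¬ob h → inr (¬oa , ¬ob , λ α oα →
      (λ p → proj₂ (proj₂ (proj₁ (h α oα) (oα , ¬oa , p)))) ,
      (λ p → proj₂ (proj₂ (proj₂ (h α oα) (oα , ¬ob , p)))))
    ⟦SO⟧ SO-axioms.INI = λ α oα → set-of-ordinals α >>= λ (a , ¬oa , ∈a) → some a (¬oa , λ β oβ →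
      (λ (_ , _ , p) → oβ , ¬oa , proj₂ (∈a oβ) p) , (λ (_ , _ , p) → oβ , oα , proj₁ (∈a oβ) p))
    ⟦SO⟧ SO-axioms.BOU = λ a ¬oa → strict-bound a >>= λ (α , oα , bound) →
      some α (oα , λ β oβ (_ , _ , p) → oβ , oα , bound β p oβ)
    ⟦SO⟧ SO-axioms.GPF = λ α oα β oβ γ oγ →
      (λ le δ oδ ε oε l → G-Ord , oα , ∈∨≈⇒⊆ oα
        (either le (λ (_ , _ , p) → inl p) (λ e → inr (Eq⇒≈ G-Ord e))) _
        (G-monotone oδ oε oβ oγ (proj₁ (Less*⇿Less oδ oε oβ oγ) l))) ,
      -- If `α` were below `G β γ`, it would be `G δ ε` for a smaller pair, and the hypothesis would
      -- put it below itself.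
      (λ h → either (∉⇒∋∨≈ oα G-Ord (λ α∈ → G-initial oβ oγ α∈ >>= λ (δ , k) → k >>= λ (ε , (oδ , oε) , l , e) →
          let _ , _ , p = h δ oδ ε oε (proj₂ (Less*⇿Less oδ oε oβ oγ) l)
          in ∉-self (∈-respˡ (≈-sym e) p)))
        (λ p → inl (G-Ord , oα , p)) (λ e → inr (Eq-ord G-Ord e)))
    ⟦SO⟧ SO-axioms.SUR = λ α oα → G-surjective oα >>= λ (β , h) → h >>= λ (γ , (oβ , oγ) , e) →
      some β (oβ , some γ (oγ , Eq-ord oα e))
    ⟦SO⟧ (SO-axioms.SEP n φ) = proj₂ (S.⟦closure⟧ n _) λ ρ a ¬oa →
      separated (predicate φ) ρ a >>= λ (s , ∈s) → set-of-ordinals s >>= λ (b , ¬ob , ∈b) →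
      some b (¬ob , λ α oα → let at = S.⟦subst⟧ {ρ = α ∷ b ∷ a ∷ ρ} {ρ′ = α ∷ ρ} φ (λ where
                                 zero    → refl
                                 (suc i) → lookup-varsˢ i) in
        (λ (_ , _ , p) → let α∈a , q = proj₁ (∈s α) (proj₁ (∈b oα) p) in (oα , ¬oa , α∈a) , proj₂ at q) ,
        (λ ((_ , _ , p) , q) → oα , ¬ob , proj₂ (∈b oα) (proj₂ (∈s α) (p , proj₁ at q))))
    ⟦SO⟧ (SO-axioms.REP n φ) = proj₂ (S.⟦closure⟧ n _) λ ρ functional a ¬oa →
      -- The formula is assumed functional on ordinals only, so the restriction to ordinals goes
      -- into the predicate.
      replaced (ordᵖ $ᵖ (varᵒ 0F ∷ []) ∧ᵖ ordᵖ $ᵖ (varᵒ 1F ∷ []) ∧ᵖ predicate φ) ρ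
        (λ {ξ} {ζ₁} {ζ₂} (oξ , o₁ , p) (_ , o₂ , q) → Eq⇒≈ o₁ (functional ξ oξ ζ₁ o₁ ζ₂ o₂
          (proj₂ (S.⟦subst⟧ φ (λ where
             zero          → refl
             (suc zero)    → refl
             (suc (suc i)) → lookup-varsˢ i)) p ,
           proj₂ (S.⟦subst⟧ φ (λ where
             zero          → refl
             (suc zero)    → refl
             (suc (suc i)) → lookup-varsˢ i)) q))) a
      >>= λ (s , ∈s) → set-of-ordinals s >>= λ (b , ¬ob , ∈b) →
      some b (¬ob , λ ζ oζ → let at = λ ξ → S.⟦subst⟧ {ρ = ξ ∷ ζ ∷ b ∷ a ∷ ρ} {ρ′ = ξ ∷ ζ ∷ ρ} φ (λ where
                                 zero          → refl
                                 (suc zero)    → refl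
                                 (suc (suc i)) → lookup-varsˢ i) in
        (λ (_ , _ , p) → proj₁ (∈s ζ) (proj₁ (∈b oζ) p) >>= λ (ξ , ξ∈a , oξ , _ , q) →
          some ξ (oξ , (oξ , ¬oa , ξ∈a) , proj₂ (at ξ) q)) ,
        (λ h → oζ , ¬ob , proj₂ (∈b oζ) (proj₂ (∈s ζ) (h >>= λ (ξ , oξ , (_ , _ , ξ∈a) , q) →
          some ξ (ξ∈a , oξ , oζ , proj₁ (at ξ) q)))))
    ⟦SO⟧ SO-axioms.POW = λ a ¬oa → power-code a >>= λ (b , ¬ob , h) → some b (¬ob , λ z ¬oz (ne , sub) →
      h z (ne >>= λ (α , oα , _ , _ , p) → some α (oα , p))
          (λ α oα p → proj₂ (proj₂ (sub α oα (oα , ¬oz , p))))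
      >>= λ (ξ , (oξ , k) , unique) → some ξ
        ((oξ , λ β oβ →
           (λ (_ , _ , p) → G-Ord , ¬ob , proj₁ (k β oβ) p) ,
           (λ (_ , _ , p) → oβ , ¬oz , proj₂ (k β oβ) p)) ,
         λ ξ′ (oξ′ , k′) → Eq-ord oξ′ (unique ξ′ oξ′ λ β oβ →
           (λ p → proj₂ (proj₂ (proj₁ (k′ β oβ) (oβ , ¬oz , p)))) ,
           (λ p → proj₂ (proj₂ (proj₂ (k′ β oβ) (G-Ord , ¬ob , p)))))))

-- Semantics of definable structures

module Translation (𝓜 : Model) {L : Language} (𝒟 : Definition L∈ L)
  (⟦_⟧ᶠ : ∀ {k} → Fun L k → Vec (Model.M 𝓜) k → Model.M 𝓜)
  (⟦_⟧ᴿ : ∀ {k} → Rel L k → Vec (Model.M 𝓜) k → Set)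
  (_≃_ : Model.M 𝓜 → Model.M 𝓜 → Set)
  (univ-correct : ∀ x → Model.⟦_⟧ 𝓜 (Definition.univ 𝒟) (x ∷ []))
  (eq-correct : ∀ x y → Model.⟦_⟧ 𝓜 (Definition.eq 𝒟) (x ∷ y ∷ []) ⇿ x ≃ y)
  (rel-correct : ∀ {k} (r : Rel L k) ρ → Model.⟦_⟧ 𝓜 (Definition.rel′ 𝒟 r) ρ ⇿ ⟦ r ⟧ᴿ ρ)
  (fun-correct : ∀ {k} (f : Fun L k) ρ y → Model.⟦_⟧ 𝓜 (Definition.fun′ 𝒟 f) (y ∷ ρ) ⇿ Model._≈_ 𝓜 y (⟦ f ⟧ᶠ ρ))
  where
  open Definability 𝓜
  open Definition 𝒟
  private
    module L = Tarski L M 𝔽 ⟦_⟧ᶠ ⟦_⟧ᴿ _≃_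
    variable
      k m n : ℕ
      ρ : Vec M n

  ⟦univ⟧ : ∀ x → ⟦ univ ⟨ var zero ∷ [] ⟩ ⟧ (x ∷ ρ)
  ⟦univ⟧ x = proj₂ (⟦⟨⟩⟧ univ (var zero ∷ [])) (univ-correct x)

  ⟦∀ᵁ⟧ : ∀ (φ : Formula L∈ (suc n)) → ⟦ ∀ᵁ φ ⟧ ρ ⇿ (∀ x → ⟦ φ ⟧ (x ∷ ρ))
  ⟦∀ᵁ⟧ φ = (λ h x → h x (⟦univ⟧ x)) , (λ h x _ → h x)

  ⟦∃ᵁ⟧ : ∀ (φ : Formula L∈ (suc n)) → ⟦ ∃ᵁ φ ⟧ ρ ⇿ (∃̃ λ x → ⟦ φ ⟧ (x ∷ ρ))
  ⟦∃ᵁ⟧ φ = ⇿-∃ (λ x → proj₂ , (⟦univ⟧ x ,_))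

  ⟦∀ᵁ*⟧ : ∀ n (φ : Formula L∈ n) → ⟦ ∀ᵁ* n φ ⟧ [] ⇿ (∀ ρ → ⟦ φ ⟧ ρ)
  ⟦∀ᵁ*⟧ zero    φ = (λ { h [] → h }) , (λ h → h [])
  ⟦∀ᵁ*⟧ (suc n) φ = ⟦∀ᵁ*⟧ n (∀ᵁ φ) ⨾
    (λ { h (x ∷ ρ) → proj₁ (⟦∀ᵁ⟧ φ) (h ρ) x }) , (λ h ρ → proj₂ (⟦∀ᵁ⟧ φ) (λ x → h (x ∷ ρ)))

  ⟦∼⟧ : ∀ (s t : Term L∈ n) {ρ} → ⟦ s ∼ t ⟧ ρ ⇿ value s ρ ≃ value t ρ
  ⟦∼⟧ s t = ⟦⟨⟩⟧ eq (s ∷ t ∷ []) ⨾ eq-correct _ _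

  ⟦⟪⟫⟧  : ∀ (t : Term L n) {r : Fin n → Fin m} {σ : Vec M m} (χ : Formula L∈ (suc m)) →
    (∀ i → lookup σ (r i) ≡ lookup ρ i) → ⟦ ⟪ t ⟫ r χ ⟧ σ ⇿ ⟦ χ ⟧ (L.value t ρ ∷ σ)
  ⟦⟪⟫*⟧ : ∀ (ts : Vec (Term L n) k) {r : Fin n → Fin m} {σ : Vec M m} (χ : Formula L∈ (k + m)) →
    (∀ i → lookup σ (r i) ≡ lookup ρ i) → ⟦ ⟪ ts ⟫* r χ ⟧ σ ⇿ ⟦ χ ⟧ (L.values ts ρ ++ σ)
  ⟦⟪⟫⟧ (var i) {σ = σ} χ e = ⟦subst⟧ χ λ where
    zero    → e i
    (suc j) → cong (λ t → value t σ) (lookup∘tabulate var j)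
  ⟦⟪⟫⟧ {ρ = ρ} (fun {k} f ts) {σ = σ} χ e = ⟦⟪⟫*⟧ ts _ e ⨾ ⟦∃ᵁ⟧ (rename (_↑ˡ _) (fun′ f) ∧ rename (lift (k ↑ʳ_)) χ) ⨾
    ⇿-∃ (λ y → ⇿-×
      (⟦rename⟧ (fun′ f) (lookup-++ˡ (y ∷ L.values ts ρ) σ) ⨾ fun-correct f (L.values ts ρ) y)
      (⟦rename⟧ χ (lift-lookup (lookup-++ʳ (L.values ts ρ) σ)))) ⨾
    -- The quantifier yields the value of the term only up to `≈`, which every formula respects.
    (λ h → _>>=_ ⦃ ⟦⟧-stable χ ⦄ h (λ (y , p , q) → ⟦⟧-resp χ (p ∷ Pointwise.refl ≈-refl) q)) ,
    (λ q → some (L.value (fun f ts) ρ) (≈-refl , q))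
  ⟦⟪⟫*⟧ []       χ e = ⇿-refl
  ⟦⟪⟫*⟧ {ρ = ρ} (t ∷ ts) {σ = σ} χ e = ⟦⟪⟫*⟧ ts _ e ⨾
    ⟦⟪⟫⟧ t χ (λ i → trans (lookup-++ʳ (L.values ts ρ) σ _) (e i))

  ⟦ᴬ⟧ : ∀ (φ : Formula L n) ρ → ⟦ φ ᴬ ⟧ ρ ⇿ L.⟦ φ ⟧ ρ
  ⟦ᴬ⟧ (rel r ts) ρ = ⟦⟪⟫*⟧ ts _ (λ i → refl) ⨾
    ⟦rename⟧ (rel′ r) (lookup-++ˡ (L.values ts ρ) ρ) ⨾ rel-correct r _
  ⟦ᴬ⟧ (s ≐ t) ρ = ⟦⟪⟫*⟧ (s ∷ t ∷ []) _ (λ i → refl) ⨾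
    ⟦rename⟧ eq (lookup-++ˡ (L.values (s ∷ t ∷ []) ρ) ρ) ⨾ eq-correct _ _
  ⟦ᴬ⟧ ⊥       ρ = ⇿-refl
  ⟦ᴬ⟧ (φ ∧ ψ) ρ = ⇿-× (⟦ᴬ⟧ φ ρ) (⟦ᴬ⟧ ψ ρ)
  ⟦ᴬ⟧ (φ ∨ ψ) ρ = ⇿-∨ (⟦ᴬ⟧ φ ρ) (⟦ᴬ⟧ ψ ρ)
  ⟦ᴬ⟧ (φ ⇒ ψ) ρ = ⇿-→ (⟦ᴬ⟧ φ ρ) (⟦ᴬ⟧ ψ ρ)
  ⟦ᴬ⟧ (all φ) ρ = ⟦∀ᵁ⟧ (φ ᴬ) ⨾ ⇿-∀ (λ x → ⟦ᴬ⟧ φ (x ∷ ρ))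
  ⟦ᴬ⟧ (ex φ)  ρ = ⟦∃ᵁ⟧ (φ ᴬ) ⨾ ⇿-∃ (λ x → ⟦ᴬ⟧ φ (x ∷ ρ))

  ⟦⋀⟧ : ∀ k {φ : Fin k → Formula L∈ n} → ⟦ ⋀ k φ ⟧ ρ → ∀ i → ⟦ φ i ⟧ ρ
  ⟦⋀⟧ (suc k) (p , q) zero    = p
  ⟦⋀⟧ (suc k) (p , q) (suc i) = ⟦⋀⟧ k q i

  ⟦Inhabited⟧ : M → ⟦ Inhabited ⟧ []
  ⟦Inhabited⟧ x = some x (univ-correct x)

  private
    x y z : Term L∈ (3 + n)
    x = var zero
    y = var (suc zero)
    z = var (suc (suc zero))

  ⟦Functional⟧ : (∀ {x y} → x ≈ y → x ≃ y) → ∀ {k} (f : Fun L k) → ⟦ Functional f ⟧ []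
  ⟦Functional⟧ i {k} f = proj₂ (⟦∀ᵁ*⟧ k (∃ᵁ (fun′ f ∧ ∀ᵁ unique))) λ ρ → proj₂ (⟦∃ᵁ⟧ (fun′ f ∧ ∀ᵁ unique))
    (some (⟦ f ⟧ᶠ ρ) (proj₂ (fun-correct f ρ _) ≈-refl , proj₂ (⟦∀ᵁ⟧ unique) λ y p →
      proj₂ (⟦∼⟧ (var zero) (var (suc zero)))
        (i (proj₁ (⟦rename⟧ (fun′ f) (lift-lookup (λ _ → refl)) ⨾ fun-correct f ρ y) p))))
    where unique = rename (lift suc) (fun′ f) ⇒ var zero ∼ var (suc zero)

  ⟦Reflexive⟧ : (∀ x → x ≃ x) → ⟦ Reflexive ⟧ []
  ⟦Reflexive⟧ h = proj₂ (⟦∀ᵁ*⟧ 1 (var zero ∼ var zero)) λ { (x ∷ []) → proj₂ (⟦∼⟧ (var zero) (var zero)) (h x) }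

  ⟦Symmetric⟧ : (∀ {x y} → x ≃ y → y ≃ x) → ⟦ Symmetric ⟧ []
  ⟦Symmetric⟧ h = proj₂ (⟦∀ᵁ*⟧ 2 (var zero ∼ var (suc zero) ⇒ var (suc zero) ∼ var zero)) λ { (a ∷ b ∷ []) →
    proj₂ (⟦∼⟧ (var (suc zero)) (var zero)) ∘ h ∘ proj₁ (⟦∼⟧ (var zero) (var (suc zero))) }

  ⟦Transitive⟧ : (∀ {x y z} → x ≃ y → y ≃ z → x ≃ z) → ⟦ Transitive ⟧ []
  ⟦Transitive⟧ h = proj₂ (⟦∀ᵁ*⟧ 3 (x ∼ y ∧ y ∼ z ⇒ x ∼ z)) λ { (a ∷ b ∷ c ∷ []) (p , q) →
    proj₂ (⟦∼⟧ x z) (h (proj₁ (⟦∼⟧ x y) p) (proj₁ (⟦∼⟧ y z) q)) }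

  ⟦RelCongruent⟧ : ∀ {k} (r : Rel L k) →
    (∀ {ρ σ} → (∀ i → lookup ρ i ≃ lookup σ i) → ⟦ r ⟧ᴿ ρ ⇿ ⟦ r ⟧ᴿ σ) → ⟦ RelCongruent r ⟧ []
  ⟦RelCongruent⟧ {k} r h = proj₂ (⟦∀ᵁ*⟧ (k + k) _) λ τ → helper τ (splitAt k τ)
    where
    helper : ∀ τ → Σ (Vec M k) (λ ρ → Σ (Vec M k) λ σ → τ ≡ ρ ++ σ) → _
    helper τ (ρ , σ , refl) p =
      ⟦rename⟧ (rel′ r) (lookup-++ˡ ρ σ) ⨾ rel-correct r ρ ⨾
      h (λ i → proj₁ (≡⇒⇿ (λ z → proj₁ z ≃ proj₂ z) (cong₂ _,_ (lookup-++ˡ ρ σ i) (lookup-++ʳ ρ σ i)))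
        (proj₁ (⟦∼⟧ (v i) (w i)) (⟦⋀⟧ k p i))) ⨾
      ⇿-sym (⟦rename⟧ (rel′ r) (lookup-++ʳ ρ σ) ⨾ rel-correct r σ)

  ⟦FunCongruent⟧ : (∀ {x y x′ y′} → x ≈ x′ → y ≈ y′ → x′ ≃ y′ → x ≃ y) → ∀ {k} (f : Fun L k) →
    (∀ {ρ σ} → (∀ i → lookup ρ i ≃ lookup σ i) → ⟦ f ⟧ᶠ ρ ≃ ⟦ f ⟧ᶠ σ) → ⟦ FunCongruent f ⟧ []
  ⟦FunCongruent⟧ resp {k} f h = proj₂ (⟦∀ᵁ*⟧ (suc k + suc k) (⋀ k (λ i → v (suc i) ∼ w (suc i)) ∧ at-v (fun′ f) ∧ at-w (fun′ f) ⇒ v {suc k} zero ∼ w zero)) λ τ → helper τ (splitAt (suc k) τ)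
    where
    helper : ∀ τ → Σ (Vec M (suc k)) (λ ρ → Σ (Vec M (suc k)) λ σ → τ ≡ ρ ++ σ) → _
    helper τ (x ∷ ρ , y ∷ σ , refl) (p , q , q′) = proj₂ (⟦∼⟧ (v {suc k} zero) (w zero))
      (proj₂ (≡⇒⇿ (λ z → x ≃ z) (lookup-++ʳ (x ∷ ρ) (y ∷ σ) zero)) (resp
        (proj₁ (⟦rename⟧ (fun′ f) (lookup-++ˡ (x ∷ ρ) (y ∷ σ)) ⨾ fun-correct f ρ x) q)
        (proj₁ (⟦rename⟧ (fun′ f) (lookup-++ʳ (x ∷ ρ) (y ∷ σ)) ⨾ fun-correct f σ y) q′)
        (h (λ i → proj₁ (≡⇒⇿ (λ z → proj₁ z ≃ proj₂ z)
          (cong₂ _,_ (lookup-++ˡ ρ (y ∷ σ) i) (lookup-++ʳ (x ∷ ρ) (y ∷ σ) (suc i))))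
          (proj₁ (⟦∼⟧ (v (suc i)) (w (suc i))) (⟦⋀⟧ k p i))))))

-- A model with true falsum satisfies every sentence.  The defining formulas do
-- not depend on the model, so they can be read off in this one.
module Trivial where
  open ∈-Semantics ⊤ ⊤ (λ _ _ → ⊤) (λ _ _ → ⊤)

  everything : ∀ {n} (φ : Formula L∈ n) ρ → ⟦ φ ⟧ ρ
  everything (rel mem (s ∷ t ∷ [])) ρ = tt
  everything (s ≐ t) ρ = tt
  everything ⊥       ρ = tt
  everything (φ ∧ ψ) ρ = everything φ ρ , everything ψ ρ
  everything (φ ∨ ψ) ρ = λ _ _ → tt
  everything (φ ⇒ ψ) ρ = λ _ → everything ψ ρ
  everything (all φ) ρ = λ x → everything φ (x ∷ ρ)
  everything (ex φ)  ρ = λ _ → tt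

  model : Model
  model = record
    { M = ⊤ ; 𝔽 = ⊤ ; _∈_ = λ _ _ → ⊤ ; _≈_ = λ _ _ → ⊤
    ; ∈-stable = λ _ → tt ; ≈-stable = λ _ → tt ; ≈-refl = tt
    ; ≈-subst = λ φ _ _ → everything φ _
    ; witness = λ _ _ → tt
    ; witness-correct = λ φ _ → everything φ _ }

  axioms : ∀ {τ} → ZFC τ → Model.⟦_⟧ model τ []
  axioms {τ} _ = everything τ []

  open OrdinalModel model axioms public using (ordᵖ; sordᵖ; ltᵖ; memᵖ; eqᵖ; Gᵒ)
  open Definability model public using (formula; graph)

interpretation : Definition L∈ LSO
interpretation = record
  { univ = ⊥ ⇒ ⊥
  ; eq   = formula eqᵖ
  ; rel′ = λ where
      RelSO.ord  → formula ordᵖ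
      RelSO.sord → formula sordᵖ
      RelSO.lt   → formula ltᵖ
      RelSO.mem  → formula memᵖ
  ; fun′ = λ where
      FunSO.g → graph Gᵒ }
  where open Trivial

-- Correctness of the interpretation in an arbitrary model.

module Interpretation (𝓜 : Model) (axioms : ∀ {τ} → ZFC τ → Model.⟦_⟧ 𝓜 τ []) where
  open OrdinalModel 𝓜 axioms public

  opaque
    unfolding SetTheory.pairˢ SetTheory.∪ᵒ SetTheory.tupleᵒ TransfiniteRecursion.belowᵒ TransfiniteRecursion.Recursion.recˢ GoedelPairing.newPairᵈ GoedelPairing.indexᵈ

    -- No graph mentions the model, so once the opaque operations are unfolded both sides compute to
    -- the same formula. The relation formulas contain no opaque operation and need no such step.
    G-graph : graph Gᵒ ≡ Trivial.graph Trivial.Gᵒ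
    G-graph = refl

  ⟦G⟧ : ∀ {k} (f : FunSO k) ρ y → ⟦ Definition.fun′ interpretation f ⟧ (y ∷ ρ) ⇿ y ≈ SOfunction f ρ
  ⟦G⟧ FunSO.g (a ∷ b ∷ []) y = ≡⇒⇿ (λ φ → ⟦ φ ⟧ (y ∷ a ∷ b ∷ [])) (sym G-graph) ⨾ Operation.correct Gᵒ (a ∷ b ∷ [])

  ⟦relation⟧ : ∀ {k} (r : RelSO k) ρ → ⟦ Definition.rel′ interpretation r ⟧ ρ ⇿ SOrelation r ρ
  ⟦relation⟧ RelSO.ord  (x ∷ [])     = Predicate.correct ordᵖ (x ∷ [])
  ⟦relation⟧ RelSO.sord (x ∷ [])     = Predicate.correct sordᵖ (x ∷ [])
  ⟦relation⟧ RelSO.lt   (x ∷ y ∷ []) = Predicate.correct ltᵖ (x ∷ y ∷ [])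
  ⟦relation⟧ RelSO.mem  (x ∷ y ∷ []) = Predicate.correct memᵖ (x ∷ y ∷ [])

  open Translation 𝓜 interpretation SOfunction SOrelation Eq (λ _ → id)
    (λ x y → Predicate.correct eqᵖ (x ∷ y ∷ [])) ⟦relation⟧ ⟦G⟧ public
  open SOAxioms (Definition._ᴬ interpretation) ⟦ᴬ⟧ public

  relation-resp : ∀ {k} (r : RelSO k) {ρ σ} → (∀ i → Eq (lookup ρ i) (lookup σ i)) → SOrelation r ρ → SOrelation r σ
  relation-resp RelSO.ord  {_ ∷ []} {_ ∷ []} e = Ord-Eq (e zero)
  relation-resp RelSO.sord {_ ∷ []} {_ ∷ []} e = ¬Ord-Eq (e zero)
  relation-resp RelSO.lt   {_ ∷ _ ∷ []} {_ ∷ _ ∷ []} e = Lt-Eq (e zero) (e (suc zero))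
  relation-resp RelSO.mem  {_ ∷ _ ∷ []} {_ ∷ _ ∷ []} e = Mem-Eq (e zero) (e (suc zero))

  function-resp : ∀ {k} (f : FunSO k) {ρ σ} → (∀ i → Eq (lookup ρ i) (lookup σ i)) → Eq (SOfunction f ρ) (SOfunction f σ)
  function-resp FunSO.g {_ ∷ _ ∷ []} {_ ∷ _ ∷ []} e = G-Eq (e zero) (e (suc zero))

ZFC-completeness : ∀ {σ} → (∀ 𝓜 → (∀ {τ} → ZFC τ → Model.⟦_⟧ 𝓜 τ []) → Model.⟦_⟧ 𝓜 σ []) → ZFC ⊢ σ
ZFC-completeness = completeness

theorem3 : ZFC Interprets SO
theorem3 = structure , λ {φ} s → ZFC-completeness λ 𝓜 axioms →
    let open Interpretation 𝓜 axioms in proj₂ (⟦ᴬ⟧ φ []) (⟦SO⟧ s)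
  where
  structure : DefinableStructure ZFC LSO
  structure = record
    { definition = interpretation
    ; inhabited = ZFC-completeness λ 𝓜 axioms →
        let open Interpretation 𝓜 axioms in ⟦Inhabited⟧ ∅
    ; functional = λ f → ZFC-completeness λ 𝓜 axioms →
        let open Interpretation 𝓜 axioms in ⟦Functional⟧ ≈⇒Eq f
    ; ∼-reflexive = ZFC-completeness λ 𝓜 axioms →
        let open Interpretation 𝓜 axioms in ⟦Reflexive⟧ (λ _ → Eq-refl)
    ; ∼-symmetric = ZFC-completeness λ 𝓜 axioms →
        let open Interpretation 𝓜 axioms in ⟦Symmetric⟧ Eq-sym
    ; ∼-transitive = ZFC-completeness λ 𝓜 axioms →
        let open Interpretation 𝓜 axioms in ⟦Transitive⟧ Eq-trans
    ; rel-congruent = λ r → ZFC-completeness λ 𝓜 axioms →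
        let open Interpretation 𝓜 axioms in ⟦RelCongruent⟧ r λ e →
          relation-resp r e , relation-resp r (Eq-sym ∘ e)
    ; fun-congruent = λ f → ZFC-completeness λ 𝓜 axioms →
        let open Interpretation 𝓜 axioms in ⟦FunCongruent⟧
          (λ e e′ h → Eq-trans (≈⇒Eq e) (Eq-trans h (≈⇒Eq (≈-sym e′)))) f (function-resp f) }
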